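{- Let $p$ be a prime and $r\in\mathbb N_{>1}$. Let $k_1,\ldots,k_r\in\mathbb Z$ with $k_1+\cdots+k_r\not\equiv r\pmod2$, $\gamma_1\in\mathbb Z_p$, $\gamma_2,\ldots,\gamma_r\in p\mathbb Z_p$ and $c\in\mathbb Z_p^\times$. Then for all $s_1,\ldots,s_r\in\mathbb Z_p$, \begin{align*} &L_{p,r}(s_1,\ldots,s_r;\omega^{k_1},\ldots,\omega^{k_r};\gamma_1,\gamma_2,\ldots,\gamma_r;c)\\ &=-\sum_{\substack{J\subsetneq\{1,\ldots,r\}\\ 1\in J}}\Bigl(\frac{1-c}2\Bigr)^{r-|J|}L_{p,|J|}\Bigl(\Bigl(\sum_{j_\mu(J)\le l<j_{\mu+1}(J)}s_l\Bigr)_{\mu=1}^{|J|};\bigl(\omega^{\sum_{j_\mu(J)\le l<j_{\mu+1}(J)}k_l}\bigr)_{\mu=1}^{|J|};(\gamma_j)_{j\in J};c\Bigr), \end{align*} where for $J\subset\{1,\ldots,r\}$ with $1\in J$ one writes $J=\{j_1(J),\ldots,j_{|J|}(J)\}$ with $1=j_1(J)<\cdots<j_{|J|}(J)$ and sets $j_{|J|+1}(J)=r+1$.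
   Context: Put $q=4$ if $p=2$ and $q=p$ if $p\ge3$. Let $W=\{\pm1\}$ if $p=2$ and $W=\{\xi\in\mathbb Z_p^\times:\xi^{p-1}=1\}$ if $p\ge3$. Write $x=\omega(x)\langle x\rangle$ for the decomposition $\mathbb Z_p^\times=W\times(1+q\mathbb Z_p)$, $\omega^k(x)=\omega(x)^k$, and $\langle x\rangle^s=\sum_{n\ge0}\binom sn(\langle x\rangle-1)^n$ for $s\in\mathbb C_p$, $|s|_p<qp^{ -1/(p-1)}$. For $c\in\mathbb Z_p^\times$ let $g_c(T)=\frac1{(1+T)-1}-\frac c{(1+T)^c-1}\in\mathbb Z_p[[T]]$, and let $\widetilde{\mathfrak m}_c$ be the $\mathbb Z_p$-valued measure on $\mathbb Z_p$ corresponding to $g_c(T)$ under the identification $\mathrm{Meas}_{\mathbb Z_p}(\mathbb Z_p)\simeq\mathbb Z_p[[\mathbb Z_p]]\simeq\mathbb Z_p[[T]]$ sending $1\in\mathbb Z_p$ (as group element) to $1+T$; that is, $\int_{\mathbb Z_p}(1+T)^x\,d\widetilde{\mathfrak m}_c(x)=g_c(T)$. (For an integer $c>1$ prime to $p$ it is the measure with $\widetilde{\mathfrak m}_c(j+p^N\mathbb Z_p)=\sum_{\xi^c=1,\xi\ne1}\frac{\xi^j}{1-\xi^{p^N}}$, $0\le j<p^N$.) For $r\in\mathbb N$, $k_j\in\mathbb Z$, $\gamma_j\in\mathbb Z_p$, $c\in\mathbb Z_p^\times$ and $s_j\in\mathbb C_p$ with $|s_j|_p<qp^{ -1/(p-1)}$,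 the $p$-adic multiple $L$-function of depth $r$ is $$L_{p,r}(s_1,\ldots,s_r;\omega^{k_1},\ldots,\omega^{k_r};\gamma_1,\ldots,\gamma_r;c)=\int_{(\mathbb Z_p^r)'_{\{\gamma_j\}}}\prod_{k=1}^r\Bigl\langle\sum_{j=1}^kx_j\gamma_j\Bigr\rangle^{ -s_k}\omega^{k_k}\Bigl(\sum_{j=1}^kx_j\gamma_j\Bigr)\prod_{j=1}^rd\widetilde{\mathfrak m}_c(x_j),$$ where $(\mathbb Z_p^r)'_{\{\gamma_j\}}=\{(x_j)\in\mathbb Z_p^r:p\nmid\sum_{j=1}^kx_j\gamma_j\text{ for all }1\le k\le r\}$; it is interpreted as $0$ when this set is empty (e.g. when $\gamma_1\in p\mathbb Z_p$). -}

module Defs where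

open import Algebra.Bundles using (CommutativeRing; RawMonoid)
open import Data.Bool.Base using (true; false; if_then_else_)
open import Data.Fin.Base as Fin using (Fin; zero; suc; toℕ; combine)
import Data.Fin.Properties as Fin
open import Data.Fin.Subset using (Subset; inside; outside; ∣_∣; ⊤)
open import Data.Fin.Subset.Properties using (_∈?_; _⊂?_)
open import Data.Integer.Base as ℤ using (ℤ; +_; -[1+_])
import Data.Integer.DivMod as ℤ
import Data.Integer.Properties as ℤ
open import Data.Integer.Divisibility.Signed as ℤ∣ using (divides)
open import Data.Integer.Tactic.RingSolver using (solve-∀)
open import Data.List.Base as List using (List; _++_; filter)
open import Data.Nat.Base as ℕ using (ℕ; zero; suc; _≤_; _<_; s≤s; z≤n; NonZero; _!)
open import Data.Nat.Combinatorics using (_C_; nCk+nC[k+1]≡[n+1]C[k+1]; k>n⇒nCk≡0; nCn≡1)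
import Data.Nat.Divisibility as ℕ
import Data.Nat.DivMod as ℕ
open import Data.Nat.Primality using (Prime; euclidsLemma; prime⇒nonZero; prime⇒nonTrivial; prime⇒irreducible)
import Data.Nat.Properties as ℕ
open import Data.Product.Base using (Σ; _,_; proj₁; proj₂)
open import Data.Sum.Base using (_⊎_; inj₁; inj₂)
import Data.Vec.Base as Vec
open import Data.Vec.Functional using (Vector; _∷_)
open import Level using (0ℓ)
open import Relation.Binary.PropositionalEquality
open import Relation.Nullary using (¬_; Dec; yes; no; does; ¬?; _×-dec_; contradiction)

allSubsets : ∀ n → List (Subset n)
allSubsets zero    = List.[ Vec.[] ]
allSubsets (suc n) = List.map (outside Vec.∷_) (allSubsets n) ++ List.map (inside Vec.∷_) (allSubsets n)

-- The subsets J ⊊ {0, …, n} with 0 ∈ J.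
properSubsets∋0 : ∀ n → List (Subset (suc n))
properSubsets∋0 n = filter (λ J → (zero ∈? J) ×-dec (J ⊂? ⊤)) (allSubsets (suc n))

-- The increasing enumeration of J.
element : ∀ {n} (J : Subset n) → Fin ∣ J ∣ → Fin n
element (inside  Vec.∷ J) zero    = zero
element (inside  Vec.∷ J) (suc μ) = suc (element J μ)
element (outside Vec.∷ J) μ       = suc (element J μ)

-- The same enumeration, indexed by all of ℕ and extended by the value n beyond the last element.
position : ∀ {n} → Subset n → ℕ → ℕ
position Vec.[]               μ       = 0
position (inside  Vec.∷ J) zero    = 0
position (inside  Vec.∷ J) (suc μ) = suc (position J μ)
position (outside Vec.∷ J) μ       = suc (position J μ)

position≡element : ∀ {n} (J : Subset n) μ → position J (toℕ μ) ≡ toℕ (element J μ)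
position≡element (inside  Vec.∷ J) zero    = refl
position≡element (inside  Vec.∷ J) (suc μ) = cong suc (position≡element J μ)
position≡element (outside Vec.∷ J) μ       = cong suc (position≡element J μ)

position-end : ∀ {n} (J : Subset n) → position J ∣ J ∣ ≡ n
position-end Vec.[]            = refl
position-end (inside  Vec.∷ J) = cong suc (position-end J)
position-end (outside Vec.∷ J) = cong suc (position-end J)

module _ {a ℓ} (M : RawMonoid a ℓ) where
  open RawMonoid M using (Carrier; ε)
  open import Algebra.Definitions.RawMonoid M using (sum)

  -- The sum of v l over the l that lie between the μ-th element of J and the next one.
  blockSum : ∀ {n} (J : Subset n) → Vector Carrier n → Vector Carrier ∣ J ∣
  blockSum J v μ = sum λ l →
    if does ((position J (toℕ μ) ℕ.≤? toℕ l) ×-dec (toℕ l ℕ.<? position J (suc (toℕ μ)))) then v l else ε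

module Integers where
  open import Data.Integer.Base using (_+_; _*_; _-_; -_; _^_)
  open ℤ∣ using (_∣_)

  infix 4 _≡_[mod_]

  record _≡_[mod_] (a b m : ℤ) : Set where
    constructor mod
    field divides-difference : m ∣ a - b
  open _≡_[mod_] public

  module _ {m : ℤ} where
    mod-reflexive : ∀ {a b} → a ≡ b → a ≡ b [mod m ]
    mod-reflexive {a} refl = mod (divides (+ 0) (ℤ.+-inverseʳ a))

    mod-refl : ∀ {a} → a ≡ a [mod m ]
    mod-refl = mod-reflexive refl

    mod-sym : ∀ {a b} → a ≡ b [mod m ] → b ≡ a [mod m ]
    mod-sym {a} {b} (mod d) = mod (subst (m ∣_) (lemma a b) (ℤ∣.∣m⇒∣-m d))
      where lemma : ∀ a b → - (a - b) ≡ b - a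
            lemma = solve-∀

    mod-trans : ∀ {a b c} → a ≡ b [mod m ] → b ≡ c [mod m ] → a ≡ c [mod m ]
    mod-trans {a} {b} {c} (mod d) (mod e) = mod (subst (m ∣_) (lemma a b c) (ℤ∣.∣m∣n⇒∣m+n d e))
      where lemma : ∀ a b c → (a - b) + (b - c) ≡ a - c
            lemma = solve-∀

    mod-+ : ∀ {a b c d} → a ≡ b [mod m ] → c ≡ d [mod m ] → a + c ≡ b + d [mod m ]
    mod-+ {a} {b} {c} {d} (mod h) (mod k) = mod (subst (m ∣_) (lemma a b c d) (ℤ∣.∣m∣n⇒∣m+n h k))
      where lemma : ∀ a b c d → (a - b) + (c - d) ≡ (a + c) - (b + d)
            lemma = solve-∀

    mod-* : ∀ {a b c d} → a ≡ b [mod m ] → c ≡ d [mod m ] → a * c ≡ b * d [mod m ]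
    mod-* {a} {b} {c} {d} (mod h) (mod k) =
      mod (subst (m ∣_) (lemma a b c d) (ℤ∣.∣m∣n⇒∣m+n (ℤ∣.∣m⇒∣m*n c h) (ℤ∣.∣n⇒∣m*n b k)))
      where lemma : ∀ a b c d → (a - b) * c + b * (c - d) ≡ a * c - b * d
            lemma = solve-∀

    mod-neg : ∀ {a b} → a ≡ b [mod m ] → - a ≡ - b [mod m ]
    mod-neg {a} {b} (mod d) = mod (subst (m ∣_) (lemma a b) (ℤ∣.∣m⇒∣-m d))
      where lemma : ∀ a b → - (a - b) ≡ - a - - b
            lemma = solve-∀

    mod-^ : ∀ {a b} n → a ≡ b [mod m ] → a ^ n ≡ b ^ n [mod m ]
    mod-^ zero    h = mod-refl
    mod-^ (suc n) h = mod-* h (mod-^ n h)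

    ∣⇒mod0 : ∀ {a} → m ∣ a → a ≡ + 0 [mod m ]
    ∣⇒mod0 {a} d = mod (subst (m ∣_) (sym (ℤ.+-identityʳ a)) d)

    mod0⇒∣ : ∀ {a} → a ≡ + 0 [mod m ] → m ∣ a
    mod0⇒∣ {a} (mod d) = subst (m ∣_) (ℤ.+-identityʳ a) d

  mod-weaken : ∀ {m n a b} → m ∣ n → a ≡ b [mod n ] → a ≡ b [mod m ]
  mod-weaken d (mod e) = mod (ℤ∣.∣-trans d e)

  Σ< : ℕ → (ℕ → ℤ) → ℤ
  Σ< zero    f = + 0
  Σ< (suc n) f = Σ< n f + f n

  Σ<-cong : ∀ n {f g : ℕ → ℤ} → (∀ i → f i ≡ g i) → Σ< n f ≡ Σ< n g
  Σ<-cong zero    h = refl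
  Σ<-cong (suc n) h = cong₂ _+_ (Σ<-cong n h) (h n)

  Σ<-shift : ∀ n f → Σ< (suc n) f ≡ f 0 + Σ< n (λ i → f (suc i))
  Σ<-shift zero    f = ℤ.+-comm (+ 0) (f 0)
  Σ<-shift (suc n) f = trans (cong (_+ f (suc n)) (Σ<-shift n f)) (ℤ.+-assoc (f 0) _ _)

  Σ<-+ : ∀ n f g → Σ< n f + Σ< n g ≡ Σ< n (λ i → f i + g i)
  Σ<-+ zero    f g = refl
  Σ<-+ (suc n) f g = trans (lemma (Σ< n f) (f n) (Σ< n g) (g n)) (cong (_+ (f n + g n)) (Σ<-+ n f g))
    where lemma : ∀ a b c d → (a + b) + (c + d) ≡ (a + c) + (b + d)
          lemma = solve-∀

  Σ<-mod0 : ∀ {m} n f → (∀ i → i < n → f i ≡ + 0 [mod m ]) → Σ< n f ≡ + 0 [mod m ]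
  Σ<-mod0 zero    f h = mod-refl
  Σ<-mod0 (suc n) f h = mod-+ {b = + 0} {d = + 0} (Σ<-mod0 n f (λ i i<n → h i (ℕ.m<n⇒m<1+n i<n))) (h n ℕ.≤-refl)

  -- The falling factorial a(a-1)⋯(a-n+1).
  fall : ℤ → ℕ → ℤ
  fall a zero    = + 1
  fall a (suc n) = fall a n * (a - + n)

  fall-mod : ∀ {m a b} n → a ≡ b [mod m ] → fall a n ≡ fall b n [mod m ]
  fall-mod zero    h = mod-refl
  fall-mod (suc n) h = mod-* (fall-mod n h) (mod-+ h mod-refl)

  fall-suc : ∀ a n → fall (+ 1 + a) (suc n) ≡ (+ 1 + a) * fall a n
  fall-suc a zero    = lemma a
    where lemma : ∀ a → + 1 * ((+ 1 + a) - + 0) ≡ (+ 1 + a) * + 1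
          lemma = solve-∀
  fall-suc a (suc n) = trans (cong (_* ((+ 1 + a) - + suc n)) (fall-suc a n)) (lemma a (+ n) (fall a n))
    where lemma : ∀ a n f → ((+ 1 + a) * f) * ((+ 1 + a) - (+ 1 + n)) ≡ (+ 1 + a) * (f * (a - n))
          lemma = solve-∀

  fall-C : ∀ m n → + (n !) * + (m C n) ≡ fall (+ m) n
  fall-C zero    zero    = refl
  fall-C zero    (suc n) = trans (cong (λ z → + (suc n !) * + z) (k>n⇒nCk≡0 {0} {suc n} (s≤s z≤n)))
                                 (trans (ℤ.*-zeroʳ (+ (suc n !))) (sym (lemma n)))
    where lemma : ∀ n → fall (+ 0) (suc n) ≡ + 0
          lemma zero    = refl
          lemma (suc n) = cong (_* (+ 0 - + suc n)) (lemma n)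
  fall-C (suc m) zero    = refl
  fall-C (suc m) (suc n) = begin
    + (suc n !) * + (suc m C suc n)
      ≡⟨ cong (λ z → + (suc n !) * + z) (sym (nCk+nC[k+1]≡[n+1]C[k+1] m n)) ⟩
    + (suc n !) * (+ (m C n) + + (m C suc n))
      ≡⟨ ℤ.*-distribˡ-+ (+ (suc n !)) (+ (m C n)) (+ (m C suc n)) ⟩
    + (suc n !) * + (m C n) + + (suc n !) * + (m C suc n)
      ≡⟨ cong₂ _+_ (trans (cong (_* + (m C n)) (ℤ.pos-* (suc n) (n !))) (ℤ.*-assoc (+ suc n) (+ (n !)) (+ (m C n))))
                   (fall-C m (suc n)) ⟩
    + suc n * (+ (n !) * + (m C n)) + fall (+ m) n * (+ m - + n)
      ≡⟨ cong (λ z → + suc n * z + fall (+ m) n * (+ m - + n)) (fall-C m n) ⟩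
    + suc n * fall (+ m) n + fall (+ m) n * (+ m - + n)
      ≡⟨ lemma (+ n) (+ m) (fall (+ m) n) ⟩
    (+ 1 + + m) * fall (+ m) n
      ≡⟨ sym (fall-suc (+ m) n) ⟩
    fall (+ suc m) (suc n) ∎
    where open ≡-Reasoning
          lemma : ∀ n m f → (+ 1 + n) * f + f * (m - n) ≡ (+ 1 + m) * f
          lemma = solve-∀

  n!≢0 : ∀ n → NonZero (n !)
  n!≢0 zero = _
  n!≢0 (suc n) = ℕ.m*n≢0 (suc n) (n !) {{_}} {{n!≢0 n}}

  absorption : ∀ m n → + suc n * + (suc m C suc n) ≡ + suc m * + (m C n)
  absorption m n = ℤ.*-cancelˡ-≡ (+ (n !)) _ _ {{n!≢0 n}} (begin
    + (n !) * (+ suc n * + (suc m C suc n))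
      ≡⟨ lemma (+ (n !)) (+ suc n) (+ (suc m C suc n)) ⟩
    + suc n * + (n !) * + (suc m C suc n)
      ≡⟨ cong (_* + (suc m C suc n)) (sym (ℤ.pos-* (suc n) (n !))) ⟩
    + (suc n !) * + (suc m C suc n)
      ≡⟨ fall-C (suc m) (suc n) ⟩
    fall (+ suc m) (suc n)
      ≡⟨ fall-suc (+ m) n ⟩
    + suc m * fall (+ m) n
      ≡⟨ cong (+ suc m *_) (sym (fall-C m n)) ⟩
    + suc m * (+ (n !) * + (m C n))
      ≡⟨ lemma′ (+ suc m) (+ (n !)) (+ (m C n)) ⟩
    + (n !) * (+ suc m * + (m C n)) ∎)
    where open ≡-Reasoning
          lemma : ∀ a b c → a * (b * c) ≡ b * a * c
          lemma = solve-∀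
          lemma′ : ∀ a b c → a * (b * c) ≡ b * (a * c)
          lemma′ = solve-∀

  -- The umbral form of (1 + X)ⁿ, in which Xⁱ is replaced by a i.
  binomialSum : ℕ → (ℕ → ℤ) → ℤ
  binomialSum zero    a = a 0
  binomialSum (suc n) a = binomialSum n a + binomialSum n (λ i → a (suc i))

  binomialSum-C : ∀ n a → binomialSum n a ≡ Σ< (suc n) (λ i → + (n C i) * a i)
  binomialSum-C zero    a = lemma (a 0)
    where lemma : ∀ a → a ≡ + 0 + + 1 * a
          lemma = solve-∀
  binomialSum-C (suc n) a = begin
    binomialSum n a + binomialSum n b
      ≡⟨ cong₂ _+_ (binomialSum-C n a) (binomialSum-C n b) ⟩
    Σ< (suc n) A + Σ< (suc n) B
      ≡⟨ cong (_+ Σ< (suc n) B) (sym (trans (cong (λ z → Σ< (suc n) A + + z * a (suc n)) (k>n⇒nCk≡0 {n} {suc n} (s≤s ℕ.≤-refl))) (ℤ.+-identityʳ (Σ< (suc n) A)))) ⟩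
    Σ< (suc (suc n)) A + Σ< (suc n) B
      ≡⟨ cong (_+ Σ< (suc n) B) (Σ<-shift (suc n) A) ⟩
    (A 0 + Σ< (suc n) (λ i → A (suc i))) + Σ< (suc n) B
      ≡⟨ lemma (A 0) (Σ< (suc n) (λ i → A (suc i))) (Σ< (suc n) B) ⟩
    A 0 + (Σ< (suc n) B + Σ< (suc n) (λ i → A (suc i)))
      ≡⟨ cong (λ z → A 0 + z) (Σ<-+ (suc n) B (λ i → A (suc i))) ⟩
    A 0 + Σ< (suc n) (λ i → B i + A (suc i))
      ≡⟨ cong (λ z → A 0 + z) (Σ<-cong (suc n) (λ i → trans (sym (ℤ.*-distribʳ-+ (a (suc i)) (+ (n C i)) (+ (n C suc i))))
            (cong (λ z → + z * a (suc i)) (nCk+nC[k+1]≡[n+1]C[k+1] n i)))) ⟩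
    A′ 0 + Σ< (suc n) (λ i → A′ (suc i))
      ≡⟨ sym (Σ<-shift (suc n) A′) ⟩
    Σ< (suc (suc n)) A′ ∎
    where
      open ≡-Reasoning
      b = λ i → a (suc i)
      A = λ i → + (n C i) * a i
      B = λ i → + (n C i) * a (suc i)
      A′ = λ i → + (suc n C i) * a i
      lemma : ∀ a b c → (a + b) + c ≡ a + (c + b)
      lemma = solve-∀

  binomialSum-* : ∀ x n a → binomialSum n (λ i → x * a i) ≡ x * binomialSum n a
  binomialSum-* x zero    a = refl
  binomialSum-* x (suc n) a = trans (cong₂ _+_ (binomialSum-* x n a) (binomialSum-* x n (λ i → a (suc i))))
    (sym (ℤ.*-distribˡ-+ x (binomialSum n a) (binomialSum n (λ i → a (suc i)))))

  binomialSum-cong : ∀ n {a b : ℕ → ℤ} → (∀ i → a i ≡ b i) → binomialSum n a ≡ binomialSum n b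
  binomialSum-cong zero    h = h 0
  binomialSum-cong (suc n) h = cong₂ _+_ (binomialSum-cong n h) (binomialSum-cong n (λ i → h (suc i)))

  binomialSum-^ : ∀ x n → binomialSum n (x ^_) ≡ (+ 1 + x) ^ n
  binomialSum-^ x zero    = refl
  binomialSum-^ x (suc n) = trans (cong₂ _+_ (binomialSum-^ x n) (trans (binomialSum-* x n (x ^_)) (cong (x *_) (binomialSum-^ x n))))
    (lemma x ((+ 1 + x) ^ n))
    where lemma : ∀ x y → y + x * y ≡ (+ 1 + x) * y
          lemma = solve-∀

  -- The quotient (aⁿ - bⁿ) / (a - b).
  geometric : ℕ → ℤ → ℤ → ℤ
  geometric zero    a b = + 0
  geometric (suc n) a b = a * geometric n a b + b ^ n

  geometric-spec : ∀ n a b → a ^ n - b ^ n ≡ geometric n a b * (a - b)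
  geometric-spec zero    a b = refl
  geometric-spec (suc n) a b = trans (lemma₁ a b (a ^ n) (b ^ n))
    (trans (cong (λ z → a * z + b ^ n * (a - b)) (geometric-spec n a b)) (lemma₂ a b (geometric n a b) (b ^ n)))
    where lemma₁ : ∀ a b x y → a * x - b * y ≡ a * (x - y) + y * (a - b)
          lemma₁ = solve-∀
          lemma₂ : ∀ a b g y → a * (g * (a - b)) + y * (a - b) ≡ (a * g + y) * (a - b)
          lemma₂ = solve-∀

  geometric-mod : ∀ {m} n a b → a ≡ b [mod m ] → geometric (suc n) a b ≡ + suc n * a ^ n [mod m ]
  geometric-mod zero    a b h = mod-reflexive (lemma a)
    where lemma : ∀ a → a * + 0 + + 1 ≡ + 1
          lemma = solve-∀
  geometric-mod (suc n) a b h = mod-trans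
    (mod-+ (mod-* (mod-refl {a = a}) (geometric-mod n a b h)) (mod-^ (suc n) (mod-sym h)))
    (mod-reflexive (lemma a (a ^ n) (+ suc n)))
    where lemma : ∀ a x n → a * (n * x) + a * x ≡ (+ 1 + n) * (a * x)
          lemma = solve-∀

  module _ {A : Set} where
    iter : ℕ → (A → A) → A → A
    iter zero    F x = x
    iter (suc n) F x = F (iter n F x)

    iter-+ : ∀ m n F x → iter (m ℕ.+ n) F x ≡ iter m F (iter n F x)
    iter-+ zero    n F x = refl
    iter-+ (suc m) n F x = cong F (iter-+ m n F x)

    iter-* : ∀ m n F x → iter (m ℕ.* n) F x ≡ iter m (iter n F) x
    iter-* zero    n F x = refl
    iter-* (suc m) n F x = trans (iter-+ n (m ℕ.* n) F x) (cong (iter n F) (iter-* m n F x))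

  -- Multiplication by τᵈ - 1 on functions of j, read as formal sums Σⱼ f(j) τʲ.
  Δ : ℤ → (ℤ → ℤ) → (ℤ → ℤ)
  Δ d f j = f (j - d) - f j

  Δ-cong : ∀ {m} d {f g : ℤ → ℤ} → (∀ j → f j ≡ g j [mod m ]) → ∀ j → Δ d f j ≡ Δ d g j [mod m ]
  Δ-cong d h j = mod-+ (h (j - d)) (mod-neg (h j))

  iterΔ-cong : ∀ {m} n d {f g : ℤ → ℤ} → (∀ j → f j ≡ g j [mod m ]) → ∀ j → iter n (Δ d) f j ≡ iter n (Δ d) g j [mod m ]
  iterΔ-cong zero    d h = h
  iterΔ-cong (suc n) d h = Δ-cong d (iterΔ-cong n d h)

  iterΔ-* : ∀ n d c f j → iter n (Δ d) (λ i → c * f i) j ≡ c * iter n (Δ d) f j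
  iterΔ-* zero    d c f j = refl
  iterΔ-* (suc n) d c f j = trans (cong₂ _-_ (iterΔ-* n d c f (j - d)) (iterΔ-* n d c f j))
    (lemma c (iter n (Δ d) f (j - d)) (iter n (Δ d) f j))
    where lemma : ∀ c x y → c * x - c * y ≡ c * (x - y)
          lemma = solve-∀

  iterΔ-≗ : ∀ n d {f g : ℤ → ℤ} → (∀ j → f j ≡ g j) → ∀ j → iter n (Δ d) f j ≡ iter n (Δ d) g j
  iterΔ-≗ zero    d h j = h j
  iterΔ-≗ (suc n) d h j = cong₂ _-_ (iterΔ-≗ n d h (j - d)) (iterΔ-≗ n d h j)

  Periodic : ℤ → (ℤ → ℤ) → Set
  Periodic P f = ∀ j → f (j - P) ≡ f j

  iterΔ-periodic : ∀ {P} n d {f} → Periodic P f → Periodic P (iter n (Δ d) f)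
  iterΔ-periodic zero    d h = h
  iterΔ-periodic {P} (suc n) d {f} h j = cong₂ _-_
    (trans (cong (iter n (Δ d) f) (lemma j P d)) (iterΔ-periodic n d h (j - d)))
    (iterΔ-periodic n d h j)
    where lemma : ∀ j P d → j - P - d ≡ j - d - P
          lemma = solve-∀

  binomialSum-minus : ∀ n a b → binomialSum n (λ i → a i - b i) ≡ binomialSum n a - binomialSum n b
  binomialSum-minus zero    a b = refl
  binomialSum-minus (suc n) a b = trans (cong₂ _+_ (binomialSum-minus n a b) (binomialSum-minus n (λ i → a (suc i)) (λ i → b (suc i))))
    (lemma (binomialSum n a) (binomialSum n b) (binomialSum n (λ i → a (suc i))) (binomialSum n (λ i → b (suc i))))
    where lemma : ∀ a b c d → (a - b) + (c - d) ≡ (a + c) - (b + d)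
          lemma = solve-∀

  shift-binomial : ∀ n d f j → binomialSum n (λ i → iter i (Δ d) f j) ≡ f (j - + n * d)
  shift-binomial zero    d f j = cong f (lemma j d)
    where lemma : ∀ j d → j ≡ j - + 0 * d
          lemma = solve-∀
  shift-binomial (suc n) d f j = trans
    (cong (λ z → binomialSum n (λ i → iter i (Δ d) f j) + z)
          (binomialSum-minus n (λ i → iter i (Δ d) f (j - d)) (λ i → iter i (Δ d) f j)))
    (trans (lemma (binomialSum n (λ i → iter i (Δ d) f j)) (binomialSum n (λ i → iter i (Δ d) f (j - d))))
    (trans (shift-binomial n d f (j - d)) (cong f (lemma′ j (+ n) d))))
    where lemma : ∀ a b → a + (b - a) ≡ b
          lemma = solve-∀
          lemma′ : ∀ j n d → j - d - n * d ≡ j - (+ 1 + n) * d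
          lemma′ = solve-∀

  indicator : ∀ {A : Set} → Dec A → ℤ
  indicator (yes _) = + 1
  indicator (no  _) = + 0

  indicator-yes : ∀ {A : Set} (d : Dec A) → A → indicator d ≡ + 1
  indicator-yes (yes _) a = refl
  indicator-yes (no ¬a) a = contradiction a ¬a

  indicator-no : ∀ {A : Set} (d : Dec A) → ¬ A → indicator d ≡ + 0
  indicator-no (yes a) ¬a = contradiction a ¬a
  indicator-no (no _)  ¬a = refl

  indicator-⇔ : ∀ {A B : Set} (d : Dec A) (e : Dec B) → (A → B) → (B → A) → indicator d ≡ indicator e
  indicator-⇔ (yes a) e f g = sym (indicator-yes e (f a))
  indicator-⇔ (no ¬a) e f g = sym (indicator-no e (λ b → ¬a (g b)))

  Σ<-zero : ∀ n f → (∀ i → i < n → f i ≡ + 0) → Σ< n f ≡ + 0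
  Σ<-zero zero    f h = refl
  Σ<-zero (suc n) f h = cong₂ _+_ (Σ<-zero n f (λ i i<n → h i (ℕ.m<n⇒m<1+n i<n))) (h n ℕ.≤-refl)

  Σ<-single : ∀ n f i → i < n → (∀ j → j < n → ¬ j ≡ i → f j ≡ + 0) → Σ< n f ≡ f i
  Σ<-single (suc n) f i (s≤s i≤n) h with i ℕ.≟ n
  ... | yes refl = trans (cong (_+ f n) (Σ<-zero n f (λ j j<n → h j (ℕ.m<n⇒m<1+n j<n) (ℕ.<⇒≢ j<n)))) (ℤ.+-identityˡ (f n))
  ... | no i≢n = trans (cong₂ _+_ (Σ<-single n f i (ℕ.≤∧≢⇒< i≤n i≢n) (λ j j<n → h j (ℕ.m<n⇒m<1+n j<n)))
                                  (h n ℕ.≤-refl (λ n≡i → i≢n (sym n≡i))))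
                       (ℤ.+-identityʳ (f i))

  Σ<-minus : ∀ n f g → Σ< n (λ i → f i - g i) ≡ Σ< n f - Σ< n g
  Σ<-minus zero    f g = refl
  Σ<-minus (suc n) f g = trans (cong (_+ (f n - g n)) (Σ<-minus n f g)) (lemma (Σ< n f) (Σ< n g) (f n) (g n))
    where lemma : ∀ a b c d → (a - b) + (c - d) ≡ (a + c) - (b + d)
          lemma = solve-∀

  residue-unique : ∀ {m i j} → i < m → j < m → + i ≡ + j [mod + m ] → i ≡ j
  residue-unique {m} {i} {j} i<m j<m (mod d) = ℤ.+-injective (ℤ.i-j≡0⇒i≡j (+ i) (+ j) (ℤ.∣i∣≡0⇒i≡0 (go _ refl)))
    where
      small : ℤ.∣ + i - + j ∣ < m
      small = subst (λ z → ℤ.∣ z ∣ < m) (sym (ℤ.m-n≡m⊖n i j)) (ℕ.≤-<-trans (ℤ.∣m⊝n∣≤m⊔n i j) (ℕ.⊔-lub i<m j<m))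
      go : ∀ k → ℤ.∣ + i - + j ∣ ≡ k → k ≡ 0
      go zero    eq = refl
      go (suc k) eq = contradiction (ℕ.∣⇒≤ (subst (m ℕ.∣_) eq (ℤ∣.∣⇒∣ᵤ d))) (ℕ.<⇒≱ (subst (_< m) eq small))

module PrimePowers (p : ℕ) (p-prime : Prime p) where
  open Integers
  open import Data.Integer.Base using (_+_; _*_; _-_; -_; _^_)
  open ℤ∣ using (_∣_)

  instance
    p≢0 : NonZero p
    p≢0 = prime⇒nonZero p-prime

  p^≢0 : ∀ n → NonZero (p ℕ.^ n)
  p^≢0 n = ℕ.m^n≢0 p n

  P^ : ℕ → ℤ
  P^ n = + (p ℕ.^ n)

  P^-+ : ∀ m n → P^ (m ℕ.+ n) ≡ P^ m * P^ n
  P^-+ m n = trans (cong +_ (ℕ.^-distribˡ-+-* p m n)) (ℤ.pos-* (p ℕ.^ m) (p ℕ.^ n))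

  P^-mono : ∀ {m n} → m ≤ n → P^ m ∣ P^ n
  P^-mono {m} {n} m≤n = divides (P^ (n ℕ.∸ m)) (trans (cong P^ (sym (ℕ.m∸n+n≡m m≤n))) (P^-+ (n ℕ.∸ m) m))

  P^1 : P^ 1 ≡ + p
  P^1 = cong +_ (ℕ.*-identityʳ p)

  mod-lower : ∀ {m n a b} → m ≤ n → a ≡ b [mod P^ n ] → a ≡ b [mod P^ m ]
  mod-lower m≤n = mod-weaken (P^-mono m≤n)

  euclid : ∀ a b → + p ∣ a * b → (+ p ∣ a) ⊎ (+ p ∣ b)
  euclid a b d with euclidsLemma ℤ.∣ a ∣ ℤ.∣ b ∣ p-prime (subst (p ℕ.∣_) (ℤ.abs-* a b) (ℤ∣.∣⇒∣ᵤ d))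
  ... | inj₁ h = inj₁ (ℤ∣.∣ᵤ⇒∣ h)
  ... | inj₂ h = inj₂ (ℤ∣.∣ᵤ⇒∣ h)

  freshman : ∀ a → binomialSum p a ≡ a 0 + a p [mod + p ]
  freshman a = go p refl
    where
      go : ∀ n → n ≡ p → binomialSum n a ≡ a 0 + a n [mod + p ]
      go zero    eq = contradiction (subst NonZero (sym eq) p≢0) λ ()
      go (suc n) eq = mod-trans (mod-reflexive (trans (binomialSum-C (suc n) a) (cong (_+ A (suc n)) (Σ<-shift n A))))
        (mod-+ {b = a 0} {d = a (suc n)}
          (mod-trans (mod-+ {b = a 0} {d = + 0} (mod-reflexive (ℤ.*-identityˡ (a 0))) (Σ<-mod0 n (λ i → A (suc i)) inner))
                     (mod-reflexive (ℤ.+-identityʳ (a 0))))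
          (mod-reflexive (trans (cong (λ z → + z * a (suc n)) (nCn≡1 (suc n))) (ℤ.*-identityˡ (a (suc n))))))
        where
          A = λ i → + (suc n C i) * a i
          inner : ∀ i → i < n → A (suc i) ≡ + 0 [mod + p ]
          inner i i<n with euclid (+ suc i) (+ (suc n C suc i))
                             (divides (+ (n C i)) (trans (absorption n i) (trans (ℤ.*-comm (+ suc n) (+ (n C i))) (cong (λ z → + (n C i) * + z) eq))))
          ... | inj₁ d = contradiction (ℕ.∣⇒≤ (ℤ∣.∣⇒∣ᵤ d)) (ℕ.<⇒≱ (subst (suc i <_) eq (s≤s i<n)))
          ... | inj₂ d = ∣⇒mod0 (ℤ∣.∣m⇒∣m*n (a (suc i)) d)

  ^-homo : ∀ a m n → a ^ (m ℕ.+ n) ≡ a ^ m * a ^ n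
  ^-homo = ℤ.^-distribˡ-+-*

  0^p : (+ 0) ^ p ≡ + 0
  0^p = go p p≢0 where
    go : ∀ n → NonZero n → (+ 0) ^ n ≡ + 0
    go (suc n) _ = refl

  fermat⁺ : ∀ n → (+ n) ^ p ≡ + n [mod + p ]
  fermat⁺ zero    = mod-reflexive 0^p
  fermat⁺ (suc n) = mod-trans (mod-reflexive (sym (binomialSum-^ (+ n) p)))
    (mod-trans (freshman ((+ n) ^_)) (mod-+ {b = + 1} mod-refl (fermat⁺ n)))

  residue : ∀ a m .{{_ : NonZero m}} → a ≡ + (a ℤ.%ℕ m) [mod + m ]
  residue a m = mod (divides (a ℤ./ℕ m)
    (trans (cong (_- r) (ℤ.a≡a%ℕn+[a/ℕn]*n a m)) (lemma r (a ℤ./ℕ m * + m))))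
    where r = + (a ℤ.%ℕ m)
          lemma : ∀ r q → (r + q) - r ≡ q
          lemma = solve-∀

  fermat : ∀ a → a ^ p ≡ a [mod + p ]
  fermat a = mod-trans (mod-^ p h) (mod-trans (fermat⁺ (a ℤ.%ℕ p)) (mod-sym h))
    where h = residue a p

  lift-^p : ∀ {k a b} → 1 ≤ k → a ≡ b [mod P^ k ] → a ^ p ≡ b ^ p [mod P^ (suc k) ]
  lift-^p {k} {a} {b} 1≤k h = mod (subst (P^ (suc k) ∣_) (sym (geometric-spec p a b))
      (subst (_∣ geometric p a b * (a - b)) (sym (ℤ.pos-* p (p ℕ.^ k)))
        (∣-*-mono (geo p refl) (divides-difference h))))
    where
      ∣-*-mono : ∀ {x y z w} → x ∣ y → z ∣ w → x * z ∣ y * w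
      ∣-*-mono {x} {y} {z} {w} d e = ℤ∣.∣-trans (ℤ∣.*-monoˡ-∣ z d) (ℤ∣.*-monoʳ-∣ y e)
      h₁ : a ≡ b [mod + p ]
      h₁ = subst (a ≡ b [mod_]) P^1 (mod-lower 1≤k h)
      geo : ∀ n → n ≡ p → + p ∣ geometric n a b
      geo zero    eq = contradiction (subst NonZero (sym eq) p≢0) λ ()
      geo (suc n) eq = mod0⇒∣ (mod-trans (geometric-mod n a b h₁)
        (∣⇒mod0 (divides (a ^ n) (trans (ℤ.*-comm (+ suc n) (a ^ n)) (cong (λ z → a ^ n * + z) eq)))))

  -- The sequence a^(pⁿ), which converges to the Teichmüller representative of a.
  teich : ℤ → ℕ → ℤ
  teich a zero    = a
  teich a (suc n) = teich a n ^ p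

  teich-coherent : ∀ a n → teich a (suc n) ≡ teich a n [mod P^ (suc n) ]
  teich-coherent a zero    = subst (a ^ p ≡ a [mod_]) (sym P^1) (fermat a)
  teich-coherent a (suc n) = lift-^p {suc n} (s≤s z≤n) (teich-coherent a n)

  teich-cong : ∀ {a b} n → a ≡ b [mod + p ] → teich a n ≡ teich b n [mod P^ (suc n) ]
  teich-cong {a} {b} zero    h = subst (a ≡ b [mod_]) (sym P^1) h
  teich-cong (suc n) h = lift-^p {suc n} (s≤s z≤n) (teich-cong n h)

  teich-mod : ∀ a n → teich a n ≡ a [mod + p ]
  teich-mod a zero    = mod-refl
  teich-mod a (suc n) = mod-trans (mod-^ p (teich-mod a n)) (fermat a)

  fermat′ : ∀ a → ¬ (+ p ∣ a) → a ^ (p ℕ.∸ 1) ≡ + 1 [mod + p ]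
  fermat′ a p∤a with euclid a (a ^ (p ℕ.∸ 1) - + 1) (subst (+ p ∣_) (eq p p≢0) (divides-difference (fermat a)))
    where
      lemma : ∀ a x → a * x - a ≡ a * (x - + 1)
      lemma = solve-∀
      eq : ∀ n → NonZero n → a ^ n - a ≡ a * (a ^ (n ℕ.∸ 1) - + 1)
      eq (suc n) _ = lemma a (a ^ n)
  ... | inj₁ d = contradiction d p∤a
  ... | inj₂ d = mod d

  ^-swap : ∀ (a : ℤ) m n → (a ^ m) ^ n ≡ (a ^ n) ^ m
  ^-swap a m n = trans (ℤ.^-*-assoc a m n) (trans (cong (a ^_) (ℕ.*-comm m n)) (sym (ℤ.^-*-assoc a n m)))

  teich-root : ∀ a → ¬ (+ p ∣ a) → ∀ n → teich a n ^ (p ℕ.∸ 1) ≡ + 1 [mod P^ (suc n) ]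
  teich-root a p∤a zero    = subst (a ^ (p ℕ.∸ 1) ≡ + 1 [mod_]) (sym P^1) (fermat′ a p∤a)
  teich-root a p∤a (suc n) = mod-trans (mod-reflexive (^-swap (teich a n) p (p ℕ.∸ 1)))
    (mod-trans (lift-^p {suc n} (s≤s z≤n) (teich-root a p∤a n)) (mod-reflexive (ℤ.^-zeroˡ p)))

  coprime-cancel : ∀ {d} → ¬ (+ p ∣ d) → ∀ k a → P^ k ∣ d * a → P^ k ∣ a
  coprime-cancel p∤d zero    a _ = divides a (sym (ℤ.*-identityʳ a))
  coprime-cancel {d} p∤d (suc k) a h with euclid d a (ℤ∣.∣-trans (subst (_∣ P^ (suc k)) P^1 (P^-mono {1} {suc k} (s≤s z≤n))) h)
  ... | inj₁ e = contradiction e p∤d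
  ... | inj₂ (divides q refl) = subst (_∣ q * + p) (trans (ℤ.*-comm (P^ k) (+ p)) (sym (ℤ.pos-* p (p ℕ.^ k))))
    (ℤ∣.*-monoˡ-∣ (+ p) (coprime-cancel p∤d k q
      (ℤ∣.*-cancelʳ-∣ (+ p) (subst₂ _∣_ (trans (ℤ.pos-* p (p ℕ.^ k)) (ℤ.*-comm (+ p) (P^ k))) (sym (ℤ.*-assoc d q (+ p))) h))))

  -- Cancelling a fixed nonzero integer costs only a bounded amount of precision.
  cancel : ∀ d → NonZero d → Σ ℕ λ v → ∀ k a → P^ (k ℕ.+ v) ∣ + d * a → P^ k ∣ a
  cancel d d≢0 = go d d ℕ.≤-refl d≢0
    where
      go : ∀ fuel d → d ≤ fuel → NonZero d → Σ ℕ λ v → ∀ k a → P^ (k ℕ.+ v) ∣ + d * a → P^ k ∣ a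
      go zero zero d≤ ()
      go (suc fuel) d d≤ d≢0 with + p ℤ∣.∣? + d
      ... | no p∤d = 0 , λ k a h → coprime-cancel p∤d k a (subst (λ z → P^ z ∣ + d * a) (ℕ.+-identityʳ k) h)
      ... | yes p∣d with ℤ∣.∣⇒∣ᵤ p∣d
      ...   | ℕ.divides zero    eq = contradiction (subst NonZero eq d≢0) λ ()
      ...   | ℕ.divides (suc q) eq = suc (proj₁ rec) , λ k a h → proj₂ rec k a
                (ℤ∣.*-cancelˡ-∣ (+ p) (subst₂ _∣_ (step k) (step′ a) h))
        where
          q<d : suc q < d
          q<d = subst (suc q <_) (sym eq) (ℕ.m<m*n (suc q) p (ℕ.nonTrivial⇒n>1 p {{prime⇒nonTrivial p-prime}}))
          rec = go fuel (suc q) (ℕ.≤-pred (ℕ.≤-trans q<d d≤)) _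
          v = proj₁ rec
          step : ∀ k → P^ (k ℕ.+ suc v) ≡ + p * P^ (k ℕ.+ v)
          step k = trans (cong P^ (ℕ.+-suc k v)) (ℤ.pos-* p (p ℕ.^ (k ℕ.+ v)))
          lemma : ∀ q p a → q * p * a ≡ p * (q * a)
          lemma = solve-∀
          step′ : ∀ a → + d * a ≡ + p * (+ suc q * a)
          step′ a = trans (cong (λ z → + z * a) eq) (trans (cong (_* a) (ℤ.pos-* (suc q) p)) (lemma (+ suc q) (+ p) a))

  freshmanΔ : ∀ d f j → iter p (Δ d) f j ≡ Δ (+ p * d) f j [mod + p ]
  freshmanΔ d f j = mod-trans (mod-reflexive (lemma (f j) (iter p (Δ d) f j)))
    (mod-+ (mod-trans (mod-sym (freshman (λ i → iter i (Δ d) f j))) (mod-reflexive (shift-binomial p d f j))) mod-refl)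
    where lemma : ∀ a b → b ≡ (a + b) - a
          lemma = solve-∀

  freshmanΔ^ : ∀ N f j → iter (p ℕ.^ N) (Δ (+ 1)) f j ≡ Δ (P^ N) f j [mod + p ]
  freshmanΔ^ zero    f j = mod-refl
  freshmanΔ^ (suc N) f j =
    mod-trans (mod-reflexive (cong (λ g → g j) (iter-* p (p ℕ.^ N) (Δ (+ 1)) f)))
    (mod-trans (replace p j)
    (mod-trans (freshmanΔ (P^ N) f j) (mod-reflexive (cong (λ d → Δ d f j) (sym (ℤ.pos-* p (p ℕ.^ N)))))))
    where
      replace : ∀ n j → iter n (iter (p ℕ.^ N) (Δ (+ 1))) f j ≡ iter n (Δ (P^ N)) f j [mod + p ]
      replace zero    j = mod-refl
      replace (suc n) j = mod-trans (freshmanΔ^ N (iter n (iter (p ℕ.^ N) (Δ (+ 1))) f) j) (Δ-cong (P^ N) (replace n) j)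

  iterΔ-divisible : ∀ N k f → Periodic (P^ N) f → ∀ j → iter (k ℕ.* p ℕ.^ N) (Δ (+ 1)) f j ≡ + 0 [mod P^ k ]
  iterΔ-divisible N zero    f per j = ∣⇒mod0 (divides (f j) (sym (ℤ.*-identityʳ (f j))))
  iterΔ-divisible N (suc k) f per j = ∣⇒mod0 (subst₂ _∣_ (trans (ℤ.*-comm (P^ k) (+ p)) (sym (ℤ.pos-* p (p ℕ.^ k)))) (sym eq)
      (ℤ∣.*-monoʳ-∣ (P^ k) (mod0⇒∣ (mod-trans (freshmanΔ^ N h j) (mod-reflexive (ℤ.i≡j⇒i-j≡0 (h-per j)))))))
    where
      Q = p ℕ.^ N
      g = iter (k ℕ.* Q) (Δ (+ 1)) f
      divisible : ∀ i → P^ k ∣ g i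
      divisible i = mod0⇒∣ (iterΔ-divisible N k f per i)
      h : ℤ → ℤ
      h i = ℤ∣.quotient (divisible i)
      g≡ : ∀ i → g i ≡ P^ k * h i
      g≡ i = trans (ℤ∣._∣_.equality (divisible i)) (ℤ.*-comm (h i) (P^ k))
      h-per : Periodic (P^ N) h
      h-per i = ℤ.*-cancelˡ-≡ (P^ k) _ _ {{p^≢0 k}}
        (trans (sym (g≡ (i - P^ N))) (trans (iterΔ-periodic (k ℕ.* Q) (+ 1) per i) (g≡ i)))
      eq : iter (suc k ℕ.* Q) (Δ (+ 1)) f j ≡ P^ k * iter Q (Δ (+ 1)) h j
      eq = trans (cong (λ u → u j) (iter-+ Q (k ℕ.* Q) (Δ (+ 1)) f))
        (trans (iterΔ-≗ Q (+ 1) g≡ j) (iterΔ-* Q (+ 1) (P^ k) h j))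

  -- The coefficient of τʲ in (τ - 1)ⁿ ∈ ℤ[τ]/(τ^(p^N) - 1).
  δ : ℕ → ℤ → ℤ
  δ N j = indicator (P^ N ℤ∣.∣? j)

  coefficient : (N n : ℕ) → ℤ → ℤ
  coefficient N n = iter n (Δ (+ 1)) (δ N)

  δ-periodic : ∀ N → Periodic (P^ N) (δ N)
  δ-periodic N j = indicator-⇔ (P^ N ℤ∣.∣? (j - P^ N)) (P^ N ℤ∣.∣? j)
    (λ d → subst (P^ N ∣_) (lemma j (P^ N)) (ℤ∣.∣m∣n⇒∣m+n d ℤ∣.∣-refl))
    (λ d → ℤ∣.∣m∣n⇒∣m-n d ℤ∣.∣-refl)
    where lemma : ∀ j P → (j - P) + P ≡ j
          lemma = solve-∀

  coefficient-small : ∀ N k n → k ℕ.* p ℕ.^ N ≤ n → ∀ j → coefficient N n j ≡ + 0 [mod P^ k ]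
  coefficient-small N k n le j = subst (λ z → coefficient N z j ≡ + 0 [mod P^ k ]) (ℕ.m∸n+n≡m le)
    (mod-trans (mod-reflexive (cong (λ u → u j) (iter-+ r (k ℕ.* p ℕ.^ N) (Δ (+ 1)) (δ N))))
    (mod-trans (iterΔ-cong r (+ 1) (iterΔ-divisible N k (δ N) (δ-periodic N)) j) (mod-reflexive (zeros r j))))
    where
      r = n ℕ.∸ k ℕ.* p ℕ.^ N
      zeros : ∀ r j → iter r (Δ (+ 1)) (λ _ → + 0) j ≡ + 0
      zeros zero    j = refl
      zeros (suc r) j = cong₂ _-_ (zeros r (j - + 1)) (zeros r j)

  δ-additive : ∀ N j → δ N j ≡ Σ< p (λ i → δ (suc N) (j + + i * P^ N))
  δ-additive N j with P^ N ℤ∣.∣? j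
  ... | no ∤j = sym (Σ<-zero p _ λ i _ → indicator-no (P^ (suc N) ℤ∣.∣? (j + + i * P^ N)) λ d →
          ∤j (ℤ∣.∣m+n∣n⇒∣m (ℤ∣.∣-trans (P^-mono (ℕ.n≤1+n N)) d) (divides (+ i) refl)))
  ... | yes (divides m eq) = sym (trans (Σ<-single p f i₀ (ℤ.n%ℕd<d (- m) p) others)
                                  (indicator-yes (P^ (suc N) ℤ∣.∣? (j + + i₀ * P^ N)) (from i₀ i₀-good)))
    where
      f : ℕ → ℤ
      f i = δ (suc N) (j + + i * P^ N)
      i₀ = (- m) ℤ.%ℕ p
      rewrite-j : ∀ i → j + + i * P^ N ≡ (m + + i) * P^ N
      rewrite-j i = trans (cong (_+ + i * P^ N) eq) (sym (ℤ.*-distribʳ-+ (P^ N) m (+ i)))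
      from : ∀ i → + p ∣ m + + i → P^ (suc N) ∣ j + + i * P^ N
      from i d = subst₂ _∣_ (sym (ℤ.pos-* p (p ℕ.^ N))) (sym (rewrite-j i)) (ℤ∣.*-monoˡ-∣ (P^ N) d)
      to : ∀ i → P^ (suc N) ∣ j + + i * P^ N → + p ∣ m + + i
      to i d = ℤ∣.*-cancelʳ-∣ (P^ N) {{p^≢0 N}} (subst₂ _∣_ (ℤ.pos-* p (p ℕ.^ N)) (rewrite-j i) d)
      i₀-good : + p ∣ m + + i₀
      i₀-good = subst (+ p ∣_) (lemma m (+ i₀)) (ℤ∣.∣m⇒∣-m (divides-difference (residue (- m) p)))
        where lemma : ∀ m i → - (- m - i) ≡ m + i
              lemma = solve-∀
      others : ∀ i → i < p → ¬ i ≡ i₀ → f i ≡ + 0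
      others i i<p i≢i₀ = indicator-no (P^ (suc N) ℤ∣.∣? (j + + i * P^ N)) λ d →
        i≢i₀ (residue-unique i<p (ℤ.n%ℕd<d (- m) p)
          (mod (subst (+ p ∣_) (lemma m (+ i) (+ i₀)) (ℤ∣.∣m∣n⇒∣m-n (to i d) i₀-good))))
        where lemma : ∀ m i j → (m + i) - (m + j) ≡ i - j
              lemma = solve-∀

  coefficient-additive : ∀ N n j → coefficient N n j ≡ Σ< p (λ i → coefficient (suc N) n (j + + i * P^ N))
  coefficient-additive N zero    j = δ-additive N j
  coefficient-additive N (suc n) j = trans (cong₂ _-_ (coefficient-additive N n (j - + 1)) (coefficient-additive N n j))
    (trans (sym (Σ<-minus p _ _)) (Σ<-cong p λ i → cong (λ z → coefficient (suc N) n z - coefficient (suc N) n (j + + i * P^ N))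
      (lemma j (+ i * P^ N))))
    where lemma : ∀ j x → j - + 1 + x ≡ j + x - + 1
          lemma = solve-∀

module PAdic (p : ℕ) (p-prime : Prime p) where
  open Integers
  open PrimePowers p p-prime

  -- ℤₚ as the inverse limit of the rings ℤ/pⁿ.
  record ℤₚ : Set where
    no-eta-equality
    field
      approx   : ℕ → ℤ
      coherent : ∀ n → approx (suc n) ≡ approx n [mod P^ n ]
  open ℤₚ public

  infix 4 _≈[_]_ _≈ₚ_

  -- Equality of the images in ℤ/pⁿ.
  record _≈[_]_ (x : ℤₚ) (n : ℕ) (y : ℤₚ) : Set where
    constructor level
    field at-level : approx x n ≡ approx y n [mod P^ n ]
  open _≈[_]_ public

  _≈ₚ_ : ℤₚ → ℤₚ → Set
  x ≈ₚ y = ∀ n → x ≈[ n ] y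

  fromℤ : ℤ → ℤₚ
  fromℤ a .approx   _ = a
  fromℤ a .coherent _ = mod-refl

  infixl 6 _+ₚ_
  infixl 7 _*ₚ_
  infix  8 -ₚ_

  _+ₚ_ _*ₚ_ : ℤₚ → ℤₚ → ℤₚ
  (x +ₚ y) .approx   n = approx x n ℤ.+ approx y n
  (x +ₚ y) .coherent n = mod-+ (coherent x n) (coherent y n)
  (x *ₚ y) .approx   n = approx x n ℤ.* approx y n
  (x *ₚ y) .coherent n = mod-* (coherent x n) (coherent y n)

  -ₚ_ : ℤₚ → ℤₚ
  (-ₚ x) .approx   n = ℤ.- approx x n
  (-ₚ x) .coherent n = mod-neg (coherent x n)

  exactly : ∀ {x y} → (∀ n → approx x n ≡ approx y n) → x ≈ₚ y
  exactly h n = level (mod-reflexive (h n))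

  ℤₚ-commutativeRing : CommutativeRing 0ℓ 0ℓ
  ℤₚ-commutativeRing = record
    { Carrier = ℤₚ
    ; _≈_ = _≈ₚ_
    ; _+_ = _+ₚ_
    ; _*_ = _*ₚ_
    ; -_  = -ₚ_
    ; 0#  = fromℤ (+ 0)
    ; 1#  = fromℤ (+ 1)
    ; isCommutativeRing = record
      { isRing = record
        { +-isAbelianGroup = record
          { isGroup = record
            { isMonoid = record
              { isSemigroup = record
                { isMagma = record
                  { isEquivalence = record
                    { refl  = λ n → level mod-refl
                    ; sym   = λ h n → level (mod-sym (at-level (h n)))
                    ; trans = λ h k n → level (mod-trans (at-level (h n)) (at-level (k n))) }
                  ; ∙-cong = λ h k n → level (mod-+ (at-level (h n)) (at-level (k n))) }
                ; assoc = λ x y z → exactly λ n → ℤ.+-assoc (approx x n) (approx y n) (approx z n) }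
              ; identity = (λ x → exactly λ n → ℤ.+-identityˡ (approx x n))
                         , (λ x → exactly λ n → ℤ.+-identityʳ (approx x n)) }
            ; inverse = (λ x → exactly λ n → ℤ.+-inverseˡ (approx x n))
                      , (λ x → exactly λ n → ℤ.+-inverseʳ (approx x n))
            ; ⁻¹-cong = λ h n → level (mod-neg (at-level (h n))) }
          ; comm = λ x y → exactly λ n → ℤ.+-comm (approx x n) (approx y n) }
        ; *-cong = λ h k n → level (mod-* (at-level (h n)) (at-level (k n)))
        ; *-assoc = λ x y z → exactly λ n → ℤ.*-assoc (approx x n) (approx y n) (approx z n)
        ; *-identity = (λ x → exactly λ n → ℤ.*-identityˡ (approx x n))
                     , (λ x → exactly λ n → ℤ.*-identityʳ (approx x n))
        ; distrib = (λ x y z → exactly λ n → ℤ.*-distribˡ-+ (approx x n) (approx y n) (approx z n))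
                  , (λ x y z → exactly λ n → ℤ.*-distribʳ-+ (approx x n) (approx y n) (approx z n)) }
      ; *-comm = λ x y → exactly λ n → ℤ.*-comm (approx x n) (approx y n) } }

  open CommutativeRing ℤₚ-commutativeRing public
    using (_≈_; _+_; _*_; -_; _-_; 0#; 1#; semiring; rawRing; +-rawMonoid; *-rawMonoid; *-rawMagma;
           *-commutativeMonoid; +-cong; *-cong; -‿cong; +-identityˡ; +-identityʳ; *-identityˡ; *-identityʳ;
           +-comm; *-comm; +-assoc; *-assoc; distribˡ; distribʳ; zeroˡ; zeroʳ; -‿inverseʳ)
    renaming (refl to ≈-refl; sym to ≈-sym; trans to ≈-trans)

  open import Algebra.Properties.Semiring.Exp semiring public using (_^_)
  open import Algebra.Properties.Semiring.Sum semiring public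
    using (sum; sum-cong-≋; *-distribʳ-sum; *-distribˡ-sum; ∑-comm; ∑-distrib-+)
  open import Algebra.Definitions.RawMonoid *-rawMonoid public using () renaming (sum to product)
  open import Algebra.Definitions.RawMagma *-rawMagma public using (_∣_) renaming (_,_ to _,∣_)

  module _ {k : ℕ} where
    lv-refl : ∀ {x} → x ≈[ k ] x
    lv-refl = level mod-refl

    lv-sym : ∀ {x y} → x ≈[ k ] y → y ≈[ k ] x
    lv-sym (level h) = level (mod-sym h)

    lv-trans : ∀ {x y z} → x ≈[ k ] y → y ≈[ k ] z → x ≈[ k ] z
    lv-trans (level h) (level h′) = level (mod-trans h h′)

    lv-+ : ∀ {x y z w} → x ≈[ k ] y → z ≈[ k ] w → x + z ≈[ k ] y + w
    lv-+ (level h) (level h′) = level (mod-+ h h′)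

    lv-* : ∀ {x y z w} → x ≈[ k ] y → z ≈[ k ] w → x * z ≈[ k ] y * w
    lv-* (level h) (level h′) = level (mod-* h h′)

    lv-neg : ∀ {x y} → x ≈[ k ] y → - x ≈[ k ] - y
    lv-neg (level h) = level (mod-neg h)

    lv-^ : ∀ {x y} n → x ≈[ k ] y → x ^ n ≈[ k ] y ^ n
    lv-^ zero    h = lv-refl
    lv-^ (suc n) h = lv-* h (lv-^ n h)

    lv-sum : ∀ {n} {v w : Vector ℤₚ n} → (∀ i → v i ≈[ k ] w i) → sum v ≈[ k ] sum w
    lv-sum {zero}  h = lv-refl
    lv-sum {suc n} h = lv-+ (h zero) (lv-sum (λ i → h (suc i)))

    lv-product : ∀ {n} {v w : Vector ℤₚ n} → (∀ i → v i ≈[ k ] w i) → product v ≈[ k ] product w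
    lv-product {zero}  h = lv-refl
    lv-product {suc n} h = lv-* (h zero) (lv-product (λ i → h (suc i)))

    lv-zeroʳ : ∀ x {y} → y ≈[ k ] 0# → x * y ≈[ k ] 0#
    lv-zeroʳ x {y} h = lv-trans (lv-* {x} {x} {y} {0#} lv-refl h) (zeroʳ x k)

  approx-steps : ∀ x m d → approx x (d ℕ.+ m) ≡ approx x m [mod P^ m ]
  approx-steps x m zero    = mod-refl
  approx-steps x m (suc d) = mod-trans (mod-lower (ℕ.m≤n+m m d) (coherent x (d ℕ.+ m))) (approx-steps x m d)

  approx-lower : ∀ x {m n} → m ≤ n → approx x n ≡ approx x m [mod P^ m ]
  approx-lower x {m} {n} m≤n = subst (λ z → approx x z ≡ approx x m [mod P^ m ]) (ℕ.m∸n+n≡m m≤n) (approx-steps x m (n ℕ.∸ m))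

  lv-lower : ∀ {m n x y} → m ≤ n → x ≈[ n ] y → x ≈[ m ] y
  lv-lower {x = x} {y} m≤n (level h) =
    level (mod-trans (mod-sym (approx-lower x m≤n)) (mod-trans (mod-lower m≤n h) (approx-lower y m≤n)))

  approx-^ : ∀ x n k → approx (x ^ n) k ≡ approx x k ℤ.^ n
  approx-^ x zero    k = refl
  approx-^ x (suc n) k = cong (approx x k ℤ.*_) (approx-^ x n k)

  level0⇒∣ : ∀ {x} k → x ≈[ k ] 0# → fromℤ (P^ k) ∣ x
  level0⇒∣ {x} k (level h) = quot ,∣ λ n → level (mod-trans (mod-reflexive (sym (eq n))) (approx-lower x (ℕ.m≤n+m n k)))
    where
      d : ∀ n → P^ k ℤ∣.∣ approx x (k ℕ.+ n)
      d n = mod0⇒∣ (mod-trans (approx-lower x (ℕ.m≤m+n k n)) h)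
      Q : ℕ → ℤ
      Q n = ℤ∣.quotient (d n)
      eq : ∀ n → approx x (k ℕ.+ n) ≡ Q n ℤ.* P^ k
      eq n = ℤ∣._∣_.equality (d n)
      lemma : ∀ a b c → a ℤ.* c ℤ.- b ℤ.* c ≡ (a ℤ.- b) ℤ.* c
      lemma = solve-∀
      quot : ℤₚ
      quot .approx     = Q
      quot .coherent n = mod (ℤ∣.*-cancelʳ-∣ (P^ k) {{p^≢0 k}} (subst₂ ℤ∣._∣_
          (trans (P^-+ k n) (ℤ.*-comm (P^ k) (P^ n)))
          (trans (cong₂ ℤ._-_ (trans (cong (approx x) (sym (ℕ.+-suc k n))) (eq (suc n))) (eq n)) (lemma (Q (suc n)) (Q n) (P^ k)))
          (divides-difference (coherent x (k ℕ.+ n)))))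

  ∣⇒level0 : ∀ {x} k → fromℤ (P^ k) ∣ x → x ≈[ k ] 0#
  ∣⇒level0 k (y ,∣ h) = lv-trans (lv-sym (h k)) (level (∣⇒mod0 (ℤ∣.divides (approx y k) refl)))

  pₚ : ℤₚ
  pₚ = fromℤ (+ p)

  pₚ∣⇒level0 : ∀ {x} → pₚ ∣ x → x ≈[ 1 ] 0#
  pₚ∣⇒level0 {x} d = ∣⇒level0 1 (subst (λ z → fromℤ z ∣ x) (sym P^1) d)

  level0⇒pₚ∣ : ∀ {x} → x ≈[ 1 ] 0# → pₚ ∣ x
  level0⇒pₚ∣ {x} h = subst (λ z → fromℤ z ∣ x) P^1 (level0⇒∣ 1 h)

  pₚ∣? : ∀ x → Dec (pₚ ∣ x)
  pₚ∣? x with + p ℤ∣.∣? approx x 1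
  ... | yes d = yes (level0⇒pₚ∣ (level (subst (approx x 1 ≡ + 0 [mod_]) (sym P^1) (∣⇒mod0 d))))
  ... | no ¬d = no λ d → ¬d (mod0⇒∣ (subst (approx x 1 ≡ + 0 [mod_]) P^1 (at-level (pₚ∣⇒level0 d))))

  ∤-approx : ∀ {x} → ¬ (pₚ ∣ x) → ¬ (+ p ℤ∣.∣ approx x 1)
  ∤-approx {x} p∤x d = p∤x (level0⇒pₚ∣ (level (subst (approx x 1 ≡ + 0 [mod_]) (sym P^1) (∣⇒mod0 d))))

  Cauchy : (ℕ → ℤₚ) → Set
  Cauchy s = ∀ k → Σ ℕ λ M → ∀ n → M ≤ n → s n ≈[ k ] s M

  _⟶_ : (ℕ → ℤₚ) → ℤₚ → Set
  s ⟶ x = ∀ k → Σ ℕ λ M → ∀ n → M ≤ n → s n ≈[ k ] x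

  limit : (s : ℕ → ℤₚ) → Cauchy s → ℤₚ
  limit s c .approx   k = approx (s (proj₁ (c k))) k
  limit s c .coherent k = mod-trans
      (mod-trans (coherent (s N) k)
        (mod-sym (at-level (lv-lower (ℕ.n≤1+n k) (proj₂ (c (suc k)) (M ℕ.⊔ N) (ℕ.m≤n⊔m M N))))))
      (at-level (proj₂ (c k) (M ℕ.⊔ N) (ℕ.m≤m⊔n M N)))
    where M = proj₁ (c k)
          N = proj₁ (c (suc k))

  limit-converges : ∀ s c → s ⟶ limit s c
  limit-converges s c k = proj₁ (c k) , λ n M≤n → level (at-level (proj₂ (c k) n M≤n))

  -- Two sequences eventually congruent modulo pᵏ have congruent limits.
  limit-level : ∀ {s t x y} k → s ⟶ x → t ⟶ y → (Σ ℕ λ M → ∀ n → M ≤ n → s n ≈[ k ] t n) → x ≈[ k ] y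
  limit-level k hs ht (M , h) = lv-trans (lv-sym (proj₂ (hs k) X (ℕ.≤-trans (ℕ.m≤m⊔n A B) (ℕ.m≤m⊔n (A ℕ.⊔ B) M))))
      (lv-trans (h X (ℕ.m≤n⊔m (A ℕ.⊔ B) M)) (proj₂ (ht k) X (ℕ.≤-trans (ℕ.m≤n⊔m A B) (ℕ.m≤m⊔n (A ℕ.⊔ B) M))))
    where A = proj₁ (hs k)
          B = proj₁ (ht k)
          X = (A ℕ.⊔ B) ℕ.⊔ M

  Null : (ℕ → ℤₚ) → Set
  Null t = ∀ k → Σ ℕ λ M → ∀ n → M ≤ n → t n ≈[ k ] 0#

  partialSum : (ℕ → ℤₚ) → ℕ → ℤₚ
  partialSum t zero    = 0#
  partialSum t (suc n) = partialSum t n + t n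

  partialSum-Cauchy : ∀ {t} → Null t → Cauchy (partialSum t)
  partialSum-Cauchy {t} null k = M , λ n M≤n → subst (λ z → partialSum t z ≈[ k ] partialSum t M) (ℕ.m∸n+n≡m M≤n) (go (n ℕ.∸ M))
    where
      M = proj₁ (null k)
      go : ∀ d → partialSum t (d ℕ.+ M) ≈[ k ] partialSum t M
      go zero    = lv-refl
      go (suc d) = lv-trans (lv-+ (go d) (proj₂ (null k) (d ℕ.+ M) (ℕ.m≤n+m M d))) (+-identityʳ (partialSum t M) k)

  series : (t : ℕ → ℤₚ) → Null t → ℤₚ
  series t null = limit (partialSum t) (partialSum-Cauchy null)

  partialSum-level : ∀ {t u} k → (∀ n → t n ≈[ k ] u n) → ∀ n → partialSum t n ≈[ k ] partialSum u n
  partialSum-level k h zero    = lv-refl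
  partialSum-level k h (suc n) = lv-+ (partialSum-level k h n) (h n)

  series-level : ∀ {t u} k (ht : Null t) (hu : Null u) → (∀ n → t n ≈[ k ] u n) → series t ht ≈[ k ] series u hu
  series-level {t} {u} k ht hu h = limit-level k
    (limit-converges _ (partialSum-Cauchy ht)) (limit-converges _ (partialSum-Cauchy hu)) (0 , λ n _ → partialSum-level k h n)

  +-Null : ∀ {t u} → Null t → Null u → Null (λ n → t n + u n)
  +-Null ht hu k = A ℕ.⊔ B , λ n le → lv-trans
      (lv-+ (proj₂ (ht k) n (ℕ.≤-trans (ℕ.m≤m⊔n A B) le)) (proj₂ (hu k) n (ℕ.≤-trans (ℕ.m≤n⊔m A B) le)))
      (+-identityʳ 0# k)
    where A = proj₁ (ht k)
          B = proj₁ (hu k)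

  interchange : ∀ x y z w → (x + y) + (z + w) ≈ (x + z) + (y + w)
  interchange x y z w = exactly λ n → lemma (approx x n) (approx y n) (approx z n) (approx w n)
    where lemma : ∀ a b c d → (a ℤ.+ b) ℤ.+ (c ℤ.+ d) ≡ (a ℤ.+ c) ℤ.+ (b ℤ.+ d)
          lemma = solve-∀

  partialSum-+ : ∀ t u n → partialSum t n + partialSum u n ≈ partialSum (λ n → t n + u n) n
  partialSum-+ t u zero    = +-identityʳ 0#
  partialSum-+ t u (suc n) = ≈-trans (interchange (partialSum t n) (t n) (partialSum u n) (u n))
    (+-cong {partialSum t n + partialSum u n} {partialSum (λ n → t n + u n) n} {t n + u n} {t n + u n} (partialSum-+ t u n) ≈-refl)

  ⟶-+ : ∀ {s t x y} → s ⟶ x → t ⟶ y → (λ n → s n + t n) ⟶ (x + y)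
  ⟶-+ hs ht k = A ℕ.⊔ B , λ n le →
      lv-+ (proj₂ (hs k) n (ℕ.≤-trans (ℕ.m≤m⊔n A B) le)) (proj₂ (ht k) n (ℕ.≤-trans (ℕ.m≤n⊔m A B) le))
    where A = proj₁ (hs k)
          B = proj₁ (ht k)

  series-+ : ∀ {t u} (ht : Null t) (hu : Null u) (h : Null (λ n → t n + u n)) → series t ht + series u hu ≈ series (λ n → t n + u n) h
  series-+ {t} {u} ht hu h k = limit-level k
    (⟶-+ (limit-converges _ (partialSum-Cauchy ht)) (limit-converges _ (partialSum-Cauchy hu)))
    (limit-converges _ (partialSum-Cauchy h)) (0 , λ n _ → partialSum-+ t u n k)

  0-Null : Null (λ _ → 0#)
  0-Null k = 0 , λ _ _ → lv-refl

  sum-Null : ∀ {m} {t : Fin m → ℕ → ℤₚ} → (∀ i → Null (t i)) → Null (λ n → sum λ i → t i n)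
  sum-Null {zero}  h = 0-Null
  sum-Null {suc m} h = +-Null (h zero) (sum-Null (λ i → h (suc i)))

  series-sum : ∀ {m} {t : Fin m → ℕ → ℤₚ} (ht : ∀ i → Null (t i)) →
               sum (λ i → series (t i) (ht i)) ≈ series (λ n → sum λ i → t i n) (sum-Null ht)
  series-sum {zero} ht k = limit-level k (λ k → 0 , λ _ _ → lv-refl)
    (limit-converges _ (partialSum-Cauchy 0-Null)) (0 , λ n _ → lv-sym (zeros n))
    where zeros : ∀ n → partialSum (λ _ → 0#) n ≈[ k ] 0#
          zeros zero    = lv-refl
          zeros (suc n) = lv-trans (lv-+ (zeros n) lv-refl) (+-identityʳ 0# k)
  series-sum {suc m} {t} ht = ≈-trans
    (+-cong {series (t zero) (ht zero)} {series (t zero) (ht zero)} ≈-refl (series-sum (λ i → ht (suc i))))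
    (series-+ (ht zero) (sum-Null (λ i → ht (suc i))) (sum-Null ht))

  record ℤₚˣ : Set where
    field
      value inverse : ℤₚ
      isInverse     : value * inverse ≈ 1#
  open ℤₚˣ public

  _^ᶻ_ : ℤₚˣ → ℤ → ℤₚ
  u ^ᶻ (+ n)    = value u ^ n
  u ^ᶻ -[1+ n ] = inverse u ^ suc n

  1-unit : ℤₚˣ
  1-unit = record { value = 1# ; inverse = 1# ; isInverse = *-identityˡ 1# }

  -1-unit : ℤₚˣ
  -1-unit = record { value = - 1# ; inverse = - 1# ; isInverse = exactly λ _ → refl }

  -- q, W and the decomposition are first defined relative to a decision of p ≡ 2.
  q-of : Dec (p ≡ 2) → ℕ
  q-of (yes _) = 4
  q-of (no  _) = p

  W-of : Dec (p ≡ 2) → ℤₚ → Set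
  W-of (yes _) ξ = ξ ≈ 1# ⊎ ξ ≈ - 1#
  W-of (no  _) ξ = ξ ^ (p ℕ.∸ 1) ≈ 1#

  q : ℕ
  q = q-of (p ℕ.≟ 2)

  W : ℤₚ → Set
  W = W-of (p ℕ.≟ 2)

  1+qℤₚ : ℤₚ → Set
  1+qℤₚ u = fromℤ (+ q) ∣ u - 1#

  -- Such a decomposition is unique, because W ∩ (1 + qℤₚ) = {1}.
  record DecompositionAt (d : Dec (p ≡ 2)) (x : ℤₚ) : Set where
    field
      ω       : ℤₚˣ
      ⟨⟩      : ℤₚ
      ω∈W     : W-of d (value ω)
      ⟨⟩∈1+qℤₚ : fromℤ (+ q-of d) ∣ ⟨⟩ - 1#
      product≈ : value ω * ⟨⟩ ≈ x

  Decomposition : ℤₚ → Set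
  Decomposition = DecompositionAt (p ℕ.≟ 2)
  open DecompositionAt public

  p∸1 : p ℕ.∸ 1 ≡ suc (p ℕ.∸ 2)
  p∸1 = go p (ℕ.nonTrivial⇒n>1 p {{prime⇒nonTrivial p-prime}})
    where go : ∀ n → 1 < n → n ℕ.∸ 1 ≡ suc (n ℕ.∸ 2)
          go (suc zero) (s≤s ())
          go (suc (suc n)) _ = refl

  minus-one-level : ∀ k {u} → u ≈[ k ] 1# → u - 1# ≈[ k ] 0#
  minus-one-level k h = lv-trans (lv-+ h lv-refl) (-‿inverseʳ 1# k)

  module _ (a : ℤ) (p∤a : ¬ (+ p ℤ∣.∣ a)) where
    teichmüller : ℤₚ
    teichmüller .approx     = teich a
    teichmüller .coherent n = mod-lower (ℕ.n≤1+n n) (teich-coherent a n)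

    teichmüller-root : teichmüller ^ (p ℕ.∸ 1) ≈ 1#
    teichmüller-root n = level (mod-trans (mod-reflexive (approx-^ teichmüller (p ℕ.∸ 1) n))
      (mod-lower (ℕ.n≤1+n n) (teich-root a p∤a n)))

    teichmüller-unit : ℤₚˣ
    teichmüller-unit .value     = teichmüller
    teichmüller-unit .inverse   = teichmüller ^ (p ℕ.∸ 2)
    teichmüller-unit .isInverse = subst (λ z → teichmüller ^ z ≈ 1#) p∸1 teichmüller-root

  decompose-odd : ∀ x → ¬ (pₚ ∣ x) → (p≢2 : ¬ (p ≡ 2)) → DecompositionAt (no p≢2) x
  decompose-odd x p∤x p≢2 = record
    { ω = t
    ; ⟨⟩ = x * inverse t
    ; ω∈W = teichmüller-root a p∤a
    ; ⟨⟩∈1+qℤₚ = level0⇒pₚ∣ (minus-one-level 1 (level (subst (λ m → approx (x * inverse t) 1 ≡ + 1 [mod m ]) (sym P^1) one)))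
    ; product≈ = ≈-trans (exactly λ n → lemma (approx (value t) n) (approx x n) (approx (inverse t) n))
        (≈-trans (*-cong {x} {x} ≈-refl (isInverse t)) (*-identityʳ x)) }
    where
      a = approx x 1
      p∤a = ∤-approx p∤x
      t = teichmüller-unit a p∤a
      lemma : ∀ t x u → t ℤ.* (x ℤ.* u) ≡ x ℤ.* (t ℤ.* u)
      lemma = solve-∀
      one : a ℤ.* approx (inverse t) 1 ≡ + 1 [mod + p ]
      one = mod-trans (mod-* (mod-refl {a = a})
               (mod-trans (mod-reflexive (approx-^ (value t) (p ℕ.∸ 2) 1)) (mod-^ (p ℕ.∸ 2) (teich-mod a 1))))
             (subst (λ z → a ℤ.^ z ≡ + 1 [mod + p ]) p∸1 (fermat′ a p∤a))

  odd-mod-4 : ∀ a → ¬ (+ 2 ℤ∣.∣ a) → ¬ (+ 4 ℤ∣.∣ a ℤ.- + 1) → + 4 ℤ∣.∣ a ℤ.+ + 1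
  odd-mod-4 a odd ≢1 = go (a ℤ.%ℕ 4) (ℤ.n%ℕd<d a 4) (ℤ.a≡a%ℕn+[a/ℕn]*n a 4)
    where
      b = a ℤ./ℕ 4
      go : ∀ r → r < 4 → a ≡ + r ℤ.+ b ℤ.* + 4 → + 4 ℤ∣.∣ a ℤ.+ + 1
      go 0 _ eq = contradiction (ℤ∣.divides (b ℤ.* + 2) (trans eq (lemma b))) odd
        where lemma : ∀ b → + 0 ℤ.+ b ℤ.* + 4 ≡ b ℤ.* + 2 ℤ.* + 2
              lemma = solve-∀
      go 1 _ eq = contradiction (ℤ∣.divides b (trans (cong (ℤ._- + 1) eq) (lemma b))) ≢1
        where lemma : ∀ b → + 1 ℤ.+ b ℤ.* + 4 ℤ.- + 1 ≡ b ℤ.* + 4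
              lemma = solve-∀
      go 2 _ eq = contradiction (ℤ∣.divides (+ 1 ℤ.+ b ℤ.* + 2) (trans eq (lemma b))) odd
        where lemma : ∀ b → + 2 ℤ.+ b ℤ.* + 4 ≡ (+ 1 ℤ.+ b ℤ.* + 2) ℤ.* + 2
              lemma = solve-∀
      go 3 _ eq = ℤ∣.divides (b ℤ.+ + 1) (trans (cong (ℤ._+ + 1) eq) (lemma b))
        where lemma : ∀ b → + 3 ℤ.+ b ℤ.* + 4 ℤ.+ + 1 ≡ (b ℤ.+ + 1) ℤ.* + 4
              lemma = solve-∀
      go (suc (suc (suc (suc r)))) (s≤s (s≤s (s≤s (s≤s ())))) eq

  module _ (p≡2 : p ≡ 2) where
    P^2 : P^ 2 ≡ + 4
    P^2 = cong (λ z → + (z ℕ.^ 2)) p≡2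

    4∣ : ∀ {x} → x ≈[ 2 ] 0# → fromℤ (+ 4) ∣ x
    4∣ {x} h = subst (λ z → fromℤ z ∣ x) P^2 (level0⇒∣ 2 h)

    level2 : ∀ {x y} → + 4 ℤ∣.∣ approx x 2 ℤ.- approx y 2 → x ≈[ 2 ] y
    level2 {x} {y} d = level (mod (subst (ℤ∣._∣ (approx x 2 ℤ.- approx y 2)) (sym P^2) d))

    decompose-two : ∀ x → ¬ (pₚ ∣ x) → Dec (+ 4 ℤ∣.∣ approx x 2 ℤ.- + 1) → DecompositionAt (yes p≡2) x
    decompose-two x p∤x (yes ≡1) = record
      { ω = 1-unit
      ; ⟨⟩ = x
      ; ω∈W = inj₁ ≈-refl
      ; ⟨⟩∈1+qℤₚ = 4∣ (minus-one-level 2 (level2 ≡1))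
      ; product≈ = *-identityˡ x }
    decompose-two x p∤x (no ≢1) = record
      { ω = -1-unit
      ; ⟨⟩ = - x
      ; ω∈W = inj₂ ≈-refl
      ; ⟨⟩∈1+qℤₚ = 4∣ (minus-one-level 2 (level2
          (subst (+ 4 ℤ∣.∣_) (lemma (approx x 2)) (ℤ∣.∣m⇒∣-m (odd-mod-4 (approx x 2) odd ≢1)))))
      ; product≈ = exactly λ n → lemma′ (approx x n) }
      where
        lemma : ∀ a → ℤ.- (a ℤ.+ + 1) ≡ ℤ.- a ℤ.- + 1
        lemma = solve-∀
        lemma′ : ∀ a → ℤ.- (+ 1) ℤ.* ℤ.- a ≡ a
        lemma′ = solve-∀
        odd : ¬ (+ 2 ℤ∣.∣ approx x 2)
        odd d = ∤-approx p∤x (subst (λ z → + z ℤ∣.∣ approx x 1) (sym p≡2)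
          (mod0⇒∣ (mod-trans (mod-sym (subst (approx x 2 ≡ approx x 1 [mod_]) (trans P^1 (cong +_ p≡2)) (coherent x 1))) (∣⇒mod0 d))))

  decomposeAt : ∀ d x → ¬ (pₚ ∣ x) → DecompositionAt d x
  decomposeAt (yes p≡2) x p∤x = decompose-two p≡2 x p∤x (+ 4 ℤ∣.∣? (approx x 2 ℤ.- + 1))
  decomposeAt (no  p≢2) x p∤x = decompose-odd x p∤x p≢2

  -- The units of ℤₚ are the elements not divisible by p.
  decompose : ∀ x → ¬ (pₚ ∣ x) → Decomposition x
  decompose = decomposeAt (p ℕ.≟ 2)

  record Close {d x y} (k : ℕ) (D : DecompositionAt d x) (E : DecompositionAt d y) : Set where
    field
      close-ω   : value (ω D) ≈[ k ] value (ω E)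
      close-ω⁻¹ : inverse (ω D) ≈[ k ] inverse (ω E)
      close-⟨⟩  : ⟨⟩ D ≈[ k ] ⟨⟩ E
  open Close public

  decompose-close : ∀ d k {x y} p∤x p∤y → x ≈[ k ℕ.+ 2 ] y → Close k (decomposeAt d x p∤x) (decomposeAt d y p∤y)
  decompose-close (no p≢2) k {x} {y} p∤x p∤y h = record
    { close-ω = c ; close-ω⁻¹ = lv-^ (p ℕ.∸ 2) c ; close-⟨⟩ = lv-* (lv-lower (ℕ.m≤m+n k 2) h) (lv-^ (p ℕ.∸ 2) c) }
    where
      h₁ : approx x 1 ≡ approx y 1 [mod + p ]
      h₁ = subst (approx x 1 ≡ approx y 1 [mod_]) P^1 (at-level (lv-lower (ℕ.≤-trans (s≤s z≤n) (ℕ.m≤n+m 2 k)) h))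
      c : teichmüller (approx x 1) (∤-approx p∤x) ≈[ k ] teichmüller (approx y 1) (∤-approx p∤y)
      c = level (mod-lower (ℕ.n≤1+n k) (teich-cong k h₁))
  decompose-close (yes p≡2) k {x} {y} p∤x p∤y h =
    go (+ 4 ℤ∣.∣? (approx x 2 ℤ.- + 1)) (+ 4 ℤ∣.∣? (approx y 2 ℤ.- + 1))
    where
      h₀ : x ≈[ k ] y
      h₀ = lv-lower (ℕ.m≤m+n k 2) h
      h₂ : approx x 2 ≡ approx y 2 [mod + 4 ]
      h₂ = subst (approx x 2 ≡ approx y 2 [mod_]) (P^2 p≡2) (at-level (lv-lower (ℕ.m≤n+m 2 k) h))
      go : ∀ d e → Close k (decompose-two p≡2 x p∤x d) (decompose-two p≡2 y p∤y e)
      go (yes _) (yes _) = record { close-ω = lv-refl ; close-ω⁻¹ = lv-refl ; close-⟨⟩ = h₀ }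
      go (no  _) (no  _) = record { close-ω = lv-refl ; close-ω⁻¹ = lv-refl ; close-⟨⟩ = lv-neg h₀ }
      go (yes a) (no ¬b) = contradiction (divides-difference (mod-trans (mod-sym h₂) (mod a))) ¬b
      go (no ¬a) (yes b) = contradiction (divides-difference (mod-trans h₂ (mod b))) ¬a

  ^ᶻ-level : ∀ {u v} k → value u ≈[ k ] value v → inverse u ≈[ k ] inverse v → ∀ n → u ^ᶻ n ≈[ k ] v ^ᶻ n
  ^ᶻ-level k h h′ (+ n)    = lv-^ n h
  ^ᶻ-level k h h′ -[1+ n ] = lv-^ (suc n) h′

  falling : ℤₚ → ℕ → ℤₚ
  falling s zero    = 1#
  falling s (suc n) = falling s n * (s - fromℤ (+ n))

  approx-falling : ∀ s n k → approx (falling s n) k ≡ fall (approx s k) n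
  approx-falling s zero    k = refl
  approx-falling s (suc n) k = cong (ℤ._* (approx s k ℤ.- + n)) (approx-falling s n k)

  residueAt : ℤₚ → ℕ → ℕ
  residueAt s k = (approx s k ℤ.%ℕ (p ℕ.^ k)) {{p^≢0 k}}

  binomial-residue : ∀ s n k → + (n !) ℤ.* + (residueAt s k C n) ≡ fall (approx s k) n [mod P^ k ]
  binomial-residue s n k = mod-trans (mod-reflexive (fall-C (residueAt s k) n))
    (fall-mod n (mod-sym (residue (approx s k) (p ℕ.^ k) {{p^≢0 k}})))

  -- The binomial coefficient (s choose n) = s(s - 1)⋯(s - n + 1)/n!, which exists in ℤₚ as the limit of
  -- the binomial coefficients of natural numbers tending to s.
  opaque
    binomial : (s : ℤₚ) (n : ℕ) → Σ ℤₚ λ b → fromℤ (+ (n !)) * b ≈ falling s n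
    binomial s n = limit b cauchy , λ k → let M , conv = limit-converges b cauchy k ; X = M ℕ.⊔ k in
        lv-trans (lv-* {k} {fromℤ (+ (n !))} lv-refl (lv-sym (conv X (ℕ.m≤m⊔n M k))))
          (level (mod-trans (mod-lower (ℕ.m≤n⊔m M k) (binomial-residue s n X))
            (mod-trans (fall-mod n (approx-lower s (ℕ.m≤n⊔m M k))) (mod-reflexive (sym (approx-falling s n k))))))
      where
        b : ℕ → ℤₚ
        b k = fromℤ (+ (residueAt s k C n))
        v : ℕ
        v = proj₁ (cancel (n !) (n!≢0 n))
        lemma : ∀ f x y → f ℤ.* x ℤ.- f ℤ.* y ≡ f ℤ.* (x ℤ.- y)
        lemma = solve-∀
        cauchy : Cauchy b
        cauchy k = k ℕ.+ v , λ m le → level (mod (proj₂ (cancel (n !) (n!≢0 n)) k _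
          (subst (P^ (k ℕ.+ v) ℤ∣.∣_) (lemma (+ (n !)) (+ (residueAt s m C n)) (+ (residueAt s (k ℕ.+ v) C n)))
            (divides-difference (mod-trans (mod-lower le (binomial-residue s n m))
              (mod-trans (fall-mod n (approx-lower s le)) (mod-sym (binomial-residue s n (k ℕ.+ v)))))))))

  _choose_ : ℤₚ → ℕ → ℤₚ
  s choose n = proj₁ (binomial s n)

  1+qℤₚ⇒level : ∀ d {u} → fromℤ (+ q-of d) ∣ u - 1# → u - 1# ≈[ 1 ] 0#
  1+qℤₚ⇒level (yes p≡2) {u} d = lv-lower (s≤s z≤n) (∣⇒level0 2 (subst (λ z → fromℤ z ∣ u - 1#) (sym (P^2 p≡2)) d))
  1+qℤₚ⇒level (no  _)       d = pₚ∣⇒level0 d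

  power-small : ∀ {x} → x ≈[ 1 ] 0# → ∀ n → x ^ n ≈[ n ] 0#
  power-small {x} h n = level (mod-trans (mod-reflexive (approx-^ x n n)) (∣⇒mod0 (go n)))
    where
      pow : ∀ a n → + p ℤ∣.∣ a → P^ n ℤ∣.∣ a ℤ.^ n
      pow a zero    d = ℤ∣.∣-refl
      pow a (suc n) d = subst (ℤ∣._∣ a ℤ.^ suc n) (sym (ℤ.pos-* p (p ℕ.^ n)))
        (ℤ∣.∣-trans (ℤ∣.*-monoˡ-∣ (P^ n) d) (ℤ∣.*-monoʳ-∣ a (pow a n d)))
      go : ∀ n → P^ n ℤ∣.∣ approx x n ℤ.^ n
      go zero    = ℤ∣.∣-refl
      go (suc m) = pow (approx x (suc m)) (suc m) (mod0⇒∣ (subst (approx x (suc m) ≡ + 0 [mod_]) P^1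
        (mod-trans (approx-lower x (s≤s z≤n)) (at-level h))))

  power-Null : ∀ {u} → 1+qℤₚ u → ∀ s → Null (λ n → (s choose n) * (u - 1#) ^ n)
  power-Null {u} h s k = k , λ n k≤n → lv-zeroʳ (s choose n)
    (lv-lower k≤n (power-small (1+qℤₚ⇒level (p ℕ.≟ 2) h) n))

  -- uˢ = Σₙ (s choose n) (u - 1)ⁿ
  power : (u : ℤₚ) → 1+qℤₚ u → ℤₚ → ℤₚ
  power u h s = series (λ n → (s choose n) * (u - 1#) ^ n) (power-Null h s)

  power-level : ∀ {u v} hu hv s k → u ≈[ k ] v → power u hu s ≈[ k ] power v hv s
  power-level {u} {v} hu hv s k h = series-level k (power-Null hu s) (power-Null hv s) λ n →
    lv-* {k} {s choose n} lv-refl (lv-^ n (lv-+ h lv-refl))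

  PowerSeries : Set
  PowerSeries = ℕ → ℤₚ

  infixl 7 _⊛_
  infixl 6 _⊖_

  _⊛_ _⊖_ : PowerSeries → PowerSeries → PowerSeries
  (f ⊛ g) n = sum {suc n} λ i → f (toℕ i) * g (n ℕ.∸ toℕ i)
  (f ⊖ g) n = f n - g n

  const : ℤₚ → PowerSeries
  const a zero    = a
  const a (suc _) = 0#

  T : PowerSeries
  T 1 = 1#
  T _ = 0#

  [1+T]^_ : ℤₚ → PowerSeries
  ([1+T]^ c) n = c choose n

  T⊛-zero : ∀ f → (T ⊛ f) 0 ≈ 0#
  T⊛-zero f = ≈-trans (+-identityʳ (0# * f 0)) (zeroˡ (f 0))

  sum-zero : ∀ {m} {v : Vector ℤₚ m} → (∀ i → v i ≈ 0#) → sum v ≈ 0#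
  sum-zero {zero}  h = ≈-refl
  sum-zero {suc m} {v} h = ≈-trans (+-cong {v zero} {0#} (h zero) (sum-zero (λ i → h (suc i)))) (+-identityʳ 0#)

  T⊛-suc : ∀ f n → (T ⊛ f) (suc n) ≈ f n
  T⊛-suc f n = ≈-trans (+-cong {0# * f (suc n)} {0#} {1# * f n + rest} {f n}
      (zeroˡ (f (suc n)))
      (≈-trans (+-cong {1# * f n} {f n} {rest} {0#} (*-identityˡ (f n)) (sum-zero {v = v} λ i → zeroˡ (f (suc n ℕ.∸ suc (suc (toℕ i)))))) (+-identityʳ (f n))))
    (+-identityˡ (f n))
    where v : Vector ℤₚ n
          v i = 0# * f (suc n ℕ.∸ suc (suc (toℕ i)))
          rest = sum v

  const⊛T : ∀ c n → (const c ⊛ T) n ≈ c * T n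
  const⊛T c n = ≈-trans (+-cong {c * T n} {c * T n} {sum v} {0#} ≈-refl (sum-zero {v = v} λ i → zeroˡ (T (n ℕ.∸ suc (toℕ i)))))
                        (+-identityʳ (c * T n))
    where v : Vector ℤₚ n
          v i = 0# * T (n ℕ.∸ suc (toℕ i))

  minus-zero : ∀ x y k → y ≈[ k ] 0# → x - y ≈[ k ] x
  minus-zero x y k h = lv-trans (lv-+ {k} {x} lv-refl (lv-neg h)) (exactly {x - 0#} {x} (λ n → ℤ.+-identityʳ (approx x n)) k)

  -- The power series g with T · E · g = E - c T, for E = c T + ⋯ and c invertible.
  module _ (c : ℤₚˣ) (E : PowerSeries) where
    quotientStep : (m : ℕ) → Vector ℤₚ m → ℤₚ
    quotientStep m prev = inverse c * (E (suc (suc m)) - sum λ i → E (suc (suc (toℕ i))) * prev i)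

    -- The coefficients of index m - 1, …, 0.
    quotientPrevious : (m : ℕ) → Vector ℤₚ m
    quotientPrevious (suc m) = quotientStep m (quotientPrevious m) ∷ quotientPrevious m

    quotientSeries : PowerSeries
    quotientSeries m = quotientStep m (quotientPrevious m)

    quotientPrevious≡ : ∀ m i → quotientPrevious m i ≡ quotientSeries (m ℕ.∸ suc (toℕ i))
    quotientPrevious≡ (suc m) zero    = refl
    quotientPrevious≡ (suc m) (suc i) = quotientPrevious≡ m i

    module _ (E0 : E 0 ≈ 0#) (E1 : E 1 ≈ value c) where
      E⊛quotient : ∀ m → (E ⊛ quotientSeries) (suc m) ≈ E (suc (suc m))
      E⊛quotient m n = lv-trans (lv-+ (lv-trans (lv-* {n} {E 0} {0#} {quotientSeries (suc m)} (E0 n) lv-refl) (zeroˡ (quotientSeries (suc m)) n))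
            (lv-+ {n} {E 1 * quotientSeries m} {value c * quotientSeries m} (lv-* (E1 n) lv-refl)
              (lv-sum {n} {m} {w = w} λ i → lv-* {n} {E (suc (suc (toℕ i)))} lv-refl (level (mod-reflexive (cong (λ z → approx z n) (sym (quotientPrevious≡ m i))))))))
          (level (mod-trans (mod-reflexive (lemma (approx (value c) n) (approx (inverse c) n) (approx (E (suc (suc m))) n) (approx (sum w) n)))
            (mod-trans (mod-+ (mod-* (at-level (isInverse c n)) mod-refl) mod-refl) (mod-reflexive (lemma′ (approx (E (suc (suc m))) n) (approx (sum w) n))))))
        where
          w : Vector ℤₚ m
          w i = E (suc (suc (toℕ i))) * quotientPrevious m i
          lemma : ∀ c c′ e s → + 0 ℤ.+ (c ℤ.* (c′ ℤ.* (e ℤ.- s)) ℤ.+ s) ≡ (c ℤ.* c′) ℤ.* (e ℤ.- s) ℤ.+ s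
          lemma = solve-∀
          lemma′ : ∀ e s → + 1 ℤ.* (e ℤ.- s) ℤ.+ s ≡ e
          lemma′ = solve-∀

      quotient-spec : ∀ n → (T ⊛ (E ⊛ quotientSeries)) n ≈ (E ⊖ (const (value c) ⊛ T)) n
      quotient-spec zero k = lv-trans (T⊛-zero (E ⊛ quotientSeries) k) (lv-sym (lv-trans
        (minus-zero (E 0) _ k (lv-trans (const⊛T (value c) 0 k) (zeroʳ (value c) k))) (E0 k)))
      quotient-spec (suc zero) k = lv-trans (T⊛-suc (E ⊛ quotientSeries) 0 k)
        (lv-trans (lv-trans (+-identityʳ (E 0 * quotientSeries 0) k) (lv-trans (lv-* {k} {E 0} {0#} {quotientSeries 0} (E0 k) lv-refl) (zeroˡ (quotientSeries 0) k)))
          (lv-sym (lv-trans (lv-+ {k} {E 1} {value c} (E1 k) (lv-neg (lv-trans (const⊛T (value c) 1 k) (*-identityʳ (value c) k)))) (-‿inverseʳ (value c) k))))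
      quotient-spec (suc (suc m)) k = lv-trans (T⊛-suc (E ⊛ quotientSeries) (suc m) k) (lv-trans (E⊛quotient m k)
        (lv-sym (minus-zero (E (suc (suc m))) _ k (lv-trans (const⊛T (value c) (suc (suc m)) k) (zeroʳ (value c) k)))))

  -- (1 + T)^c - 1
  denominator : ℤₚ → PowerSeries
  denominator c = [1+T]^ c ⊖ const 1#

  choose-0 : ∀ c → (denominator c) 0 ≈ 0#
  choose-0 c n = level (mod-trans (mod-+ {b = + 1} (mod-trans
    (mod-reflexive (sym (ℤ.*-identityˡ (approx (c choose 0) n)))) (at-level (proj₂ (binomial c 0) n))) (mod-refl {a = ℤ.- + 1})) (mod-refl {a = + 0}))

  choose-1 : ∀ c → (denominator c) 1 ≈ c
  choose-1 c n = level (mod-trans (mod-reflexive (trans (ℤ.+-identityʳ (approx (c choose 1) n)) (sym (ℤ.*-identityˡ (approx (c choose 1) n)))))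
    (mod-trans (at-level (proj₂ (binomial c 1) n)) (mod-reflexive (lemma (approx c n)))))
    where lemma : ∀ a → + 1 ℤ.* (a ℤ.- + 0) ≡ a
          lemma = solve-∀

  -- g_c = 1/((1+T) - 1) - c/((1+T)^c - 1), with denominators cleared.
  IsG : ℤₚ → PowerSeries → Set
  IsG c g = ∀ n → (T ⊛ (denominator c ⊛ g)) n ≈ (denominator c ⊖ (const c ⊛ T)) n

  opaque
    gSeries : (c : ℤₚˣ) → Σ PowerSeries (IsG (value c))
    gSeries c = quotientSeries c (denominator (value c))
              , quotient-spec c (denominator (value c)) (choose-0 (value c)) (choose-1 (value c))

  -- mass N j is the measure of j + p^N ℤₚ.
  record Measure : Set where
    field
      mass     : (N : ℕ) → Fin (p ℕ.^ N) → ℤₚ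
      additive : ∀ N j → mass N j ≈ sum λ (i : Fin p) → mass (suc N) (combine i j)
  open Measure public

  coefficient-Null : ∀ (a : PowerSeries) N j → Null (λ n → a n * fromℤ (coefficient N n j))
  coefficient-Null a N j k = k ℕ.* p ℕ.^ N , λ n le → lv-zeroʳ (a n) (level (coefficient-small N k n le j))

  sum-fromℤ : ∀ n (f : ℕ → ℤ) → fromℤ (Σ< n f) ≈ sum {n} (λ i → fromℤ (f (toℕ i)))
  sum-fromℤ zero    f = ≈-refl
  sum-fromℤ (suc n) f k = lv-trans (level (mod-reflexive (Σ<-shift n f)))
    (lv-+ {k} {fromℤ (f 0)} {fromℤ (f 0)} {fromℤ (Σ< n (λ i → f (suc i)))} lv-refl (sum-fromℤ n (λ i → f (suc i)) k))

  toℕ-combine : ∀ N (i : Fin p) (j : Fin (p ℕ.^ N)) → + toℕ (combine i j) ≡ + toℕ j ℤ.+ + toℕ i ℤ.* P^ N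
  toℕ-combine N i j = trans (cong +_ (Fin.toℕ-combine i j))
    (trans (cong (ℤ._+ + toℕ j) (ℤ.pos-* (p ℕ.^ N) (toℕ i))) (lemma (P^ N) (+ toℕ i) (+ toℕ j)))
    where lemma : ∀ P i j → P ℤ.* i ℤ.+ j ≡ j ℤ.+ i ℤ.* P
          lemma = solve-∀

  coefficient-additive′ : ∀ N n (j : Fin (p ℕ.^ N)) →
    fromℤ (coefficient N n (+ toℕ j)) ≈ sum (λ (i : Fin p) → fromℤ (coefficient (suc N) n (+ toℕ (combine i j))))
  coefficient-additive′ N n j k =
    lv-trans {k} {fromℤ (coefficient N n (+ toℕ j))} {fromℤ (Σ< p u)} {sum w}
      (level (mod-reflexive (coefficient-additive N n (+ toℕ j))))
      (lv-trans {k} {fromℤ (Σ< p u)} {sum v} {sum w} (sum-fromℤ p u k)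
        (lv-sum {k} {p} {v} {w} λ i → level (mod-reflexive (cong (coefficient (suc N) n) (sym (toℕ-combine N i j))))))
    where u : ℕ → ℤ
          u i = coefficient (suc N) n (+ toℕ j ℤ.+ + i ℤ.* P^ N)
          v w : Vector ℤₚ p
          v i = fromℤ (u (toℕ i))
          w i = fromℤ (coefficient (suc N) n (+ toℕ (combine i j)))

  series-additive : ∀ {m} (t : ℕ → ℤₚ) (ht : Null t) (u : Fin m → ℕ → ℤₚ) (hu : ∀ i → Null (u i)) →
                    (∀ n → t n ≈ sum (λ i → u i n)) → series t ht ≈ sum (λ i → series (u i) (hu i))
  series-additive {m} t ht u hu h k =
    lv-trans {k} {series t ht} {series v hv} {sum (λ i → series (u i) (hu i))}
      (series-level {t} {v} k ht hv (λ n → h n k)) (lv-sym (series-sum {m} {u} hu k))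
    where
      v : ℕ → ℤₚ
      v n = sum (λ i → u i n)
      hv : Null v
      hv = sum-Null hu

  module _ (a : PowerSeries) where
    massTerm : (N : ℕ) → Fin (p ℕ.^ N) → ℕ → ℤₚ
    massTerm N j n = a n * fromℤ (coefficient N n (+ toℕ j))

    massTerm-Null : ∀ N j → Null (massTerm N j)
    massTerm-Null N j = coefficient-Null a N (+ toℕ j)

    massTerm-additive : ∀ N j n → massTerm N j n ≈ sum λ (i : Fin p) → massTerm (suc N) (combine i j) n
    massTerm-additive N j n = ≈-trans {massTerm N j n} {a n * sum w}
        (*-cong {a n} {a n} {fromℤ (coefficient N n (+ toℕ j))} {sum w} ≈-refl (coefficient-additive′ N n j))
        (*-distribˡ-sum (a n) w)
      where w : Vector ℤₚ p
            w i = fromℤ (coefficient (suc N) n (+ toℕ (combine i j)))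

    -- The measure corresponding to Σₙ aₙTⁿ, whose image in ℤₚ[ℤ/p^N] is Σₙ aₙ(τ - 1)ⁿ with τ the class of 1.
    measureOf : Measure
    measureOf .mass     N j = series (massTerm N j) (massTerm-Null N j)
    measureOf .additive N j = series-additive {p} (massTerm N j) (massTerm-Null N j)
      (λ i → massTerm (suc N) (combine i j)) (λ i → massTerm-Null (suc N) (combine i j)) (massTerm-additive N j)

  m̃ : ℤₚˣ → Measure
  m̃ c = measureOf (proj₁ (gSeries c))

  -- On the compact space ℤₚʳ continuity is uniform continuity.
  ModulusAt : ∀ {r} → (Vector ℤₚ r → ℤₚ) → ℕ → ℕ → Set
  ModulusAt f k N = ∀ x y → (∀ i → x i ≈[ N ] y i) → f x ≈[ k ] f y

  Continuous : ∀ {r} → (Vector ℤₚ r → ℤₚ) → Set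
  Continuous f = ∀ k → Σ ℕ (ModulusAt f k)

  -- Σ f(j₁, …, jᵣ) μ(j₁ + p^N ℤₚ) ⋯ μ(jᵣ + p^N ℤₚ)
  riemannSum : Measure → ℕ → ∀ r → (Vector ℤₚ r → ℤₚ) → ℤₚ
  riemannSum μ N zero    f = f λ ()
  riemannSum μ N (suc r) f = sum λ j → mass μ N j * riemannSum μ N r λ x → f (fromℤ (+ toℕ j) ∷ x)

  riemannSum-level : ∀ μ N r {f g} k → (∀ x → f x ≈[ k ] g x) → riemannSum μ N r f ≈[ k ] riemannSum μ N r g
  riemannSum-level μ N zero    k h = h _
  riemannSum-level μ N (suc r) k h = lv-sum λ j →
    lv-* {k} {mass μ N j} lv-refl (riemannSum-level μ N r k λ x → h (fromℤ (+ toℕ j) ∷ x))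

  sum-↑ : ∀ m {n} (v : Vector ℤₚ (m ℕ.+ n)) → sum v ≈ sum (λ i → v (i Fin.↑ˡ n)) + sum (λ i → v (m Fin.↑ʳ i))
  sum-↑ zero    v = ≈-sym (+-identityˡ (sum v))
  sum-↑ (suc m) {n} v = ≈-trans (+-cong {v zero} {v zero} ≈-refl (sum-↑ m (λ i → v (suc i))))
    (≈-sym (+-assoc (v zero) (sum λ i → v (suc i Fin.↑ˡ n)) (sum λ i → v (suc m Fin.↑ʳ i))))

  sum-combine : ∀ m {n} (v : Vector ℤₚ (m ℕ.* n)) → sum v ≈ sum {m} (λ i → sum {n} (λ j → v (combine i j)))
  sum-combine zero    v = ≈-refl
  sum-combine (suc m) {n} v = ≈-trans (sum-↑ n v)
    (+-cong {sum (λ j → v (j Fin.↑ˡ (m ℕ.* n)))} {sum (λ j → v (j Fin.↑ˡ (m ℕ.* n)))} ≈-refl (sum-combine m (λ i → v (n Fin.↑ʳ i))))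

  ∷-level : ∀ {r N a b} {x y : Vector ℤₚ r} → a ≈[ N ] b → (∀ i → x i ≈[ N ] y i) → ∀ i → (a ∷ x) i ≈[ N ] (b ∷ y) i
  ∷-level h h′ zero    = h
  ∷-level h h′ (suc i) = h′ i

  riemannSum-step : ∀ μ r f k N → ModulusAt f k N → riemannSum μ (suc N) r f ≈[ k ] riemannSum μ N r f
  riemannSum-step μ zero    f k N h = lv-refl
  riemannSum-step μ (suc r) f k N h =
    lv-trans (sum-combine p {p ℕ.^ N} (λ J → mass μ (suc N) J * R (suc N) (fromℤ (+ toℕ J))) k)
    (lv-trans (lv-sum λ (i : Fin p) → lv-sum λ (j : Fin (p ℕ.^ N)) → lv-* {k} {mass μ (suc N) (combine i j)} lv-refl (lv-trans
        (riemannSum-step μ r (λ x → f (fromℤ (+ toℕ (combine i j)) ∷ x)) k N λ x y e → h _ _ (∷-level lv-refl e))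
        (riemannSum-level μ N r k λ x → h _ _ (∷-level (same i j) (λ _ → lv-refl)))))
    (lv-trans (∑-comm {p} {p ℕ.^ N} (λ i j → mass μ (suc N) (combine i j) * R N (fromℤ (+ toℕ j))) k)
      (lv-sum λ j → lv-trans
        (lv-sym (*-distribʳ-sum (R N (fromℤ (+ toℕ j))) (λ (i : Fin p) → mass μ (suc N) (combine i j)) k))
        (lv-* {k} (lv-sym (additive μ N j k)) lv-refl))))
    where
      R : ℕ → ℤₚ → ℤₚ
      R M a = riemannSum μ M r λ x → f (a ∷ x)
      same : ∀ (i : Fin p) (j : Fin (p ℕ.^ N)) → fromℤ (+ toℕ (combine i j)) ≈[ N ] fromℤ (+ toℕ j)
      same i j = level (mod-trans (mod-reflexive (toℕ-combine N i j)) (mod (ℤ∣.divides (+ toℕ i) (lemma (+ toℕ j) (+ toℕ i ℤ.* P^ N)))))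
        where lemma : ∀ a b → (a ℤ.+ b) ℤ.- a ≡ b
              lemma = solve-∀

  riemannSum-Cauchy : ∀ μ r {f} → Continuous f → Cauchy (λ N → riemannSum μ N r f)
  riemannSum-Cauchy μ r {f} cont k = N , λ n N≤n →
      subst (λ z → riemannSum μ z r f ≈[ k ] riemannSum μ N r f) (ℕ.m∸n+n≡m N≤n) (go (n ℕ.∸ N))
    where
      N = proj₁ (cont k)
      go : ∀ d → riemannSum μ (d ℕ.+ N) r f ≈[ k ] riemannSum μ N r f
      go zero    = lv-refl
      go (suc d) = lv-trans (riemannSum-step μ r f k (d ℕ.+ N) λ x y h →
        proj₂ (cont k) x y λ i → lv-lower (ℕ.m≤n+m N d) (h i)) (go d)

  -- The integral against the r-fold product of μ with itself, as a limit of Riemann sums.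
  ∫ : ∀ {r} (f : Vector ℤₚ r → ℤₚ) → Continuous f → Measure → ℤₚ
  ∫ {r} f cont μ = limit (λ N → riemannSum μ N r f) (riemannSum-Cauchy μ r cont)

  module _ {r : ℕ} (γ : Vector ℤₚ r) where
    -- Σ_{j ≤ k} xⱼγⱼ
    partialForm : Vector ℤₚ r → Vector ℤₚ r
    partialForm x k = sum λ j → if does (j Fin.≤? k) then x j * γ j else 0#

    Domain : Vector ℤₚ r → Set
    Domain x = ∀ k → ¬ (pₚ ∣ partialForm x k)

    domain? : ∀ x → Dec (Domain x)
    domain? x = Fin.all? λ k → ¬? (pₚ∣? (partialForm x k))

    partialForm-level : ∀ {x y} N → (∀ i → x i ≈[ N ] y i) → ∀ k → partialForm x k ≈[ N ] partialForm y k
    partialForm-level {x} {y} N h k = lv-sum λ j → go (does (j Fin.≤? k)) j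
      where go : ∀ b j → (if b then x j * γ j else 0#) ≈[ N ] (if b then y j * γ j else 0#)
            go true  j = lv-* (h j) lv-refl
            go false j = lv-refl

    pₚ∣-level : ∀ {x y} → x ≈[ 1 ] y → pₚ ∣ x → pₚ ∣ y
    pₚ∣-level h d = level0⇒pₚ∣ (lv-trans (lv-sym h) (pₚ∣⇒level0 d))

    Domain-level : ∀ {x y} → (∀ i → x i ≈[ 1 ] y i) → Domain x → Domain y
    Domain-level h D k d = D k (pₚ∣-level (lv-sym (partialForm-level 1 h k)) d)

  -- ⟨y⟩⁻ˢ ωⁿ(y)
  factorOf : ∀ {y} → ℤₚ → ℤ → Decomposition y → ℤₚ
  factorOf s n D = power (⟨⟩ D) (⟨⟩∈1+qℤₚ D) (- s) * (ω D ^ᶻ n)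

  factorOf-level : ∀ {y z} s n k (D : Decomposition y) (E : Decomposition z) → Close k D E → factorOf s n D ≈[ k ] factorOf s n E
  factorOf-level s n k D E c =
    lv-* {k} {power (⟨⟩ D) (⟨⟩∈1+qℤₚ D) (- s)} {power (⟨⟩ E) (⟨⟩∈1+qℤₚ E) (- s)} {ω D ^ᶻ n} {ω E ^ᶻ n}
      (power-level {⟨⟩ D} {⟨⟩ E} (⟨⟩∈1+qℤₚ D) (⟨⟩∈1+qℤₚ E) (- s) k (close-⟨⟩ c))
      (^ᶻ-level {ω D} {ω E} k (close-ω c) (close-ω⁻¹ c) n)

  factor : (s : ℤₚ) (n : ℤ) (y : ℤₚ) → ¬ (pₚ ∣ y) → ℤₚ
  factor s n y p∤y = factorOf s n (decompose y p∤y)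

  factor-level : ∀ s n k {y z} p∤y p∤z → y ≈[ k ℕ.+ 2 ] z → factor s n y p∤y ≈[ k ] factor s n z p∤z
  factor-level s n k {y} {z} p∤y p∤z h =
    factorOf-level s n k (decompose y p∤y) (decompose z p∤z) (decompose-close (p ℕ.≟ 2) k p∤y p∤z h)

  module _ {r : ℕ} (s : Vector ℤₚ r) (n : Vector ℤ r) (γ : Vector ℤₚ r) where
    integrandAt : ∀ x → Dec (Domain γ x) → ℤₚ
    integrandAt x (yes D) = product λ k → factor (s k) (n k) (partialForm γ x k) (D k)
    integrandAt x (no  _) = 0#

    -- The integrand, extended by zero outside the domain of integration.
    integrand : Vector ℤₚ r → ℤₚ
    integrand x = integrandAt x (domain? γ x)

    integrand-continuous : Continuous integrand
    integrand-continuous k = k ℕ.+ 2 , λ x y h → go x y h (domain? γ x) (domain? γ y)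
      where
        lower : ∀ {x y : Vector ℤₚ r} → (∀ i → x i ≈[ k ℕ.+ 2 ] y i) → ∀ i → x i ≈[ 1 ] y i
        lower h i = lv-lower (ℕ.≤-trans (s≤s z≤n) (ℕ.m≤n+m 2 k)) (h i)
        go : ∀ x y → (∀ i → x i ≈[ k ℕ.+ 2 ] y i) → ∀ d e → integrandAt x d ≈[ k ] integrandAt y e
        go x y h (yes D) (yes E) = lv-product λ i → factor-level (s i) (n i) k (D i) (E i) (partialForm-level γ (k ℕ.+ 2) h i)
        go x y h (no  _) (no  _) = lv-refl
        go x y h (yes D) (no ¬E) = contradiction (Domain-level γ (lower h) D) ¬E
        go x y h (no ¬D) (yes E) = contradiction (Domain-level γ (λ i → lv-sym (lower h i)) E) ¬D

    -- L_{p,r}(s₁, …, sᵣ; ω^n₁, …, ω^nᵣ; γ₁, …, γᵣ; c) for s₁, …, sᵣ ∈ ℤₚ.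
    L : ℤₚˣ → ℤₚ
    L c = ∫ integrand integrand-continuous (m̃ c)

  unit-∤ : (c : ℤₚˣ) → ¬ (+ p ℤ∣.∣ approx (value c) 1)
  unit-∤ c d = ℕ.<⇒≱ (ℕ.nonTrivial⇒n>1 p {{prime⇒nonTrivial p-prime}}) (ℕ.∣⇒≤ (ℤ∣.∣⇒∣ᵤ (mod0⇒∣ {+ p} {+ 1} (mod-trans
    (mod-sym (subst (approx (value c * inverse c) 1 ≡ + 1 [mod_]) P^1 (at-level (isInverse c 1))))
    (∣⇒mod0 (ℤ∣.∣m⇒∣m*n (approx (inverse c) 1) d))))))

  half-two : p ≡ 2 → (c : ℤₚˣ) → Σ ℤₚ λ h → fromℤ (+ 2) * h ≈ 1# - value c
  half-two p≡2 c = h , λ n → lv-trans (*-comm (fromℤ (+ 2)) h n)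
      (subst (λ z → h * fromℤ (+ z) ≈ 1# - value c) p≡2 h-spec n)
    where
      a = approx (value c) 1
      a≡1 : a ≡ + 1 [mod + p ]
      a≡1 = subst (λ z → z ≡ + 1 [mod + p ]) (trans (cong (λ z → a ℤ.^ (z ℕ.∸ 1)) p≡2) (ℤ.^-identityʳ a)) (fermat′ a (unit-∤ c))
      even : pₚ ∣ 1# - value c
      even = level0⇒pₚ∣ (level (subst (+ 1 ℤ.- a ≡ + 0 [mod_]) (sym P^1) (mod-+ {b = + 1} {d = ℤ.- + 1} mod-refl (mod-neg a≡1))))
      split : pₚ ∣ 1# - value c → Σ ℤₚ λ h → h * pₚ ≈ 1# - value c
      split (h ,∣ e) = h , e
      h = proj₁ (split even)
      h-spec = proj₂ (split even)

  half-odd : ¬ (p ≡ 2) → (c : ℤₚˣ) → Σ ℤₚ λ h → fromℤ (+ 2) * h ≈ 1# - value c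
  half-odd p≢2 c = e * (1# - value c) , λ n → level (mod-trans (mod-reflexive (sym (ℤ.*-assoc (+ 2) (E n) (approx (1# - value c) n))))
      (mod-trans (mod-* {b = + 1} (mod-trans (mod-reflexive (2E n)) (mod (ℤ∣.divides (+ 1) (lemma (P^ n))))) mod-refl)
                 (mod-reflexive (ℤ.*-identityˡ (approx (1# - value c) n)))))
    where
      lemma : ∀ P → + 1 ℤ.+ P ℤ.- + 1 ≡ + 1 ℤ.* P
      lemma = solve-∀
      m = p ℕ./ 2
      p≡ : p ≡ 1 ℕ.+ m ℕ.* 2
      p≡ = go (p ℕ.% 2) (ℕ.m%n<n p 2) (ℕ.m≡m%n+[m/n]*n p 2)
        where
          go : ∀ r → r < 2 → p ≡ r ℕ.+ m ℕ.* 2 → p ≡ 1 ℕ.+ m ℕ.* 2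
          go 1 _ eq = eq
          go (suc (suc r)) (s≤s (s≤s ())) eq
          go 0 _ eq with prime⇒irreducible p-prime (ℕ.divides m eq)
          ... | inj₂ 2≡p = contradiction (sym 2≡p) p≢2
      E : ℕ → ℤ
      E zero    = + 1
      E (suc n) = E n ℤ.+ + m ℤ.* P^ n
      2E : ∀ n → + 2 ℤ.* E n ≡ + 1 ℤ.+ P^ n
      2E zero    = refl
      2E (suc n) = trans (ℤ.*-distribˡ-+ (+ 2) (E n) (+ m ℤ.* P^ n)) (trans (cong (ℤ._+ + 2 ℤ.* (+ m ℤ.* P^ n)) (2E n))
          (trans (lemma′ (P^ n) (+ m)) (cong (ℤ._+_ (+ 1)) (sym (trans (ℤ.pos-* p (p ℕ.^ n)) (cong (ℤ._* P^ n)
            (trans (cong +_ p≡) (cong (ℤ._+_ (+ 1)) (ℤ.pos-* m 2)))))))))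
        where lemma′ : ∀ P m → + 1 ℤ.+ P ℤ.+ + 2 ℤ.* (m ℤ.* P) ≡ + 1 ℤ.+ (+ 1 ℤ.+ m ℤ.* + 2) ℤ.* P
              lemma′ = solve-∀
      e : ℤₚ
      e .approx     = E
      e .coherent n = mod (ℤ∣.divides (+ m) (lemma′ (E n) (+ m ℤ.* P^ n)))
        where lemma′ : ∀ a b → (a ℤ.+ b) ℤ.- a ≡ b
              lemma′ = solve-∀

  -- For p = 2 the division by 2 is possible in ℤₚ because the unit c is odd.
  halfOf1- : (c : ℤₚˣ) → Σ ℤₚ λ h → fromℤ (+ 2) * h ≈ 1# - value c
  halfOf1- with p ℕ.≟ 2
  ... | yes p≡2 = half-two p≡2
  ... | no  p≢2 = half-odd p≢2

  [1-_]/2 : ℤₚˣ → ℤₚ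
  [1- c ]/2 = proj₁ (halfOf1- c)

  sumOver : ∀ {A : Set} → List A → (A → ℤₚ) → ℤₚ
  sumOver xs f = List.foldr (λ x y → f x + y) 0# xs

{-# OPTIONS --safe #-}
-- Let h = (1 - c)/2. In the group ring, g_c satisfies (τ - 1)(τᶜ - 1)g = (τᶜ - 1) - c(τ - 1). This makes
-- the sum of μ = m̃_c + hδ₀ and its reflection under x ↦ -x a distribution annihilated by (τ - 1)(τᶜ - 1).
-- A translation-invariant distribution vanishes, its masses being divisible by all powers of p, so μ is odd.
-- The integrand has parity (-1)^(k₁ + ⋯ + kᵣ) ≠ (-1)ʳ, hence its integral against μʳ is zero. Expanding
-- (m̃_c + hδ₀)ʳ gives one term for each J: setting xⱼ = 0 for j ∉ J makes the partial sums constant on the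
-- blocks of J, whose factors combine by the exponent laws, and the integrand vanishes when x₁ = 0.
module Submission where

open import Defs
open Integers using (_≡_[mod_])
open import Data.Fin.Base using (Fin; suc)
open import Data.Fin.Subset using (∣_∣)
open import Data.Integer.Base using (ℤ; +_; +-0-rawMonoid)
open import Algebra.Definitions.RawMonoid +-0-rawMonoid using () renaming (sum to sumℤ)
open import Data.Nat.Base using (ℕ; suc; _∸_)
open import Data.Nat.Primality using (Prime)
open import Data.Vec.Functional using (Vector)
open import Function.Base using (_∘_)
open import Relation.Nullary using (¬_)

open import Algebra.Bundles using (CommutativeRing; Monoid)
open import Data.Bool.Base using (true; false; _∧_; if_then_else_)
open import Data.Fin.Base as Fin using (zero; toℕ)
open import Data.Fin.Permutation using (permutation)
import Data.Fin.Properties as Fin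
open import Data.Fin.Subset using (Subset; inside; outside; ⊤; _∉_)
open import Data.Fin.Subset.Properties using (_∈?_; _⊂?_; ∈⊤; ∣p∣≤n; ∣⊤∣≡n; drop-there)
open import Data.Integer.Base as ℤ using (-[1+_])
import Data.Integer.DivMod as ℤ
open import Data.Integer.Divisibility.Signed as ℤ∣ using (divides)
import Data.Integer.Properties as ℤ
open import Data.Integer.Tactic.RingSolver using (solve-∀)
open import Data.List.Base as List using (List; _++_; filter)
open import Data.Nat.Base as ℕ using (zero; _≤_; _<_; s≤s; z≤n; NonZero; _!)
open import Data.Nat.Combinatorics using (_C_; nCk+nC[k+1]≡[n+1]C[k+1]; k>n⇒nCk≡0)
import Data.Nat.Divisibility as ℕ
import Data.Nat.DivMod as ℕ
open import Data.Nat.Primality using (prime⇒nonTrivial; prime⇒irreducible)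
import Data.Nat.Properties as ℕ
open import Data.Product.Base using (Σ; _×_; _,_; proj₁; proj₂)
open import Data.Sum.Base using (_⊎_; inj₁; inj₂)
open import Data.Vec.Functional using (_∷_)
import Data.Vec.Base as Vec
open import Level using (0ℓ)
open import Relation.Binary.Bundles using (Setoid)
open import Relation.Binary.PropositionalEquality using (_≡_; refl; sym; trans; cong; cong₂; subst)
import Relation.Binary.Reasoning.Setoid as SetoidReasoning
open import Relation.Nullary using (Dec; yes; no; contradiction; does; _×-dec_)

-- In every finite group ring ℤₚ[ℤ/p^N] the elements τ - 1 and τᶜ - 1 annihilate the sum of all
-- group elements, so neither can be cancelled at a single level N. Cancellation succeeds only for
-- families compatible in N, and for this reason the oddness of μ is proved for distributions and
-- not for one Riemann sum. The constant (1 - c)/2 is forced. With y = 1 + T one has 1/(y - 1) +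
-- 1/(y⁻¹ - 1) = -1, hence formally g_c(y) + g_c(y⁻¹) = c - 1, and half of 1 - c must be added to
-- make g_c odd. The substitution y ↦ y⁻¹ is never carried out on power series; it is the index
-- change j ↦ -j in the group ring. p-adic exponents occur in (1 + T)ᶜ and in ⟨y⟩⁻ˢ. Modulo pᵏ both
-- are replaced by natural exponents that approximate c or -s closely enough, which reduces the laws
-- needed to those of ordinary powers. Oddness gives X = -X for the Riemann sums X, and for p = 2
-- this yields X = 0 only with a loss of precision. Hence the statements are congruences modulo pᵏ
-- for arbitrary k.

≤ᵇ-suc : ∀ m n → (suc m ℕ.≤ᵇ suc n) ≡ (m ℕ.≤ᵇ n)
≤ᵇ-suc zero    n = refl
≤ᵇ-suc (suc m) n = refl

-- Block sums of a subset

module BlockSums {a ℓ} (M : Monoid a ℓ) where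
  open Monoid M using (Carrier; _≈_; _∙_; ε; identityˡ; rawMonoid) renaming (refl to ≈-refl; trans to ≈-trans)
  open import Algebra.Definitions.RawMonoid rawMonoid using (sum)

  -- In `regroup` a block is already open when the vector starts. These are the entries that still
  -- fall into that block, up to the first element of J.
  prefixSum : ∀ {n} → Subset n → Vector Carrier n → Carrier
  prefixSum J v = sum λ l → if toℕ l ℕ.<ᵇ position J 0 then v l else ε

  sum-ε : ∀ n → sum {n} (λ _ → ε) ≈ ε
  sum-ε zero    = ≈-refl
  sum-ε (suc n) = ≈-trans (identityˡ _) (sum-ε n)

  sum-cong : ∀ {n} {v w : Vector Carrier n} → (∀ i → v i ≡ w i) → sum v ≡ sum w
  sum-cong {zero}  h = refl
  sum-cong {suc n} h = cong₂ _∙_ (h zero) (sum-cong (h ∘ suc))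

  blockSum-outside : ∀ {n} (J : Subset n) v μ → blockSum rawMonoid (outside Vec.∷ J) v μ ≈ blockSum rawMonoid J (v ∘ suc) μ
  blockSum-outside J v μ = ≈-trans (identityˡ _) (Monoid.reflexive M (sum-cong λ l →
    cong (λ b → if b ∧ (toℕ l ℕ.<ᵇ position J (suc (toℕ μ))) then v (suc l) else ε) (≤ᵇ-suc (position J (toℕ μ)) (toℕ l))))

  -- From its second element on, `inside ∷ J` has the same positions as `outside ∷ J` has from its
  -- first, so both block sums reduce to the same expression.
  blockSum-inside-suc : ∀ {n} (J : Subset n) v μ → blockSum rawMonoid (inside Vec.∷ J) v (suc μ) ≈ blockSum rawMonoid J (v ∘ suc) μ
  blockSum-inside-suc = blockSum-outside

module FunctionalEquation (p : ℕ) (p-prime : Prime p) where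
  open Integers
  open PrimePowers p p-prime
  open PAdic p p-prime
  open import Algebra.Properties.Semiring.Sum semiring using (sum-permute)

  -- Power series as distributions

  lv-setoid : ℕ → Setoid 0ℓ 0ℓ
  lv-setoid k = record
    { Carrier = ℤₚ ; _≈_ = λ x y → x ≈[ k ] y
    ; isEquivalence = record { refl = lv-refl ; sym = lv-sym ; trans = lv-trans } }

  module lv-Reasoning (k : ℕ) = SetoidReasoning (lv-setoid k)
  module ≈-Reasoning = SetoidReasoning (CommutativeRing.setoid ℤₚ-commutativeRing)

  ⟶-suc : ∀ {s x} → s ⟶ x → (s ∘ suc) ⟶ x
  ⟶-suc h k = proj₁ (h k) , λ n le → proj₂ (h k) (suc n) (ℕ.m≤n⇒m≤1+n le)

  ⟶-const : ∀ x → (λ _ → x) ⟶ x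
  ⟶-const x k = 0 , λ _ _ → lv-refl

  series-⟶ : ∀ {t} (ht : Null t) → partialSum t ⟶ series t ht
  series-⟶ ht = limit-converges _ (partialSum-Cauchy ht)

  ⟶-unique : ∀ {s t x y} → s ⟶ x → t ⟶ y → (∀ n → s n ≈ t n) → x ≈ y
  ⟶-unique hs ht h k = limit-level k hs ht (0 , λ n _ → h n k)

  series-shift : ∀ {t u} (ht : Null t) (hu : Null u) → t 0 ≈ 0# → (∀ n → t (suc n) ≈ u n) → series t ht ≈ series u hu
  series-shift {t} {u} ht hu h0 h = ⟶-unique (⟶-suc (series-⟶ ht)) (series-⟶ hu) go
    where
      go : ∀ n → partialSum t (suc n) ≈ partialSum u n
      go zero    k = lv-trans (+-identityˡ (t 0) k) (h0 k)
      go (suc n) k = lv-+ (go n k) (h n k)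

  series-single : ∀ {t} (ht : Null t) → (∀ n → t (suc n) ≈ 0#) → series t ht ≈ t 0
  series-single {t} ht h = ⟶-unique (⟶-suc (series-⟶ ht)) (⟶-const (t 0)) go
    where
      go : ∀ n → partialSum t (suc n) ≈ t 0
      go zero      = +-identityˡ (t 0)
      go (suc n) k = lv-trans (lv-+ (go n k) (h n k)) (+-identityʳ (t 0) k)

  series-cong : ∀ {t u} (ht : Null t) (hu : Null u) → (∀ n → t n ≈ u n) → series t ht ≈ series u hu
  series-cong ht hu h k = series-level k ht hu λ n → h n k

  infixl 6 _⊕_

  _⊕_ : PowerSeries → PowerSeries → PowerSeries
  (f ⊕ g) n = f n + g n

  evalTerm : PowerSeries → ℕ → ℤ → ℕ → ℤₚ
  evalTerm a N j n = a n * fromℤ (coefficient N n j)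

  evalTerm-Null : ∀ a N j → Null (evalTerm a N j)
  evalTerm-Null = coefficient-Null

  opaque
    -- The coefficient at τʲ of the image in ℤₚ[ℤ/p^N] of a power series under T ↦ τ - 1.
    eval : PowerSeries → ℕ → ℤ → ℤₚ
    eval a N j = series (evalTerm a N j) (evalTerm-Null a N j)

    eval≈series : ∀ a N j → eval a N j ≈ series (evalTerm a N j) (evalTerm-Null a N j)
    eval≈series a N j = ≈-refl {eval a N j}

    -- Once n ≥ k·p^N, the power (τ - 1)ⁿ is divisible by pᵏ in ℤ[ℤ/p^N]. Modulo pᵏ an evaluation
    -- thus sees finitely many coefficients, which is what allows (1 + T)ᶜ to be replaced by a
    -- polynomial.
    eval-level : ∀ {a b} k N → (∀ n → n < k ℕ.* p ℕ.^ N → a n ≈[ k ] b n) → ∀ j → eval a N j ≈[ k ] eval b N j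
    eval-level {a} {b} k N h j = series-level k (evalTerm-Null a N j) (evalTerm-Null b N j) go
      where
        go : ∀ n → a n * fromℤ (coefficient N n j) ≈[ k ] b n * fromℤ (coefficient N n j)
        go n with n ℕ.<? k ℕ.* p ℕ.^ N
        ... | yes lt = lv-* (h n lt) lv-refl
        ... | no ¬lt = lv-trans (lv-zeroʳ (a n) small) (lv-sym (lv-zeroʳ (b n) small))
          where small : fromℤ (coefficient N n j) ≈[ k ] 0#
                small = level (coefficient-small N k n (ℕ.≮⇒≥ ¬lt) j)

    eval-cong : ∀ {a b} → (∀ n → a n ≈ b n) → ∀ N j → eval a N j ≈ eval b N j
    eval-cong h N j k = eval-level k N (λ n _ → h n k) j

    eval-⊕ : ∀ a b N j → eval (a ⊕ b) N j ≈ eval a N j + eval b N j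
    eval-⊕ a b N j k = lv-trans
      (series-level k (evalTerm-Null (a ⊕ b) N j) null λ n → distribʳ (fromℤ (coefficient N n j)) (a n) (b n) k)
      (lv-sym (series-+ (evalTerm-Null a N j) (evalTerm-Null b N j) null k))
      where null : Null (λ n → evalTerm a N j n + evalTerm b N j n)
            null = +-Null (evalTerm-Null a N j) (evalTerm-Null b N j)

    eval-⊖ : ∀ a b N j → eval (a ⊖ b) N j ≈ eval a N j - eval b N j
    eval-⊖ a b N j k = begin
      eval (a ⊖ b) N j                             ≈⟨ exactly {_} {(x + y) - y} (λ n → cancel-+ (approx x n) (approx y n)) k ⟩
      (eval (a ⊖ b) N j + eval b N j) - eval b N j ≈⟨ lv-+ (lv-sym (eval-⊕ (a ⊖ b) b N j k)) lv-refl ⟩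
      eval ((a ⊖ b) ⊕ b) N j - eval b N j          ≈⟨ lv-+ (eval-cong (λ n → exactly λ m → cancel-- (approx (a n) m) (approx (b n) m)) N j k) lv-refl ⟩
      eval a N j - eval b N j ∎
      where
        open lv-Reasoning k
        x y : ℤₚ
        x = eval (a ⊖ b) N j
        y = eval b N j
        cancel-+ : ∀ x y → x ≡ (x ℤ.+ y) ℤ.- y
        cancel-+ = solve-∀
        cancel-- : ∀ x y → (x ℤ.- y) ℤ.+ y ≡ x
        cancel-- = solve-∀

    eval-const : ∀ a N j → eval (const a) N j ≈ a * fromℤ (δ N j)
    eval-const a N j = series-single (evalTerm-Null (const a) N j) λ n → zeroˡ (fromℤ (coefficient N (suc n) j))

    -- T becomes τ - 1, and multiplication by τ moves the coefficient at j - 1 to j. Since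
    -- `coefficient N (suc n) j` is by definition a difference, adding the series of f back to the
    -- shifted series leaves one term for each n.
    eval-T⊛ : ∀ f N j → eval (T ⊛ f) N j ≈ eval f N (j ℤ.- + 1) - eval f N j
    eval-T⊛ f N j = begin
      eval (T ⊛ f) N j                    ≈⟨ series-shift (evalTerm-Null (T ⊛ f) N j) null zero′ step ⟩
      series u null                       ≈⟨ exactly {_} {(x + y) - y} (λ n → cancel-+ (approx x n) (approx y n)) ⟩
      (series u null + eval f N j) - eval f N j
        ≈⟨ +-cong (series-+ null (evalTerm-Null f N j) (+-Null null (evalTerm-Null f N j))) (≈-refl {x = - eval f N j}) ⟩
      series _ (+-Null null (evalTerm-Null f N j)) - eval f N j
        ≈⟨ +-cong (series-cong (+-Null null (evalTerm-Null f N j)) (evalTerm-Null f N (j ℤ.- + 1)) merge) (≈-refl {x = - eval f N j}) ⟩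
      eval f N (j ℤ.- + 1) - eval f N j ∎
      where
        open ≈-Reasoning
        u : ℕ → ℤₚ
        u n = f n * fromℤ (coefficient N (suc n) j)
        null : Null u
        null k = k ℕ.* p ℕ.^ N , λ n le → lv-zeroʳ (f n) (level (coefficient-small N k (suc n) (ℕ.m≤n⇒m≤1+n le) j))
        x y : ℤₚ
        x = series u null
        y = eval f N j
        cancel-+ : ∀ x y → x ≡ (x ℤ.+ y) ℤ.- y
        cancel-+ = solve-∀
        zero′ : (T ⊛ f) 0 * fromℤ (coefficient N 0 j) ≈ 0#
        zero′ k = lv-trans (lv-* (T⊛-zero f k) lv-refl) (zeroˡ (fromℤ (coefficient N 0 j)) k)
        step : ∀ n → (T ⊛ f) (suc n) * fromℤ (coefficient N (suc n) j) ≈ u n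
        step n k = lv-* (T⊛-suc f n k) lv-refl
        merge : ∀ n → u n + f n * fromℤ (coefficient N n j) ≈ f n * fromℤ (coefficient N n (j ℤ.- + 1))
        merge n = exactly λ m → lemma (approx (f n) m) (coefficient N n (j ℤ.- + 1)) (coefficient N n j)
          where lemma : ∀ f c d → f ℤ.* (c ℤ.- d) ℤ.+ f ℤ.* d ≡ f ℤ.* c
                lemma = solve-∀

  δ-cong : ∀ N {i j} → i ≡ j [mod P^ N ] → δ N i ≡ δ N j
  δ-cong N {i} {j} h = indicator-⇔ (P^ N ℤ∣.∣? i) (P^ N ℤ∣.∣? j)
    (λ d → mod0⇒∣ (mod-trans (mod-sym h) (∣⇒mod0 d))) (λ d → mod0⇒∣ (mod-trans h (∣⇒mod0 d)))

  δ-even : ∀ N j → δ N (ℤ.- j) ≡ δ N j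
  δ-even N j = indicator-⇔ (P^ N ℤ∣.∣? (ℤ.- j)) (P^ N ℤ∣.∣? j)
    (λ d → subst (P^ N ℤ∣.∣_) (ℤ.neg-involutive j) (ℤ∣.∣m⇒∣-m d)) ℤ∣.∣m⇒∣-m

  coefficient-cong : ∀ N n {i j} → i ≡ j [mod P^ N ] → coefficient N n i ≡ coefficient N n j
  coefficient-cong N zero    h = δ-cong N h
  coefficient-cong N (suc n) h = cong₂ ℤ._-_ (coefficient-cong N n (mod-+ h mod-refl)) (coefficient-cong N n h)

  eval-periodic : ∀ a N {i j} → i ≡ j [mod P^ N ] → eval a N i ≈ eval a N j
  eval-periodic a N {i} {j} h k = lv-trans (eval≈series a N i k) (lv-trans
    (series-level k (evalTerm-Null a N i) (evalTerm-Null a N j) λ n →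
      lv-* {k} {a n} lv-refl (level (mod-reflexive (coefficient-cong N n h))))
    (lv-sym (eval≈series a N j k)))

  coefficient-sum : ∀ N n j →
    fromℤ (coefficient N n j) ≈ sum λ (i : Fin p) → fromℤ (coefficient (suc N) n (j ℤ.+ + toℕ i ℤ.* P^ N))
  coefficient-sum N n j k = lv-trans {k} {fromℤ (coefficient N n j)} {fromℤ (Σ< p u)} {sum v}
      (level (mod-reflexive (coefficient-additive N n j))) (sum-fromℤ p u k)
    where
      u : ℕ → ℤ
      u i = coefficient (suc N) n (j ℤ.+ + i ℤ.* P^ N)
      v : Vector ℤₚ p
      v i = fromℤ (u (toℕ i))

  module _ (a : PowerSeries) (N : ℕ) (j : ℤ) where
    preimage : Fin p → ℤ
    preimage i = j ℤ.+ + toℕ i ℤ.* P^ N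

    preimageTerm : Fin p → ℕ → ℤₚ
    preimageTerm i = evalTerm a (suc N) (preimage i)

    evalTerm-additive : ∀ n → evalTerm a N j n ≈ sum (λ i → preimageTerm i n)
    evalTerm-additive n = ≈-trans {evalTerm a N j n} {a n * sum c} {sum (λ i → preimageTerm i n)}
        (*-cong {a n} {a n} {fromℤ (coefficient N n j)} {sum c} ≈-refl (coefficient-sum N n j))
        (*-distribˡ-sum (a n) c)
      where
        c : Vector ℤₚ p
        c i = fromℤ (coefficient (suc N) n (preimage i))

    eval-additive : eval a N j ≈ sum λ (i : Fin p) → eval a (suc N) (preimage i)
    eval-additive k = lv-trans {k} {eval a N j} {series (evalTerm a N j) (evalTerm-Null a N j)} {sum v}
        (eval≈series a N j k)
        (lv-trans {k} {series (evalTerm a N j) (evalTerm-Null a N j)} {sum w} {sum v}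
          (series-additive {p} (evalTerm a N j) (evalTerm-Null a N j) preimageTerm (λ i → evalTerm-Null a (suc N) (preimage i)) evalTerm-additive k)
          (lv-sum {k} {p} {w} {v} λ i → lv-sym (eval≈series a (suc N) (preimage i) k)))
      where
        v w : Vector ℤₚ p
        v i = eval a (suc N) (preimage i)
        w i = series (preimageTerm i) (evalTerm-Null a (suc N) (preimage i))

  mass≈eval : ∀ a N j → mass (measureOf a) N j ≈ eval a N (+ toℕ j)
  mass≈eval a N j k = lv-trans {k} {mass (measureOf a) N j} {series (evalTerm a N (+ toℕ j)) (evalTerm-Null a N (+ toℕ j))} {eval a N (+ toℕ j)}
    (series-level k (massTerm-Null a N j) (evalTerm-Null a N (+ toℕ j)) λ n → lv-refl {k} {evalTerm a N (+ toℕ j) n})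
    (lv-sym (eval≈series a N (+ toℕ j) k))

  -- Multiplication by powers of 1 + T

  ⊛-level : ∀ {f f′ g g′} k n → (∀ i → i ≤ n → f i ≈[ k ] f′ i) → (∀ i → g i ≈[ k ] g′ i) → (f ⊛ g) n ≈[ k ] (f′ ⊛ g′) n
  ⊛-level k n h h′ = lv-sum λ i → lv-* (h (toℕ i) (ℕ.≤-pred (Fin.toℕ<n i))) (h′ (n ℕ.∸ toℕ i))

  ⊛-distribʳ-⊕ : ∀ f f′ g n → ((f ⊕ f′) ⊛ g) n ≈ (f ⊛ g) n + (f′ ⊛ g) n
  ⊛-distribʳ-⊕ f f′ g n k = lv-trans
    (lv-sum {k} {suc n} {λ i → (f ⊕ f′) (toℕ i) * g (n ℕ.∸ toℕ i)} {λ i → v i + w i} λ i → distribʳ (g (n ℕ.∸ toℕ i)) (f (toℕ i)) (f′ (toℕ i)) k)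
    (∑-distrib-+ v w k)
    where
      v w : Vector ℤₚ (suc n)
      v i = f (toℕ i) * g (n ℕ.∸ toℕ i)
      w i = f′ (toℕ i) * g (n ℕ.∸ toℕ i)

  const⊛ : ∀ a g n → (const a ⊛ g) n ≈ a * g n
  const⊛ a g n = ≈-trans (+-cong {a * g n} {a * g n} {sum v} {0#} ≈-refl (sum-zero {v = v} λ i → zeroˡ (g (n ℕ.∸ suc (toℕ i)))))
                        (+-identityʳ (a * g n))
    where v : Vector ℤₚ n
          v i = 0# * g (n ℕ.∸ suc (toℕ i))

  -- Multiplication by T shifts coefficients, so no double sum has to be reordered. Iterated, this
  -- case gives associativity for the left factors (1 + T)^R, which are the ones that occur.
  T⊛-assoc : ∀ f g n → ((T ⊛ f) ⊛ g) n ≈ (T ⊛ (f ⊛ g)) n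
  T⊛-assoc f g zero k = lv-trans (+-identityʳ ((T ⊛ f) 0 * g 0) k)
    (lv-trans (lv-trans (lv-* {k} {(T ⊛ f) 0} {0#} {g 0} (T⊛-zero f k) lv-refl) (zeroˡ (g 0) k)) (lv-sym (T⊛-zero (f ⊛ g) k)))
  T⊛-assoc f g (suc n) k = lv-trans
    (lv-+ {k} {(T ⊛ f) 0 * g (suc n)} {0#} {sum v} {(f ⊛ g) n}
      (lv-trans (lv-* {k} {(T ⊛ f) 0} {0#} {g (suc n)} (T⊛-zero f k) lv-refl) (zeroˡ (g (suc n)) k))
      (lv-sum {k} {suc n} {v} {λ i → f (toℕ i) * g (n ℕ.∸ toℕ i)} λ i → lv-* {k} {(T ⊛ f) (suc (toℕ i))} (T⊛-suc f (toℕ i) k) lv-refl))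
    (lv-trans (+-identityˡ ((f ⊛ g) n) k) (lv-sym (T⊛-suc (f ⊛ g) n k)))
    where v : Vector ℤₚ (suc n)
          v i = (T ⊛ f) (suc (toℕ i)) * g (n ℕ.∸ toℕ i)

  T⊛-cong : ∀ {f g} → (∀ n → f n ≈ g n) → ∀ n → (T ⊛ f) n ≈ (T ⊛ g) n
  T⊛-cong {f} {g} h n k = ⊛-level {T} {T} {f} {g} k n (λ _ _ → lv-refl) λ i → h i k

  [1+T]⊛_ : PowerSeries → PowerSeries
  [1+T]⊛ f = f ⊕ (T ⊛ f)

  [1+T]⊛-cong : ∀ {f g} → (∀ n → f n ≈ g n) → ∀ n → ([1+T]⊛ f) n ≈ ([1+T]⊛ g) n
  [1+T]⊛-cong h n k = lv-+ (h n k) (T⊛-cong h n k)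

  [1+T]⊛-assoc : ∀ f g n → (([1+T]⊛ f) ⊛ g) n ≈ ([1+T]⊛ (f ⊛ g)) n
  [1+T]⊛-assoc f g n = ≈-trans (⊛-distribʳ-⊕ f (T ⊛ f) g n) (+-cong {(f ⊛ g) n} ≈-refl (T⊛-assoc f g n))

  eval-[1+T]⊛ : ∀ f N j → eval ([1+T]⊛ f) N j ≈ eval f N (j ℤ.- + 1)
  eval-[1+T]⊛ f N j = begin
    eval ([1+T]⊛ f) N j                    ≈⟨ eval-⊕ f (T ⊛ f) N j ⟩
    x + eval (T ⊛ f) N j                   ≈⟨ +-cong (≈-refl {x}) (eval-T⊛ f N j) ⟩
    x + (y - x)                            ≈⟨ exactly {x + (y - x)} {y} (λ n → lemma (approx x n) (approx y n)) ⟩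
    y ∎
    where
      open ≈-Reasoning
      x = eval f N j
      y = eval f N (j ℤ.- + 1)
      lemma : ∀ x y → x ℤ.+ (y ℤ.- x) ≡ y
      lemma = solve-∀

  [1+T]^ℕ_⊛_ : ℕ → PowerSeries → PowerSeries
  [1+T]^ℕ R ⊛ f = iter R [1+T]⊛_ f

  [1+T]^ℕ-assoc : ∀ R g n → (([1+T]^ℕ R ⊛ const 1#) ⊛ g) n ≈ ([1+T]^ℕ R ⊛ g) n
  [1+T]^ℕ-assoc zero    g n = ≈-trans (const⊛ 1# g n) (*-identityˡ (g n))
  [1+T]^ℕ-assoc (suc R) g n = ≈-trans ([1+T]⊛-assoc ([1+T]^ℕ R ⊛ const 1#) g n) ([1+T]⊛-cong ([1+T]^ℕ-assoc R g) n)

  eval-[1+T]^ℕ : ∀ R f N j → eval ([1+T]^ℕ R ⊛ f) N j ≈ eval f N (j ℤ.- + R)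
  eval-[1+T]^ℕ zero    f N j k = eval-periodic f N (mod-reflexive (sym (ℤ.+-identityʳ j))) k
  eval-[1+T]^ℕ (suc R) f N j k = lv-trans (eval-[1+T]⊛ ([1+T]^ℕ R ⊛ f) N j k) (lv-trans (eval-[1+T]^ℕ R f N (j ℤ.- + 1) k)
    (eval-periodic f N (mod-reflexive (lemma j (+ R))) k))
    where lemma : ∀ j R → (j ℤ.- + 1) ℤ.- R ≡ j ℤ.- (+ 1 ℤ.+ R)
          lemma = solve-∀

  [1+T]^ℕ-coefficient : ∀ R n → ([1+T]^ℕ R ⊛ const 1#) n ≈ fromℤ (+ (R C n))
  [1+T]^ℕ-coefficient zero    zero    = ≈-refl
  [1+T]^ℕ-coefficient zero    (suc n) = exactly λ _ → cong +_ (sym (k>n⇒nCk≡0 {0} {suc n} (s≤s z≤n)))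
  [1+T]^ℕ-coefficient (suc R) zero    k = lv-trans
    (lv-+ {z = (T ⊛ ([1+T]^ℕ R ⊛ const 1#)) 0} ([1+T]^ℕ-coefficient R 0 k) (T⊛-zero ([1+T]^ℕ R ⊛ const 1#) k))
    (level (mod-reflexive (cong +_ (trans (ℕ.+-identityʳ (R C 0)) (nC0 R)))))
    where nC0 : ∀ n → n C 0 ≡ 1
          nC0 zero    = refl
          nC0 (suc n) = refl
  [1+T]^ℕ-coefficient (suc R) (suc n) k = lv-trans
    (lv-+ {z = (T ⊛ ([1+T]^ℕ R ⊛ const 1#)) (suc n)} ([1+T]^ℕ-coefficient R (suc n) k)
      (lv-trans (T⊛-suc ([1+T]^ℕ R ⊛ const 1#) n k) ([1+T]^ℕ-coefficient R n k)))
    (level (mod-reflexive (cong +_ (trans (ℕ.+-comm (R C suc n) (R C n)) (nCk+nC[k+1]≡[n+1]C[k+1] R n)))))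

  -- After multiplication by n! both sides are falling factorials of arguments congruent modulo p^K.
  -- Dividing by n! costs the v digits provided by `cancel`, hence the threshold k + v.
  choose-level : ∀ s n k → Σ ℕ λ M → ∀ K → M ≤ K → s choose n ≈[ k ] fromℤ (+ (residueAt s K C n))
  choose-level s n k = X , λ K X≤K → lv-trans {k} {s choose n} {fromℤ (approx (s choose n) K)}
      (level (mod-sym (approx-lower (s choose n) (ℕ.≤-trans (ℕ.m≤m+n k v) X≤K))))
      (level (mod (proj₂ (cancel (n !) (n!≢0 n)) k _ (subst (P^ X ℤ∣.∣_)
        (lemma (+ (n !)) (approx (s choose n) K) (+ (residueAt s K C n)))
        (divides-difference (mod-lower X≤K (mod-trans (at-level (proj₂ (binomial s n) K))
          (mod-trans (mod-reflexive (approx-falling s n K)) (mod-sym (binomial-residue s n K))))))))))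
    where
      v X : ℕ
      v = proj₁ (cancel (n !) (n!≢0 n))
      X = k ℕ.+ v
      lemma : ∀ f x y → f ℤ.* x ℤ.- f ℤ.* y ≡ f ℤ.* (x ℤ.- y)
      lemma = solve-∀

  choose-level-uniform : ∀ s B k → Σ ℕ λ M → ∀ K → M ≤ K → ∀ n → n < B → s choose n ≈[ k ] fromℤ (+ (residueAt s K C n))
  choose-level-uniform s zero    k = 0 , λ _ _ _ ()
  choose-level-uniform s (suc B) k = M ℕ.⊔ M′ , go
    where
      M M′ : ℕ
      M  = proj₁ (choose-level-uniform s B k)
      M′ = proj₁ (choose-level s B k)
      go : ∀ K → M ℕ.⊔ M′ ≤ K → ∀ n → n < suc B → s choose n ≈[ k ] fromℤ (+ (residueAt s K C n))
      go K le n (s≤s n≤B) with n ℕ.≟ B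
      ... | yes refl = proj₂ (choose-level s B k) K (ℕ.≤-trans (ℕ.m≤n⊔m M M′) le)
      ... | no n≢B   = proj₂ (choose-level-uniform s B k) K (ℕ.≤-trans (ℕ.m≤m⊔n M M′) le) n (ℕ.≤∧≢⇒< n≤B n≢B)

  residueAt-mod : ∀ s {N K} → N ≤ K → + residueAt s K ≡ approx s N [mod P^ N ]
  residueAt-mod s {N} {K} N≤K = mod-trans (mod-lower N≤K (mod-sym (residue (approx s K) (p ℕ.^ K) {{p^≢0 K}}))) (approx-lower s N≤K)

  -- The two demands on R serve different ends. Close coefficients let (1 + T)^R stand for (1 + T)ᶜ
  -- under `eval`, while R ≡ c modulo p^N identifies the resulting shift by R with a shift by c.
  [1+T]^-approximation : ∀ c N k B → Σ ℕ λ R → Σ (+ R ≡ approx c N [mod P^ N ]) λ _ →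
    ∀ i → i < B → ([1+T]^ c) i ≈[ k ] ([1+T]^ℕ R ⊛ const 1#) i
  [1+T]^-approximation c N k B = R , residueAt-mod c (ℕ.m≤n⊔m M N) , λ i i<B → lv-trans
      (proj₂ (choose-level-uniform c B k) (M ℕ.⊔ N) (ℕ.m≤m⊔n M N) i i<B)
      (lv-sym ([1+T]^ℕ-coefficient R i k))
    where
      M R : ℕ
      M = proj₁ (choose-level-uniform c B k)
      R = residueAt c (M ℕ.⊔ N)

  eval-[1+T]^⊛ : ∀ c g N j → eval ([1+T]^ c ⊛ g) N j ≈ eval g N (j ℤ.- approx c N)
  eval-[1+T]^⊛ c g N j k = begin
    eval ([1+T]^ c ⊛ g) N j
      -- A coefficient of the product of index below k·p^N involves only coefficients of (1 + T)ᶜ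
      -- below that index, so this bound suffices for the approximation.
      ≈⟨ eval-level k N (λ n n<B → ⊛-level {[1+T]^ c} {[1+T]^ℕ R ⊛ const 1#} {g} {g} k n (λ i i≤n → near i (ℕ.≤-<-trans i≤n n<B)) (λ _ → lv-refl)) j ⟩
    eval (([1+T]^ℕ R ⊛ const 1#) ⊛ g) N j
      ≈⟨ eval-cong ([1+T]^ℕ-assoc R g) N j k ⟩
    eval ([1+T]^ℕ R ⊛ g) N j
      ≈⟨ eval-[1+T]^ℕ R g N j k ⟩
    eval g N (j ℤ.- + R)
      ≈⟨ eval-periodic g N (mod-+ (mod-refl {a = j}) (mod-neg R≡c)) k ⟩
    eval g N (j ℤ.- approx c N) ∎
    where
      open lv-Reasoning k
      approximation = [1+T]^-approximation c N k (k ℕ.* p ℕ.^ N)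
      R : ℕ
      R = proj₁ approximation
      R≡c : + R ≡ approx c N [mod P^ N ]
      R≡c = proj₁ (proj₂ approximation)
      near : ∀ i → i < k ℕ.* p ℕ.^ N → ([1+T]^ c) i ≈[ k ] ([1+T]^ℕ R ⊛ const 1#) i
      near = proj₂ (proj₂ approximation)

  eval-[1+T]^ : ∀ c N j → eval ([1+T]^ c) N j ≈ fromℤ (δ N (j ℤ.- approx c N))
  eval-[1+T]^ c N j k = begin
    eval ([1+T]^ c) N j
      ≈⟨ eval-level k N near j ⟩
    eval ([1+T]^ℕ R ⊛ const 1#) N j
      ≈⟨ eval-[1+T]^ℕ R (const 1#) N j k ⟩
    eval (const 1#) N (j ℤ.- + R)
      ≈⟨ eval-periodic (const 1#) N (mod-+ (mod-refl {a = j}) (mod-neg R≡c)) k ⟩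
    eval (const 1#) N (j ℤ.- approx c N)
      ≈⟨ eval-const 1# N (j ℤ.- approx c N) k ⟩
    1# * fromℤ (δ N (j ℤ.- approx c N))
      ≈⟨ *-identityˡ (fromℤ (δ N (j ℤ.- approx c N))) k ⟩
    fromℤ (δ N (j ℤ.- approx c N)) ∎
    where
      open lv-Reasoning k
      approximation = [1+T]^-approximation c N k (k ℕ.* p ℕ.^ N)
      R : ℕ
      R = proj₁ approximation
      R≡c : + R ≡ approx c N [mod P^ N ]
      R≡c = proj₁ (proj₂ approximation)
      near : ∀ i → i < k ℕ.* p ℕ.^ N → ([1+T]^ c) i ≈[ k ] ([1+T]^ℕ R ⊛ const 1#) i
      near = proj₂ (proj₂ approximation)

  -- Translation-invariant distributions

  module _ {n : ℕ} {{n≢0 : NonZero n}} where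
    opposite : Fin n → Fin n
    opposite i = Fin.fromℕ< (ℤ.n%ℕd<d (ℤ.- (+ toℕ i)) n)

    opposite-mod : ∀ i → + toℕ (opposite i) ≡ ℤ.- (+ toℕ i) [mod + n ]
    opposite-mod i = mod-trans (mod-reflexive (cong +_ (Fin.toℕ-fromℕ< _))) (mod-sym (residue (ℤ.- (+ toℕ i)) n))

    opposite-involutive : ∀ i → opposite (opposite i) ≡ i
    opposite-involutive i = Fin.toℕ-injective (residue-unique (Fin.toℕ<n (opposite (opposite i))) (Fin.toℕ<n i)
      (mod-trans (opposite-mod (opposite i)) (mod-trans (mod-neg (opposite-mod i)) (mod-reflexive (ℤ.neg-involutive (+ toℕ i))))))

    sum-opposite : ∀ v → sum v ≈ sum (λ i → v (opposite i))
    sum-opposite v = sum-permute v (permutation opposite opposite opposite-involutive opposite-involutive)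

  sum-replicate : ∀ n x → sum {n} (λ _ → x) ≈ fromℤ (+ n) * x
  sum-replicate zero    x = ≈-sym (zeroˡ x)
  sum-replicate (suc n) x k = lv-trans (lv-+ {k} {x} lv-refl (sum-replicate n x k))
    (exactly {x + fromℤ (+ n) * x} {fromℤ (+ suc n) * x} (λ m → lemma (approx x m) (+ n)) k)
    where lemma : ∀ x n → x ℤ.+ n ℤ.* x ≡ (+ 1 ℤ.+ n) ℤ.* x
          lemma = solve-∀

  p*-level : ∀ {x} k → x ≈[ k ] 0# → fromℤ (+ p) * x ≈[ suc k ] 0#
  p*-level {x} k h = level (∣⇒mod0 (subst (ℤ∣._∣ + p ℤ.* approx x (suc k)) (sym (ℤ.pos-* p (p ℕ.^ k)))
    (ℤ∣.*-monoʳ-∣ (+ p) (mod0⇒∣ (mod-trans (coherent x k) (at-level h))))))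

  -- F N j is the mass of j + p^N ℤₚ.
  record Distribution (F : ℕ → ℤ → ℤₚ) : Set where
    field
      periodic : ∀ N {i j} → i ≡ j [mod P^ N ] → F N i ≈ F N j
      pushes   : ∀ N j → F N j ≈ sum λ (i : Fin p) → F (suc N) (j ℤ.+ + toℕ i ℤ.* P^ N)
  open Distribution

  eval-distribution : ∀ a → Distribution (eval a)
  eval-distribution a .periodic = eval-periodic a
  eval-distribution a .pushes   = eval-additive a

  -- The classes above -j are listed as -j + i·p^N, their reflections as -j - i·p^N. The permutation
  -- i ↦ -i modulo p matches the two lists.
  reflection : ∀ {F} → Distribution F → Distribution (λ N j → F N (ℤ.- j))
  reflection         D .periodic N h   = periodic D N (mod-neg h)
  reflection {F} D .pushes   N j k = lv-trans (pushes D N (ℤ.- j) k) (lv-trans (sum-opposite v k)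
      (lv-sum {k} {p} {λ i → v (opposite i)} {w} λ i → periodic D (suc N) (same i) k))
    where
      v w : Vector ℤₚ p
      v i = F (suc N) (ℤ.- j ℤ.+ + toℕ i ℤ.* P^ N)
      w i = F (suc N) (ℤ.- (j ℤ.+ + toℕ i ℤ.* P^ N))
      lemma₁ : ∀ j i o P → (ℤ.- j ℤ.+ o ℤ.* P) ℤ.- ℤ.- (j ℤ.+ i ℤ.* P) ≡ (o ℤ.- ℤ.- i) ℤ.* P
      lemma₁ = solve-∀
      same : ∀ i → ℤ.- j ℤ.+ + toℕ (opposite i) ℤ.* P^ N ≡ ℤ.- (j ℤ.+ + toℕ i ℤ.* P^ N) [mod P^ (suc N) ]
      same i = mod (subst (P^ (suc N) ℤ∣.∣_) (sym (lemma₁ j (+ toℕ i) (+ toℕ (opposite i)) (P^ N)))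
        (subst (ℤ∣._∣ (+ toℕ (opposite i) ℤ.- ℤ.- (+ toℕ i)) ℤ.* P^ N) (sym (ℤ.pos-* p (p ℕ.^ N)))
          (ℤ∣.*-monoˡ-∣ (P^ N) (divides-difference (opposite-mod i)))))

  sum-distribution : ∀ {F G} → Distribution F → Distribution G → Distribution (λ N j → F N j + G N j)
  sum-distribution D E .periodic N h k = lv-+ (periodic D N h k) (periodic E N h k)
  sum-distribution {F} {G} D E .pushes N j k = lv-trans (lv-+ (pushes D N j k) (pushes E N j k)) (lv-sym (∑-distrib-+ v w k))
    where
      v w : Vector ℤₚ p
      v i = F (suc N) (j ℤ.+ + toℕ i ℤ.* P^ N)
      w i = G (suc N) (j ℤ.+ + toℕ i ℤ.* P^ N)

  neg-distribution : ∀ {F} → Distribution F → Distribution (λ N j → - F N j)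
  neg-distribution D .periodic N h k = lv-neg (periodic D N h k)
  neg-distribution {F} D .pushes N j k = lv-trans (lv-neg (pushes D N j k)) (neg-sum v k)
    where
      v : Vector ℤₚ p
      v i = F (suc N) (j ℤ.+ + toℕ i ℤ.* P^ N)
      neg-sum : ∀ {n} (v : Vector ℤₚ n) → - sum v ≈ sum (λ i → - v i)
      neg-sum {zero}  v = exactly λ _ → refl
      neg-sum {suc n} v k = lv-trans (exactly { - (x + y)} {(- x) + (- y)} (λ m → ℤ.neg-distrib-+ (approx x m) (approx y m)) k)
        (lv-+ {k} { (- x)} lv-refl (neg-sum (v ∘ suc) k))
        where
          x = v zero
          y = sum (v ∘ suc)

  translation : ∀ {F} → Distribution F → ∀ (c : ℤₚ) → Distribution (λ N j → F N (j ℤ.- approx c N))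
  translation D c .periodic N h = periodic D N (mod-+ h mod-refl)
  translation {F} D c .pushes N j k = lv-trans
    -- The shift is by a different integer at each level. Before passing to level N + 1 it is
    -- exchanged for the approximation of c used there, which agrees modulo p^N.
    (periodic D N (mod-+ (mod-refl {a = j}) (mod-neg (mod-sym (coherent c N)))) k)
    (lv-trans (pushes D N (j ℤ.- approx c (suc N)) k) (lv-sum {k} {p} {v} {w} λ i →
      periodic D (suc N) (mod-reflexive (lemma j (approx c (suc N)) (+ toℕ i ℤ.* P^ N))) k))
    where
      v w : Vector ℤₚ p
      v i = F (suc N) (j ℤ.- approx c (suc N) ℤ.+ + toℕ i ℤ.* P^ N)
      w i = F (suc N) (j ℤ.+ + toℕ i ℤ.* P^ N ℤ.- approx c (suc N))
      lemma : ∀ j c x → j ℤ.- c ℤ.+ x ≡ j ℤ.+ x ℤ.- c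
      lemma = solve-∀

  -- The p classes above a class have equal mass, so every mass is divisible by every power of p.
  translation-invariant⇒0 : ∀ {F} → Distribution F → (∀ N j → F N j ≈ F N (j ℤ.- + 1)) → ∀ N j → F N j ≈ 0#
  translation-invariant⇒0 {F} D inv N j k = go k N j
    where
      shift : ∀ N j n → F N (j ℤ.+ + n) ≈ F N j
      shift N j zero    = periodic D N (mod-reflexive (ℤ.+-identityʳ j))
      shift N j (suc n) k = lv-trans (inv N (j ℤ.+ + suc n) k)
        (lv-trans (periodic D N (mod-reflexive (lemma j (+ n))) k) (shift N j n k))
        where lemma : ∀ j n → j ℤ.+ (+ 1 ℤ.+ n) ℤ.- + 1 ≡ j ℤ.+ n
              lemma = solve-∀
      same : ∀ N j (i : Fin p) → F (suc N) (j ℤ.+ + toℕ i ℤ.* P^ N) ≈ F (suc N) j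
      same N j i k = lv-trans
        (periodic D (suc N) (mod-reflexive (cong (λ z → j ℤ.+ z) (sym (ℤ.pos-* (toℕ i) (p ℕ.^ N))))) k)
        (shift (suc N) j (toℕ i ℕ.* p ℕ.^ N) k)
      go : ∀ k N j → F N j ≈[ k ] 0#
      go zero    N j = level (∣⇒mod0 (divides (approx (F N j) 0) (sym (ℤ.*-identityʳ _))))
      go (suc k) N j = lv-trans (pushes D N j (suc k)) (lv-trans
        (lv-sum {suc k} {p} {λ i → F (suc N) (j ℤ.+ + toℕ i ℤ.* P^ N)} {λ _ → F (suc N) j} λ i → same N j i (suc k))
        (lv-trans (sum-replicate p (F (suc N) j) (suc k)) (p*-level k (go k (suc N) j))))

  x-y≈0⇒x≈y : ∀ {x y} → x - y ≈ 0# → x ≈ y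
  x-y≈0⇒x≈y {x} {y} h k = level (mod (mod0⇒∣ (at-level (h k))))

  module _ (c : ℤₚˣ) where
    -- At level N, translating by c as many times as a natural number representing c⁻¹ modulo p^N is
    -- a translation by 1.
    unit-translation-invariant⇒0 : ∀ {F} → Distribution F → (∀ N j → F N j ≈ F N (j ℤ.- approx (value c) N)) → ∀ N j → F N j ≈ 0#
    unit-translation-invariant⇒0 {F} D inv = translation-invariant⇒0 D one
      where
        many : ∀ N j n → F N j ≈ F N (j ℤ.- + n ℤ.* approx (value c) N)
        many N j zero    = periodic D N (mod-reflexive (sym (ℤ.+-identityʳ j)))
        many N j (suc n) k = lv-trans (many N j n k) (lv-trans (inv N _ k) (periodic D N (mod-reflexive (lemma j (+ n) (approx (value c) N))) k))
          where lemma : ∀ j n c → j ℤ.- n ℤ.* c ℤ.- c ≡ j ℤ.- (+ 1 ℤ.+ n) ℤ.* c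
                lemma = solve-∀
        one : ∀ N j → F N j ≈ F N (j ℤ.- + 1)
        one N j k = lv-trans (many N j (residueAt (inverse c) N) k) (periodic D N
          (mod-+ (mod-refl {a = j}) (mod-neg (mod-trans (mod-* (residueAt-mod (inverse c) ℕ.≤-refl) mod-refl)
            (mod-trans (mod-reflexive (ℤ.*-comm (approx (inverse c) N) (approx (value c) N))) (at-level (isInverse c N)))))) k)

    -- The two factors are cancelled in turn. The difference F(j - c) - F(j) is itself a
    -- distribution and invariant under translation by 1, so it vanishes; this makes F invariant
    -- under translation by c.
    second-difference⇒0 : ∀ {F} → Distribution F →
      (∀ N j → F N (j ℤ.- + 1 ℤ.- approx (value c) N) - F N (j ℤ.- + 1) ≈ F N (j ℤ.- approx (value c) N) - F N j) →
      ∀ N j → F N j ≈ 0#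
    second-difference⇒0 {F} D h = unit-translation-invariant⇒0 D λ N j → ≈-sym {F N (j ℤ.- approx (value c) N)} {F N j} (x-y≈0⇒x≈y
      (translation-invariant⇒0 (sum-distribution (translation D (value c)) (neg-distribution D)) (λ N j → ≈-sym (h N j)) N j))

  -- The odd measure

  eval-denominator : ∀ c N j → eval (denominator c) N j ≈ fromℤ (δ N (j ℤ.- approx c N) ℤ.- δ N j)
  eval-denominator c N j k = begin
    eval (denominator c) N j
      ≈⟨ eval-⊖ ([1+T]^ c) (const 1#) N j k ⟩
    eval ([1+T]^ c) N j - eval (const 1#) N j
      ≈⟨ lv-+ (eval-[1+T]^ c N j k) (lv-neg (eval-const 1# N j k)) ⟩
    fromℤ (δ N (j ℤ.- approx c N)) - 1# * fromℤ (δ N j)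
      ≈⟨ level (mod-reflexive (cong (λ z → δ N (j ℤ.- approx c N) ℤ.- z) (ℤ.*-identityˡ (δ N j)))) ⟩
    fromℤ (δ N (j ℤ.- approx c N) ℤ.- δ N j) ∎
    where open lv-Reasoning k

  eval-denominator⊛ : ∀ c g N j → eval (denominator c ⊛ g) N j ≈ eval g N (j ℤ.- approx c N) - eval g N j
  eval-denominator⊛ c g N j k = begin
    eval (denominator c ⊛ g) N j
      ≈⟨ exactly {x} {(x + y) - y} (λ n → cancel-+ (approx x n) (approx y n)) k ⟩
    (eval (denominator c ⊛ g) N j + eval g N j) - eval g N j
      ≈⟨ lv-+ (lv-sym (eval-⊕ (denominator c ⊛ g) g N j k)) lv-refl ⟩
    eval ((denominator c ⊛ g) ⊕ g) N j - eval g N j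
      ≈⟨ lv-+ (eval-cong split N j k) lv-refl ⟩
    eval ([1+T]^ c ⊛ g) N j - eval g N j
      ≈⟨ lv-+ (eval-[1+T]^⊛ c g N j k) lv-refl ⟩
    eval g N (j ℤ.- approx c N) - eval g N j ∎
    where
      open lv-Reasoning k
      x = eval (denominator c ⊛ g) N j
      y = eval g N j
      cancel-+ : ∀ x y → x ≡ (x ℤ.+ y) ℤ.- y
      cancel-+ = solve-∀
      cancel-- : ∀ x y → (x ℤ.- y) ℤ.+ y ≡ x
      cancel-- = solve-∀
      split : ∀ n → ((denominator c ⊛ g) ⊕ g) n ≈ ([1+T]^ c ⊛ g) n
      split n k = lv-trans
        (lv-+ {k} {(denominator c ⊛ g) n} lv-refl (lv-sym (lv-trans (const⊛ 1# g n k) (*-identityˡ (g n) k))))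
        (lv-trans (lv-sym (⊛-distribʳ-⊕ (denominator c) (const 1#) g n k))
          (⊛-level {denominator c ⊕ const 1#} {[1+T]^ c} {g} {g} k n
            (λ i _ → exactly {(denominator c ⊕ const 1#) i} {([1+T]^ c) i} (λ m → cancel-- (approx (([1+T]^ c) i) m) (approx (const 1# i) m)) k)
            (λ _ → lv-refl)))

  const⊛T≈T⊛const : ∀ c n → (const c ⊛ T) n ≈ (T ⊛ const c) n
  const⊛T≈T⊛const c zero k = lv-trans (const⊛T c 0 k) (lv-trans (zeroʳ c k) (lv-sym (T⊛-zero (const c) k)))
  const⊛T≈T⊛const c (suc zero) k = lv-trans (const⊛T c 1 k) (lv-trans (*-identityʳ c k) (lv-sym (T⊛-suc (const c) 0 k)))
  const⊛T≈T⊛const c (suc (suc n)) k = lv-trans (const⊛T c (suc (suc n)) k) (lv-trans (zeroʳ c k) (lv-sym (T⊛-suc (const c) (suc n) k)))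

  eval-const⊛T : ∀ c N j → eval (const c ⊛ T) N j ≈ c * fromℤ (δ N (j ℤ.- + 1)) - c * fromℤ (δ N j)
  eval-const⊛T c N j k = lv-trans (eval-cong (const⊛T≈T⊛const c) N j k) (lv-trans (eval-T⊛ (const c) N j k)
    (lv-+ (eval-const c N (j ℤ.- + 1) k) (lv-neg (eval-const c N j k))))

  module _ (c : ℤₚˣ) where
    gᶜ : PowerSeries
    gᶜ = proj₁ (gSeries c)

    c̄ : ℕ → ℤ
    c̄ = approx (value c)

    gᶜ-difference : ∀ N j →
      (eval gᶜ N (j ℤ.- + 1 ℤ.- c̄ N) - eval gᶜ N (j ℤ.- + 1)) - (eval gᶜ N (j ℤ.- c̄ N) - eval gᶜ N j) ≈
      fromℤ (δ N (j ℤ.- c̄ N) ℤ.- δ N j) - (value c * fromℤ (δ N (j ℤ.- + 1)) - value c * fromℤ (δ N j))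
    gᶜ-difference N j k = begin
      (eval gᶜ N (j ℤ.- + 1 ℤ.- c̄ N) - eval gᶜ N (j ℤ.- + 1)) - (eval gᶜ N (j ℤ.- c̄ N) - eval gᶜ N j)
        ≈⟨ lv-+ (lv-sym (eval-denominator⊛ (value c) gᶜ N (j ℤ.- + 1) k)) (lv-neg (lv-sym (eval-denominator⊛ (value c) gᶜ N j k))) ⟩
      eval (denominator (value c) ⊛ gᶜ) N (j ℤ.- + 1) - eval (denominator (value c) ⊛ gᶜ) N j
        ≈⟨ eval-T⊛ (denominator (value c) ⊛ gᶜ) N j k ⟨
      eval (T ⊛ (denominator (value c) ⊛ gᶜ)) N j
        ≈⟨ eval-cong (proj₂ (gSeries c)) N j k ⟩
      eval (denominator (value c) ⊖ (const (value c) ⊛ T)) N j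
        ≈⟨ eval-⊖ (denominator (value c)) (const (value c) ⊛ T) N j k ⟩
      eval (denominator (value c)) N j - eval (const (value c) ⊛ T) N j
        ≈⟨ lv-+ (eval-denominator (value c) N j k) (lv-neg (eval-const⊛T (value c) N j k)) ⟩
      fromℤ (δ N (j ℤ.- c̄ N) ℤ.- δ N j) - (value c * fromℤ (δ N (j ℤ.- + 1)) - value c * fromℤ (δ N j)) ∎
      where open lv-Reasoning k

    h₀ : ℤₚ
    h₀ = [1- c ]/2

    -- Serves to remove c as a coefficient. It then survives only as a shift, and `simplify` becomes
    -- a polynomial identity in h₀.
    c̄≡1-2h₀ : ∀ k → c̄ k ≡ + 1 ℤ.- + 2 ℤ.* approx h₀ k [mod P^ k ]
    c̄≡1-2h₀ k = mod (subst (P^ k ℤ∣.∣_) (lemma (approx h₀ k) (c̄ k)) (divides-difference (at-level (proj₂ (halfOf1- c) k))))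
      where lemma : ∀ h₀ c → + 2 ℤ.* h₀ ℤ.- (+ 1 ℤ.- c) ≡ c ℤ.- (+ 1 ℤ.- + 2 ℤ.* h₀)
            lemma = solve-∀

    -- m̃_c + (1 - c)/2 δ₀
    oddSeries : PowerSeries
    oddSeries = gᶜ ⊕ const h₀

    oddMass : ℕ → ℤ → ℤₚ
    oddMass = eval oddSeries

    oddMass-spec : ∀ N j → oddMass N j ≈ eval gᶜ N j + h₀ * fromℤ (δ N j)
    oddMass-spec N j k = lv-trans (eval-⊕ gᶜ (const h₀) N j k) (lv-+ {k} {eval gᶜ N j} lv-refl (eval-const h₀ N j k))

    -- The right-hand side is (1 - h₀)(τᶜ - τ) + h₀(τ¹⁺ᶜ - 1) in the group ring. With a general
    -- constant in place of h₀, the coefficients of τᶜ and τ, and those of τ¹⁺ᶜ and 1, are opposite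
    -- exactly when twice that constant is 1 - c.
    oddMass-difference : ∀ N j → (oddMass N (j ℤ.- + 1 ℤ.- c̄ N) - oddMass N (j ℤ.- + 1)) - (oddMass N (j ℤ.- c̄ N) - oddMass N j) ≈
      ((1# - h₀) * fromℤ (δ N (j ℤ.- c̄ N)) - h₀ * fromℤ (δ N j)) -
      ((1# - h₀) * fromℤ (δ N (j ℤ.- + 1)) - h₀ * fromℤ (δ N (j ℤ.- + 1 ℤ.- c̄ N)))
    oddMass-difference N j k = begin
      (oddMass N (j ℤ.- + 1 ℤ.- c̄ N) - oddMass N (j ℤ.- + 1)) - (oddMass N (j ℤ.- c̄ N) - oddMass N j)
        ≈⟨ lv-+ (lv-+ (oddMass-spec N (j ℤ.- + 1 ℤ.- c̄ N) k) (lv-neg (oddMass-spec N (j ℤ.- + 1) k)))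
                (lv-neg (lv-+ (oddMass-spec N (j ℤ.- c̄ N) k) (lv-neg (oddMass-spec N j k)))) ⟩
      ((G₁ + h₀ * fromℤ d₁) - (G₂ + h₀ * fromℤ d₂)) - ((G₃ + h₀ * fromℤ d₃) - (G₄ + h₀ * fromℤ d₄))
        ≈⟨ level (mod-reflexive (regroup (approx G₁ k) (approx G₂ k) (approx G₃ k) (approx G₄ k) (approx h₀ k) d₁ d₂ d₃ d₄)) ⟩
      ((G₁ - G₂) - (G₃ - G₄)) + h₀ * fromℤ ((d₁ ℤ.- d₂) ℤ.- (d₃ ℤ.- d₄))
        ≈⟨ lv-+ (gᶜ-difference N j k) lv-refl ⟩
      (fromℤ (d₃ ℤ.- d₄) - (value c * fromℤ d₂ - value c * fromℤ d₄)) + h₀ * fromℤ ((d₁ ℤ.- d₂) ℤ.- (d₃ ℤ.- d₄))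
        ≈⟨ level (mod-+ (mod-+ (mod-refl {a = d₃ ℤ.- d₄}) (mod-neg (mod-+ (mod-* (c̄≡1-2h₀ k) (mod-refl {a = d₂})) (mod-neg (mod-* (c̄≡1-2h₀ k) (mod-refl {a = d₄}))))))
             (mod-refl {a = approx h₀ k ℤ.* ((d₁ ℤ.- d₂) ℤ.- (d₃ ℤ.- d₄))})) ⟩
      (fromℤ (d₃ ℤ.- d₄) - ((1# - fromℤ (+ 2) * h₀) * fromℤ d₂ - (1# - fromℤ (+ 2) * h₀) * fromℤ d₄)) + h₀ * fromℤ ((d₁ ℤ.- d₂) ℤ.- (d₃ ℤ.- d₄))
        ≈⟨ level (mod-reflexive (simplify (approx h₀ k) d₁ d₂ d₃ d₄)) ⟩
      ((1# - h₀) * fromℤ d₃ - h₀ * fromℤ d₄) - ((1# - h₀) * fromℤ d₂ - h₀ * fromℤ d₁) ∎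
      where
        open lv-Reasoning k
        G₁ = eval gᶜ N (j ℤ.- + 1 ℤ.- c̄ N)
        G₂ = eval gᶜ N (j ℤ.- + 1)
        G₃ = eval gᶜ N (j ℤ.- c̄ N)
        G₄ = eval gᶜ N j
        d₁ = δ N (j ℤ.- + 1 ℤ.- c̄ N)
        d₂ = δ N (j ℤ.- + 1)
        d₃ = δ N (j ℤ.- c̄ N)
        d₄ = δ N j
        regroup : ∀ a b c d h₀ x y z w → ((a ℤ.+ h₀ ℤ.* x) ℤ.- (b ℤ.+ h₀ ℤ.* y)) ℤ.- ((c ℤ.+ h₀ ℤ.* z) ℤ.- (d ℤ.+ h₀ ℤ.* w)) ≡
          ((a ℤ.- b) ℤ.- (c ℤ.- d)) ℤ.+ h₀ ℤ.* ((x ℤ.- y) ℤ.- (z ℤ.- w))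
        regroup = solve-∀
        simplify : ∀ h₀ x y z w →
          ((z ℤ.- w) ℤ.- ((+ 1 ℤ.- + 2 ℤ.* h₀) ℤ.* y ℤ.- (+ 1 ℤ.- + 2 ℤ.* h₀) ℤ.* w)) ℤ.+ h₀ ℤ.* ((x ℤ.- y) ℤ.- (z ℤ.- w)) ≡
          ((+ 1 ℤ.- h₀) ℤ.* z ℤ.- h₀ ℤ.* w) ℤ.- ((+ 1 ℤ.- h₀) ℤ.* y ℤ.- h₀ ℤ.* x)
        simplify = solve-∀

    evenPart : ℕ → ℤ → ℤₚ
    evenPart N j = oddMass N j + oddMass N (ℤ.- j)

    evenPart-distribution : Distribution evenPart
    evenPart-distribution = sum-distribution (eval-distribution oddSeries) (reflection (eval-distribution oddSeries))

    -- The right-hand side of oddMass-difference is odd under j ↦ 1 + c - j.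
    evenPart-difference : ∀ N j → evenPart N (j ℤ.- + 1 ℤ.- c̄ N) - evenPart N (j ℤ.- + 1) ≈ evenPart N (j ℤ.- c̄ N) - evenPart N j
    evenPart-difference N j = x-y≈0⇒x≈y λ k → let open lv-Reasoning k in begin
      ((A₁ + B₁) - (A₂ + B₂)) - ((A₃ + B₃) - (A₄ + B₄))
        ≈⟨ level (mod-reflexive (regroup (approx A₁ k) (approx A₂ k) (approx A₃ k) (approx A₄ k) (approx B₁ k) (approx B₂ k) (approx B₃ k) (approx B₄ k))) ⟩
      ((A₁ - A₂) - (A₃ - A₄)) + ((B₄ - B₃) - (B₂ - B₁))
        -- B₁, ..., B₄ are the values of `oddMass` at i, i - c, i - 1 and i - 1 - c, so the second
        -- bracket is the left-hand side of `oddMass-difference` at i.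
        ≈⟨ lv-+ (oddMass-difference N j k) (lv-trans
             (lv-+ (lv-+ (A-at e₄ k) (lv-neg (A-at e₃ k))) (lv-neg (lv-+ (A-at e₂ k) (lv-neg (A-at e₁ k)))))
             (oddMass-difference N i k)) ⟩
      (((1# - h₀) * fromℤ d₃ - h₀ * fromℤ d₄) - ((1# - h₀) * fromℤ d₂ - h₀ * fromℤ d₁)) +
      (((1# - h₀) * fromℤ (δ N (i ℤ.- c̄ N)) - h₀ * fromℤ (δ N i)) - ((1# - h₀) * fromℤ (δ N (i ℤ.- + 1)) - h₀ * fromℤ (δ N (i ℤ.- + 1 ℤ.- c̄ N))))
        -- As `δ` is even, passing from j to i exchanges d₁ with d₄ and d₂ with d₃, and this changes
        -- the sign.
        ≈⟨ level (mod-reflexive (trans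
             (cong₂ (λ x y → R d₁ d₂ d₃ d₄ k ℤ.+ R y (δ N (i ℤ.- + 1)) x (δ N i) k) (δ-at e₂) (δ-at e₄))
             (trans (cong₂ (λ x y → R d₁ d₂ d₃ d₄ k ℤ.+ R d₄ x d₂ y k) (δ-at e₃) (δ-at e₁))
               (odd (approx h₀ k) d₁ d₂ d₃ d₄)))) ⟩
      0# ∎
      where
        i = + 1 ℤ.+ c̄ N ℤ.- j
        A₁ = oddMass N (j ℤ.- + 1 ℤ.- c̄ N)
        A₂ = oddMass N (j ℤ.- + 1)
        A₃ = oddMass N (j ℤ.- c̄ N)
        A₄ = oddMass N j
        B₁ = oddMass N (ℤ.- (j ℤ.- + 1 ℤ.- c̄ N))
        B₂ = oddMass N (ℤ.- (j ℤ.- + 1))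
        B₃ = oddMass N (ℤ.- (j ℤ.- c̄ N))
        B₄ = oddMass N (ℤ.- j)
        d₁ = δ N (j ℤ.- + 1 ℤ.- c̄ N)
        d₂ = δ N (j ℤ.- + 1)
        d₃ = δ N (j ℤ.- c̄ N)
        d₄ = δ N j
        R : ℤ → ℤ → ℤ → ℤ → ℕ → ℤ
        R x y z w k = ((+ 1 ℤ.- approx h₀ k) ℤ.* z ℤ.- approx h₀ k ℤ.* w) ℤ.- ((+ 1 ℤ.- approx h₀ k) ℤ.* y ℤ.- approx h₀ k ℤ.* x)
        e₁ : ℤ.- (j ℤ.- + 1 ℤ.- c̄ N) ≡ i
        e₁ = lemma j (c̄ N) where
          lemma : ∀ j c → ℤ.- (j ℤ.- + 1 ℤ.- c) ≡ + 1 ℤ.+ c ℤ.- j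
          lemma = solve-∀
        e₂ : ℤ.- (j ℤ.- + 1) ≡ i ℤ.- c̄ N
        e₂ = lemma j (c̄ N) where
          lemma : ∀ j c → ℤ.- (j ℤ.- + 1) ≡ (+ 1 ℤ.+ c ℤ.- j) ℤ.- c
          lemma = solve-∀
        e₃ : ℤ.- (j ℤ.- c̄ N) ≡ i ℤ.- + 1
        e₃ = lemma j (c̄ N) where
          lemma : ∀ j c → ℤ.- (j ℤ.- c) ≡ (+ 1 ℤ.+ c ℤ.- j) ℤ.- + 1
          lemma = solve-∀
        e₄ : ℤ.- j ≡ i ℤ.- + 1 ℤ.- c̄ N
        e₄ = lemma j (c̄ N) where
          lemma : ∀ j c → ℤ.- j ≡ (+ 1 ℤ.+ c ℤ.- j) ℤ.- + 1 ℤ.- c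
          lemma = solve-∀
        A-at : ∀ {x y} → x ≡ y → oddMass N x ≈ oddMass N y
        A-at e = eval-periodic oddSeries N (mod-reflexive e)
        δ-at : ∀ {x y} → ℤ.- x ≡ y → δ N y ≡ δ N x
        δ-at {x} e = trans (cong (δ N) (sym e)) (δ-even N x)
        regroup : ∀ a b c d a′ b′ c′ d′ → ((a ℤ.+ a′) ℤ.- (b ℤ.+ b′)) ℤ.- ((c ℤ.+ c′) ℤ.- (d ℤ.+ d′)) ≡
          ((a ℤ.- b) ℤ.- (c ℤ.- d)) ℤ.+ ((d′ ℤ.- c′) ℤ.- (b′ ℤ.- a′))
        regroup = solve-∀
        odd : ∀ h₀ x y z w →
          (((+ 1 ℤ.- h₀) ℤ.* z ℤ.- h₀ ℤ.* w) ℤ.- ((+ 1 ℤ.- h₀) ℤ.* y ℤ.- h₀ ℤ.* x)) ℤ.+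
          (((+ 1 ℤ.- h₀) ℤ.* y ℤ.- h₀ ℤ.* x) ℤ.- ((+ 1 ℤ.- h₀) ℤ.* z ℤ.- h₀ ℤ.* w)) ≡ + 0
        odd = solve-∀

    oddMass-odd : ∀ N j → oddMass N (ℤ.- j) ≈ - oddMass N j
    oddMass-odd N j k = begin
      oddMass N (ℤ.- j)
        ≈⟨ level (mod-reflexive (lemma (approx (oddMass N j) k) (approx (oddMass N (ℤ.- j)) k))) ⟩
      (oddMass N j + oddMass N (ℤ.- j)) - oddMass N j
        ≈⟨ lv-+ (second-difference⇒0 c evenPart-distribution evenPart-difference N j k) lv-refl ⟩
      0# - oddMass N j
        ≈⟨ +-identityˡ (- oddMass N j) k ⟩
      - oddMass N j ∎
      where
        open lv-Reasoning k
        lemma : ∀ x y → y ≡ (x ℤ.+ y) ℤ.- x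
        lemma = solve-∀

    oddMeasure : Measure
    oddMeasure = measureOf oddSeries

    oddMeasure-odd : ∀ N (i j : Fin (p ℕ.^ N)) → + toℕ i ≡ ℤ.- (+ toℕ j) [mod P^ N ] → mass oddMeasure N i ≈ - mass oddMeasure N j
    oddMeasure-odd N i j e k = lv-trans (mass≈eval oddSeries N i k) (lv-trans (eval-periodic oddSeries N e k)
      (lv-trans (oddMass-odd N (+ toℕ j) k) (lv-neg (lv-sym (mass≈eval oddSeries N j k)))))

    oddMeasure-mass : ∀ N j → mass oddMeasure N j ≈ mass (m̃ c) N j + h₀ * fromℤ (δ N (+ toℕ j))
    oddMeasure-mass N j k = lv-trans (mass≈eval oddSeries N j k) (lv-trans (oddMass-spec N (+ toℕ j) k)
      (lv-+ (lv-sym (mass≈eval gᶜ N j k)) lv-refl))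

  -- Exponent laws

  lv-0 : ∀ {x y} → x ≈[ 0 ] y
  lv-0 {x} {y} = level (mod (divides (approx x 0 ℤ.- approx y 0) (sym (ℤ.*-identityʳ (approx x 0 ℤ.- approx y 0)))))

  ^-p^-mod : ∀ {a} → a ≡ + 1 [mod + p ] → ∀ K → a ℤ.^ (p ℕ.^ K) ≡ + 1 [mod P^ (suc K) ]
  ^-p^-mod {a} h zero    = mod-trans (mod-reflexive (ℤ.^-identityʳ a)) (subst (a ≡ + 1 [mod_]) (sym P^1) h)
  ^-p^-mod {a} h (suc K) = mod-trans (mod-reflexive (trans (sym (ℤ.^-*-assoc a p (p ℕ.^ K))) (^-swap a p (p ℕ.^ K))))
    (mod-trans (lift-^p {suc K} (s≤s z≤n) (^-p^-mod h K)) (mod-reflexive (ℤ.^-zeroˡ p)))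

  -- Writing m = r + d·p^K, the contribution of d disappears because the p^K-th power of a is 1
  -- modulo p^K.
  ^-residue : ∀ {a} → a ≡ + 1 [mod + p ] → ∀ K m → a ℤ.^ m ≡ a ℤ.^ ((m ℕ.% p ℕ.^ K) {{p^≢0 K}}) [mod P^ K ]
  ^-residue {a} h K m = mod-trans
    (mod-reflexive (trans (cong (a ℤ.^_) (ℕ.m≡m%n+[m/n]*n m P {{p^≢0 K}}))
      (trans (^-homo a r (d ℕ.* P)) (cong (a ℤ.^ r ℤ.*_) (trans (sym (ℤ.^-*-assoc a d P)) (^-swap a d P))))))
    (mod-trans (mod-* (mod-refl {a = a ℤ.^ r}) (mod-trans (mod-^ d (mod-lower (ℕ.n≤1+n K) (^-p^-mod h K))) (mod-reflexive (ℤ.^-zeroˡ d))))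
      (mod-reflexive (ℤ.*-identityʳ (a ℤ.^ r))))
    where
      P r d : ℕ
      P = p ℕ.^ K
      r = (m ℕ.% P) {{p^≢0 K}}
      d = (m ℕ./ P) {{p^≢0 K}}

  ^-exponent-mod : ∀ {a} → a ≡ + 1 [mod + p ] → ∀ K {m n} → + m ≡ + n [mod P^ K ] → a ℤ.^ m ≡ a ℤ.^ n [mod P^ K ]
  ^-exponent-mod {a} h K {m} {n} e = mod-trans (^-residue h K m) (mod-trans (mod-reflexive (cong (a ℤ.^_) same)) (mod-sym (^-residue h K n)))
    where
      instance
        P≢0 : NonZero (p ℕ.^ K)
        P≢0 = p^≢0 K
      residueℕ : ∀ m → + m ≡ + (m ℕ.% p ℕ.^ K) [mod P^ K ]
      residueℕ m = residue (+ m) (p ℕ.^ K)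
      same : m ℕ.% p ℕ.^ K ≡ n ℕ.% p ℕ.^ K
      same = residue-unique (ℕ.m%n<n m (p ℕ.^ K)) (ℕ.m%n<n n (p ℕ.^ K)) (mod-trans (mod-sym (residueℕ m)) (mod-trans e (residueℕ n)))

  binomial-theorem : ∀ a R n → suc R ≤ n → Σ< n (λ i → + (R C i) ℤ.* (a ℤ.- + 1) ℤ.^ i) ≡ a ℤ.^ R
  binomial-theorem a R n le = trans (go n le) (trans (sym (binomialSum-C R ((a ℤ.- + 1) ℤ.^_)))
      (trans (binomialSum-^ (a ℤ.- + 1) R) (cong (ℤ._^ R) (lemma a))))
    where
      lemma : ∀ a → + 1 ℤ.+ (a ℤ.- + 1) ≡ a
      lemma = solve-∀
      f : ℕ → ℤ
      f i = + (R C i) ℤ.* (a ℤ.- + 1) ℤ.^ i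
      steps : ∀ d → Σ< (d ℕ.+ suc R) f ≡ Σ< (suc R) f
      steps zero    = refl
      steps (suc d) = trans (cong₂ ℤ._+_ (steps d) (cong (λ z → + z ℤ.* (a ℤ.- + 1) ℤ.^ (d ℕ.+ suc R)) (k>n⇒nCk≡0 {R} {d ℕ.+ suc R} (ℕ.m≤n+m (suc R) d))))
        (ℤ.+-identityʳ (Σ< (suc R) f))
      go : ∀ n → suc R ≤ n → Σ< n f ≡ Σ< (suc R) f
      go n le = subst (λ z → Σ< z f ≡ Σ< (suc R) f) (ℕ.m∸n+n≡m le) (steps (n ℕ.∸ suc R))

  ^-+ : ∀ x m n → x ^ (m ℕ.+ n) ≈ x ^ m * x ^ n
  ^-+ x zero    n = ≈-sym (*-identityˡ (x ^ n))
  ^-+ x (suc m) n k = lv-trans (lv-* {k} {x} lv-refl (^-+ x m n k)) (lv-sym (*-assoc x (x ^ m) (x ^ n) k))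

  module _ {u : ℤₚ} (hu : 1+qℤₚ u) where
    u-1-small : u - 1# ≈[ 1 ] 0#
    u-1-small = 1+qℤₚ⇒level (p ℕ.≟ 2) hu

    approx≡1 : ∀ k → 1 ≤ k → approx u k ≡ + 1 [mod + p ]
    approx≡1 k 1≤k = subst (approx u k ≡ + 1 [mod_]) P^1 (mod-trans (approx-lower u 1≤k)
      (mod (mod0⇒∣ (at-level u-1-small))))

    -- For n ≥ k both sides vanish modulo pᵏ, since u - 1 is divisible by p. Only finitely many
    -- binomial coefficients therefore have to be approximated.
    power-term : ∀ s k R → (∀ n → n < k → s choose n ≈[ k ] fromℤ (+ (R C n))) → ∀ n →
      (s choose n) * (u - 1#) ^ n ≈[ k ] fromℤ (+ (R C n) ℤ.* (approx u k ℤ.- + 1) ℤ.^ n)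
    power-term s k R near n with n ℕ.<? k
    ... | yes n<k = level (mod-* (at-level (near n n<k)) (mod-reflexive (approx-^ (u - 1#) n k)))
    ... | no  n≮k = lv-trans (lv-zeroʳ (s choose n) small)
        (level (mod-sym (mod-trans (mod-* (mod-refl {a = + (R C n)}) (mod-trans (mod-reflexive (sym (approx-^ (u - 1#) n k))) (at-level small)))
          (mod-reflexive (ℤ.*-zeroʳ (+ (R C n)))))))
      where small : (u - 1#) ^ n ≈[ k ] 0#
            small = lv-lower (ℕ.≮⇒≥ n≮k) (power-small u-1-small n)

    opaque
      -- The bridge from p-adic to natural exponents: the terms of the series agree modulo pᵏ with
      -- those of the finite expansion of (1 + (u - 1))^R, where R is a residue of s. The exponent
      -- laws below are transported across it.
      power-residue : ∀ s k → Σ ℕ λ M → ∀ K → M ≤ K → power u hu s ≈[ k ] u ^ residueAt s K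
      power-residue s k = M , λ K M≤K → go (residueAt s K) (proj₂ (choose-level-uniform s k k) K M≤K)
        where
          M : ℕ
          M = proj₁ (choose-level-uniform s k k)
          t : ℕ → ℤₚ
          t n = (s choose n) * (u - 1#) ^ n
          go : ∀ R → (∀ n → n < k → s choose n ≈[ k ] fromℤ (+ (R C n))) → power u hu s ≈[ k ] u ^ R
          go R near = lv-trans (lv-sym (proj₂ converges X (ℕ.m≤m⊔n (proj₁ converges) (suc R))))
              (level (mod-trans (partial X) (mod-trans (mod-reflexive (binomial-theorem (approx u k) R X (ℕ.m≤n⊔m (proj₁ converges) (suc R))))
                (mod-reflexive (sym (approx-^ u R k))))))
            where
              converges : Σ ℕ λ M → ∀ n → M ≤ n → partialSum t n ≈[ k ] power u hu s
              converges = series-⟶ {t} (power-Null hu s) k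
              X : ℕ
              X = proj₁ converges ℕ.⊔ suc R
              partial : ∀ n → approx (partialSum t n) k ≡ Σ< n (λ i → + (R C i) ℤ.* (approx u k ℤ.- + 1) ℤ.^ i) [mod P^ k ]
              partial zero    = mod-refl
              partial (suc n) = mod-+ (partial n) (at-level (power-term s k R near n))

    ^-exponent-level : ∀ k {m n} → + m ≡ + n [mod P^ k ] → u ^ m ≈[ k ] u ^ n
    ^-exponent-level zero    {m} {n} e = lv-0
    ^-exponent-level (suc k) {m} {n} e = level (mod-trans (mod-reflexive (approx-^ u m (suc k)))
      (mod-trans (^-exponent-mod (approx≡1 (suc k) (s≤s z≤n)) (suc k) {m} {n} e) (mod-reflexive (sym (approx-^ u n (suc k))))))

    power-cong : ∀ {s t} → s ≈ t → power u hu s ≈ power u hu t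
    power-cong {s} {t} h k = go (residueAt s K) (residueAt t K)
        (proj₂ (power-residue s k) K (ℕ.≤-trans (ℕ.m≤m⊔n M N) (ℕ.m≤m⊔n (M ℕ.⊔ N) k)))
        (proj₂ (power-residue t k) K (ℕ.≤-trans (ℕ.m≤n⊔m M N) (ℕ.m≤m⊔n (M ℕ.⊔ N) k)))
        (mod-trans (residueAt-mod s k≤K) (mod-trans (at-level (h k)) (mod-sym (residueAt-mod t k≤K))))
      where
        M N K : ℕ
        M = proj₁ (power-residue s k)
        N = proj₁ (power-residue t k)
        K = (M ℕ.⊔ N) ℕ.⊔ k
        k≤K : k ≤ K
        k≤K = ℕ.m≤n⊔m (M ℕ.⊔ N) k
        go : ∀ m n → power u hu s ≈[ k ] u ^ m → power u hu t ≈[ k ] u ^ n → + m ≡ + n [mod P^ k ] →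
             power u hu s ≈[ k ] power u hu t
        go m n em en e = lv-trans em (lv-trans (^-exponent-level k e) (lv-sym en))

    -- All three residues are taken at one K ≥ k, so they satisfy l ≡ m + n modulo pᵏ, and exponents
    -- of u matter only modulo pᵏ. The separate r accommodates the negated exponents of `factorOf`,
    -- where -(s + s′) is only equivalent to -s + -s′.
    power-+ : ∀ r s t → r ≈ s + t → power u hu r ≈ power u hu s * power u hu t
    power-+ r s t h k = go (residueAt r K) (residueAt s K) (residueAt t K)
        (proj₂ (power-residue r k) K (ℕ.≤-trans (ℕ.m≤n⊔m (M ℕ.⊔ N) L′) (ℕ.m≤m⊔n ((M ℕ.⊔ N) ℕ.⊔ L′) k)))
        (proj₂ (power-residue s k) K (ℕ.≤-trans (ℕ.m≤m⊔n M N) MN≤K))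
        (proj₂ (power-residue t k) K (ℕ.≤-trans (ℕ.m≤n⊔m M N) MN≤K))
        (mod-trans (residueAt-mod r k≤K) (mod-trans (at-level (h k)) (mod-sym (mod-+ (residueAt-mod s k≤K) (residueAt-mod t k≤K)))))
      where
        M N L′ K : ℕ
        M  = proj₁ (power-residue s k)
        N  = proj₁ (power-residue t k)
        L′ = proj₁ (power-residue r k)
        K  = ((M ℕ.⊔ N) ℕ.⊔ L′) ℕ.⊔ k
        k≤K : k ≤ K
        k≤K  = ℕ.m≤n⊔m ((M ℕ.⊔ N) ℕ.⊔ L′) k
        MN≤K : M ℕ.⊔ N ≤ K
        MN≤K = ℕ.≤-trans (ℕ.m≤m⊔n (M ℕ.⊔ N) L′) (ℕ.m≤m⊔n ((M ℕ.⊔ N) ℕ.⊔ L′) k)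
        go : ∀ l m n → power u hu r ≈[ k ] u ^ l → power u hu s ≈[ k ] u ^ m → power u hu t ≈[ k ] u ^ n →
             + l ≡ + m ℤ.+ + n [mod P^ k ] → power u hu r ≈[ k ] power u hu s * power u hu t
        go l m n el em en e = begin
          power u hu r                 ≈⟨ el ⟩
          u ^ l                        ≈⟨ ^-exponent-level k {l} {m ℕ.+ n} e ⟩
          u ^ (m ℕ.+ n)                ≈⟨ ^-+ u m n k ⟩
          u ^ m * u ^ n                ≈⟨ lv-* em en ⟨
          power u hu s * power u hu t  ∎
          where open lv-Reasoning k

  module _ (u : ℤₚˣ) where
    ^ᶻ-⊖ : ∀ m n → u ^ᶻ (m ℤ.⊖ n) ≈ value u ^ m * inverse u ^ n
    ^ᶻ-⊖ zero    zero    = ≈-sym (*-identityˡ 1#)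
    ^ᶻ-⊖ zero    (suc n) = ≈-sym (*-identityˡ (inverse u ^ suc n))
    ^ᶻ-⊖ (suc m) zero    = ≈-sym (*-identityʳ (value u ^ suc m))
    ^ᶻ-⊖ (suc m) (suc n) k = begin
      u ^ᶻ (suc m ℤ.⊖ suc n)
        ≈⟨ level (mod-reflexive (cong (λ z → approx (u ^ᶻ z) k) (ℤ.[1+m]⊖[1+n]≡m⊖n m n))) ⟩
      u ^ᶻ (m ℤ.⊖ n)
        ≈⟨ ^ᶻ-⊖ m n k ⟩
      value u ^ m * inverse u ^ n
        ≈⟨ *-identityˡ (value u ^ m * inverse u ^ n) k ⟨
      1# * (value u ^ m * inverse u ^ n)
        ≈⟨ lv-* (lv-sym (isInverse u k)) lv-refl ⟩
      (value u * inverse u) * (value u ^ m * inverse u ^ n)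
        ≈⟨ level (mod-reflexive (lemma (approx (value u) k) (approx (inverse u) k) (approx (value u ^ m) k) (approx (inverse u ^ n) k))) ⟩
      value u ^ suc m * inverse u ^ suc n ∎
      where
        open lv-Reasoning k
        lemma : ∀ v w x y → (v ℤ.* w) ℤ.* (x ℤ.* y) ≡ (v ℤ.* x) ℤ.* (w ℤ.* y)
        lemma = solve-∀

    ^ᶻ-+ : ∀ m n → u ^ᶻ (m ℤ.+ n) ≈ u ^ᶻ m * u ^ᶻ n
    ^ᶻ-+ (+ m)    (+ n)    = ^-+ (value u) m n
    ^ᶻ-+ (+ m)    -[1+ n ] = ^ᶻ-⊖ m (suc n)
    ^ᶻ-+ -[1+ m ] (+ n)    k = lv-trans (^ᶻ-⊖ n (suc m) k) (*-comm (value u ^ n) (inverse u ^ suc m) k)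
    ^ᶻ-+ -[1+ m ] -[1+ n ] k = lv-trans (level (mod-reflexive (cong (λ z → approx (inverse u ^ suc z) k) (sym (ℕ.+-suc m n)))))
      (^-+ (inverse u) (suc m) (suc n) k)

  factorOf-+ : ∀ {y} s n s′ n′ r (D : Decomposition y) → r ≈ s + s′ → factorOf s n D * factorOf s′ n′ D ≈ factorOf r (n ℤ.+ n′) D
  factorOf-+ s n s′ n′ r D h k = go (power-+ (⟨⟩∈1+qℤₚ D) (- r) (- s) (- s′)
      (λ k → level (mod-trans (mod-neg (at-level (h k))) (mod-reflexive (ℤ.neg-distrib-+ (approx s k) (approx s′ k))))) k) (^ᶻ-+ (ω D) n n′ k)
    where
      lemma : ∀ v w x y → (v ℤ.* w) ℤ.* (x ℤ.* y) ≡ (v ℤ.* x) ℤ.* (w ℤ.* y)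
      lemma = solve-∀
      go : ∀ {P P′ P″ O O′ O″} → P″ ≈[ k ] P * P′ → O″ ≈[ k ] O * O′ → (P * O) * (P′ * O′) ≈[ k ] P″ * O″
      go {P} {P′} {P″} {O} {O′} {O″} hP hO = lv-trans
        (level (mod-reflexive (lemma (approx P k) (approx O k) (approx P′ k) (approx O′ k)))) (lv-sym (lv-* hP hO))

  factorOf-cong : ∀ {y s s′} n (D : Decomposition y) → s ≈ s′ → factorOf s n D ≈ factorOf s′ n D
  factorOf-cong {s = s} {s′} n D h k = lv-* (power-cong (⟨⟩∈1+qℤₚ D) { - s} { - s′} (λ m → lv-neg (h m)) k) lv-refl

  -- Symmetry of the factors

  -- This is ωⁿ(-1): ω(-1) = -1 is its own inverse, so the absolute value of n serves for negative
  -- exponents too.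
  ε : ℤ → ℤₚ
  ε n = (- 1#) ^ ℤ.∣ n ∣

  ^-neg : ∀ {v w} → w ≈ - v → ∀ n → w ^ n ≈ (- 1#) ^ n * v ^ n
  ^-neg h zero    = ≈-sym (*-identityˡ 1#)
  ^-neg {v} {w} h (suc n) k = lv-trans (lv-* (h k) (^-neg h n k))
    (exactly { - v * (e * x)} {(- 1# * e) * (v * x)} (λ m → lemma (approx v m) (approx e m) (approx x m)) k)
    where
      e x : ℤₚ
      e = (- 1#) ^ n
      x = v ^ n
      lemma : ∀ v e x → ℤ.- v ℤ.* (e ℤ.* x) ≡ (ℤ.- + 1 ℤ.* e) ℤ.* (v ℤ.* x)
      lemma = solve-∀

  -- Relates the computed decompositions of x and -x directly, without an appeal to uniqueness. The
  -- inverse of ω is compared as well because negative powers are formed from it.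
  record Opposite {d x y} (D : DecompositionAt d x) (E : DecompositionAt d y) : Set where
    field
      opposite-ω   : value (ω E) ≈ - value (ω D)
      opposite-ω⁻¹ : inverse (ω E) ≈ - inverse (ω D)
      same-⟨⟩      : ⟨⟩ E ≈ ⟨⟩ D
  open Opposite

  module _ (p≢2 : ¬ p ≡ 2) where
    -- With 3 split off, both p and p - 2 have the form 1 + 2m to which `odd-^` applies. The
    -- exponent p - 2 is the one defining the inverse of a Teichmüller representative.
    odd-prime : Σ ℕ λ m → p ≡ 3 ℕ.+ m ℕ.* 2
    odd-prime = go (p ℕ.% 2) (p ℕ./ 2) (ℕ.m%n<n p 2) (ℕ.m≡m%n+[m/n]*n p 2)
      where
        go : ∀ r m → r < 2 → p ≡ r ℕ.+ m ℕ.* 2 → Σ ℕ λ m → p ≡ 3 ℕ.+ m ℕ.* 2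
        go 0 m _ eq with prime⇒irreducible p-prime (ℕ.divides m eq)
        ... | inj₂ 2≡p = contradiction (sym 2≡p) p≢2
        go 1 (suc m) _ eq = m , eq
        go 1 zero    _ eq = contradiction (subst (1 <_) eq (ℕ.nonTrivial⇒n>1 p {{prime⇒nonTrivial p-prime}})) λ { (s≤s ()) }
        go (suc (suc r)) m (s≤s (s≤s ())) eq

    odd-^ : ∀ m a → (ℤ.- a) ℤ.^ (1 ℕ.+ m ℕ.* 2) ≡ ℤ.- (a ℤ.^ (1 ℕ.+ m ℕ.* 2))
    odd-^ zero    a = lemma a
      where lemma : ∀ a → ℤ.- a ℤ.* + 1 ≡ ℤ.- (a ℤ.* + 1)
            lemma = solve-∀
    odd-^ (suc m) a = trans (cong (λ z → ℤ.- a ℤ.* (ℤ.- a ℤ.* z)) (odd-^ m a)) (lemma a (a ℤ.^ (1 ℕ.+ m ℕ.* 2)))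
      where lemma : ∀ a x → ℤ.- a ℤ.* (ℤ.- a ℤ.* ℤ.- x) ≡ ℤ.- (a ℤ.* (a ℤ.* x))
            lemma = solve-∀

    ^-p-neg : ∀ a → (ℤ.- a) ℤ.^ p ≡ ℤ.- (a ℤ.^ p)
    ^-p-neg a = subst (λ z → (ℤ.- a) ℤ.^ z ≡ ℤ.- (a ℤ.^ z)) (sym (proj₂ odd-prime)) (odd-^ (suc (proj₁ odd-prime)) a)

    ^-p∸2-neg : ∀ a → (ℤ.- a) ℤ.^ (p ℕ.∸ 2) ≡ ℤ.- (a ℤ.^ (p ℕ.∸ 2))
    ^-p∸2-neg a = subst (λ z → (ℤ.- a) ℤ.^ z ≡ ℤ.- (a ℤ.^ z)) (cong (ℕ._∸ 2) (sym (proj₂ odd-prime))) (odd-^ (proj₁ odd-prime) a)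

    teich-neg : ∀ a n → teich (ℤ.- a) n ≡ ℤ.- teich a n
    teich-neg a zero    = refl
    teich-neg a (suc n) = trans (cong (ℤ._^ p) (teich-neg a n)) (^-p-neg (teich a n))

    decompose-odd-neg : ∀ x p∤x p∤-x → Opposite (decompose-odd x p∤x p≢2) (decompose-odd (- x) p∤-x p≢2)
    decompose-odd-neg x p∤x p∤-x = record
      { opposite-ω   = exactly (teich-neg a)
      ; opposite-ω⁻¹ = exactly inverse-neg
      ; same-⟨⟩      = exactly λ n → trans (cong (ℤ.- approx x n ℤ.*_) (inverse-neg n)) (lemma (approx x n) (approx (inverse t) n)) }
      where
        a : ℤ
        a = approx x 1
        t t⁻ : ℤₚˣ
        t = teichmüller-unit a (∤-approx p∤x)
        t⁻ = teichmüller-unit (ℤ.- a) (∤-approx p∤-x)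
        inverse-neg : ∀ n → approx (inverse t⁻) n ≡ ℤ.- approx (inverse t) n
        inverse-neg n = trans (approx-^ (value t⁻) (p ℕ.∸ 2) n) (trans (cong (ℤ._^ (p ℕ.∸ 2)) (teich-neg a n))
          (trans (^-p∸2-neg (teich a n)) (cong ℤ.-_ (sym (approx-^ (value t) (p ℕ.∸ 2) n)))))
        lemma : ∀ x y → ℤ.- x ℤ.* ℤ.- y ≡ x ℤ.* y
        lemma = solve-∀

  module _ (p≡2 : p ≡ 2) where
    -- For odd x exactly one of x and -x is 1 modulo 4, so the two decisions always differ.
    decompose-two-neg : ∀ x p∤x p∤-x d e → Opposite (decompose-two p≡2 x p∤x d) (decompose-two p≡2 (- x) p∤-x e)
    decompose-two-neg x p∤x p∤-x (yes a) (no _) = record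
      { opposite-ω   = ≈-refl
      ; opposite-ω⁻¹ = ≈-refl
      ; same-⟨⟩      = exactly λ n → ℤ.neg-involutive (approx x n) }
    decompose-two-neg x p∤x p∤-x (no _) (yes b) = record
      { opposite-ω   = exactly λ _ → refl
      ; opposite-ω⁻¹ = exactly λ _ → refl
      ; same-⟨⟩      = ≈-refl }
    decompose-two-neg x p∤x p∤-x (yes a) (yes b) = contradiction
      (ℕ.∣⇒≤ (ℤ∣.∣⇒∣ᵤ (subst (+ 4 ℤ∣.∣_) (lemma (approx x 2)) (ℤ∣.∣m∣n⇒∣m+n a b)))) λ { (s≤s (s≤s ())) }
      where lemma : ∀ a → (a ℤ.- + 1) ℤ.+ (ℤ.- a ℤ.- + 1) ≡ ℤ.- + 2
            lemma = solve-∀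
    decompose-two-neg x p∤x p∤-x (no ¬a) (no ¬b) = contradiction
      (subst (+ 4 ℤ∣.∣_) (lemma (approx x 2)) (ℤ∣.∣m⇒∣-m (odd-mod-4 (approx x 2) odd ¬a))) ¬b
      where
        lemma : ∀ a → ℤ.- (a ℤ.+ + 1) ≡ ℤ.- a ℤ.- + 1
        lemma = solve-∀
        odd : ¬ (+ 2 ℤ∣.∣ approx x 2)
        odd d = ∤-approx p∤x (subst (λ z → + z ℤ∣.∣ approx x 1) (sym p≡2)
          (mod0⇒∣ (mod-trans (mod-sym (subst (approx x 2 ≡ approx x 1 [mod_]) (trans P^1 (cong +_ p≡2)) (coherent x 1))) (∣⇒mod0 d))))

  decomposeAt-neg : ∀ d x p∤x p∤-x → Opposite (decomposeAt d x p∤x) (decomposeAt d (- x) p∤-x)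
  decomposeAt-neg (yes p≡2) x p∤x p∤-x = decompose-two-neg p≡2 x p∤x p∤-x
    (+ 4 ℤ∣.∣? (approx x 2 ℤ.- + 1)) (+ 4 ℤ∣.∣? (approx (- x) 2 ℤ.- + 1))
  decomposeAt-neg (no  p≢2) x p∤x p∤-x = decompose-odd-neg p≢2 x p∤x p∤-x

  ^ᶻ-neg : ∀ {u v} → value v ≈ - value u → inverse v ≈ - inverse u → ∀ n → v ^ᶻ n ≈ ε n * u ^ᶻ n
  ^ᶻ-neg h h′ (+ n)    = ^-neg h n
  ^ᶻ-neg h h′ -[1+ n ] = ^-neg h′ (suc n)

  factorOf-neg : ∀ {x y} s n (D : Decomposition x) (E : Decomposition y) → Opposite D E → factorOf s n E ≈ ε n * factorOf s n D
  factorOf-neg s n D E o k = go (power-level (⟨⟩∈1+qℤₚ E) (⟨⟩∈1+qℤₚ D) (- s) k (same-⟨⟩ o k))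
      (^ᶻ-neg {ω D} {ω E} (opposite-ω o) (opposite-ω⁻¹ o) n k)
    where
      lemma : ∀ p e o → p ℤ.* (e ℤ.* o) ≡ e ℤ.* (p ℤ.* o)
      lemma = solve-∀
      go : ∀ {P P′ O O′} → P ≈[ k ] P′ → O ≈[ k ] ε n * O′ → P * O ≈[ k ] ε n * (P′ * O′)
      go {P} {P′} {O} {O′} hP hO = lv-trans (lv-* hP hO) (level (mod-reflexive (lemma (approx P′ k) (approx (ε n) k) (approx O′ k))))

  ∣-neg : ∀ {x} → pₚ ∣ - x → pₚ ∣ x
  ∣-neg {x} d = level0⇒pₚ∣ (level (subst (λ z → z ≡ + 0 [mod P^ 1 ]) (ℤ.neg-involutive (approx x 1)) (mod-neg (at-level (pₚ∣⇒level0 d)))))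

  ∣-cong : ∀ {x y} → x ≈ y → pₚ ∣ x → pₚ ∣ y
  ∣-cong h d = level0⇒pₚ∣ (lv-trans (lv-sym (h 1)) (pₚ∣⇒level0 d))

  -- Extending each factor by 0 absorbs the domain of integration: the integrand becomes a plain
  -- product, and identities between factors hold at every y without carrying proofs that p does not
  -- divide y.
  totalFactorAt : ℤₚ → ℤ → (y : ℤₚ) → Dec (pₚ ∣ y) → ℤₚ
  totalFactorAt s n y (yes _)  = 0#
  totalFactorAt s n y (no p∤y) = factor s n y p∤y

  opaque
    totalFactor : ℤₚ → ℤ → ℤₚ → ℤₚ
    totalFactor s n y = totalFactorAt s n y (pₚ∣? y)

    totalFactor-non-unit : ∀ s n {y} → pₚ ∣ y → totalFactor s n y ≈ 0#
    totalFactor-non-unit s n {y} d = go (pₚ∣? y)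
      where go : ∀ e → totalFactorAt s n y e ≈ 0#
            go (yes _)  = ≈-refl
            go (no p∤y) = contradiction d p∤y

    totalFactor-unit : ∀ s n {y} (p∤y : ¬ (pₚ ∣ y)) → totalFactor s n y ≈ factor s n y p∤y
    totalFactor-unit s n {y} p∤y = go (pₚ∣? y)
      where go : ∀ e → totalFactorAt s n y e ≈ factor s n y p∤y
            go (yes d) = contradiction d p∤y
            go (no h) k = factor-level s n k h p∤y lv-refl

  totalFactor-cong : ∀ s n {y z} → y ≈ z → totalFactor s n y ≈ totalFactor s n z
  totalFactor-cong s n {y} {z} h k = go (pₚ∣? y)
    where
      go : Dec (pₚ ∣ y) → totalFactor s n y ≈[ k ] totalFactor s n z
      go (yes d) = lv-trans (totalFactor-non-unit s n d k) (lv-sym (totalFactor-non-unit s n (∣-cong h d) k))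
      go (no p∤y) = lv-trans (totalFactor-unit s n p∤y k) (lv-trans (factor-level s n k p∤y p∤z (h (k ℕ.+ 2))) (lv-sym (totalFactor-unit s n p∤z k)))
        where p∤z : ¬ (pₚ ∣ z)
              p∤z d = p∤y (∣-cong (≈-sym {y} {z} h) d)

  totalFactor-exponent-cong : ∀ {s s′ n n′} → s ≈ s′ → n ≡ n′ → ∀ y → totalFactor s n y ≈ totalFactor s′ n′ y
  totalFactor-exponent-cong {s} {s′} {n} h refl y k = go (pₚ∣? y)
    where
      go : Dec (pₚ ∣ y) → totalFactor s n y ≈[ k ] totalFactor s′ n y
      go (yes d)  = lv-trans (totalFactor-non-unit s n d k) (lv-sym (totalFactor-non-unit s′ n d k))
      go (no p∤y) = lv-trans (totalFactor-unit s n p∤y k) (lv-trans (factorOf-cong {s = s} {s′} n (decompose y p∤y) h k) (lv-sym (totalFactor-unit s′ n p∤y k)))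

  totalFactor-+ : ∀ s n s′ n′ y → totalFactor s n y * totalFactor s′ n′ y ≈ totalFactor (s + s′) (n ℤ.+ n′) y
  totalFactor-+ s n s′ n′ y = go (s + s′) (≈-refl {s + s′}) (pₚ∣? y)
    where
      go : ∀ r → r ≈ s + s′ → Dec (pₚ ∣ y) → totalFactor s n y * totalFactor s′ n′ y ≈ totalFactor r (n ℤ.+ n′) y
      go r h (yes d) k = lv-trans (lv-* {k} {totalFactor s n y} {0#} {totalFactor s′ n′ y} (totalFactor-non-unit s n d k) lv-refl)
        (lv-trans (zeroˡ (totalFactor s′ n′ y) k) (lv-sym (totalFactor-non-unit r (n ℤ.+ n′) d k)))
      go r h (no p∤y) k = lv-trans (lv-* (totalFactor-unit s n p∤y k) (totalFactor-unit s′ n′ p∤y k))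
        (lv-trans (factorOf-+ s n s′ n′ r (decompose y p∤y) h k) (lv-sym (totalFactor-unit r (n ℤ.+ n′) p∤y k)))

  totalFactor-opposite : ∀ {y z} s n (p∤y : ¬ (pₚ ∣ y)) (p∤z : ¬ (pₚ ∣ z)) → Opposite (decompose y p∤y) (decompose z p∤z) →
                         totalFactor s n z ≈ ε n * totalFactor s n y
  totalFactor-opposite {y} {z} s n p∤y p∤z o k = lv-trans (totalFactor-unit s n p∤z k) (lv-trans
    (factorOf-neg s n (decompose y p∤y) (decompose z p∤z) o k)
    (lv-* {k} {ε n} lv-refl (lv-sym (totalFactor-unit s n p∤y k))))

  totalFactor-neg : ∀ s n y → totalFactor s n (- y) ≈ ε n * totalFactor s n y
  totalFactor-neg s n y = go (pₚ∣? y)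
    where
      go : Dec (pₚ ∣ y) → totalFactor s n (- y) ≈ ε n * totalFactor s n y
      go (yes d) k = lv-trans (totalFactor-non-unit s n (∣-neg (∣-cong (exactly λ m → sym (ℤ.neg-involutive (approx y m))) d)) k)
        (lv-sym (lv-zeroʳ (ε n) (totalFactor-non-unit s n d k)))
      go (no p∤y) = totalFactor-opposite s n p∤y (p∤y ∘ ∣-neg) (decomposeAt-neg (p ℕ.≟ 2) y p∤y (p∤y ∘ ∣-neg))

  product-zero : ∀ {r} (v : Vector ℤₚ r) i → v i ≈ 0# → product v ≈ 0#
  product-zero v zero    h k = lv-trans (lv-* (h k) lv-refl) (zeroˡ (product (v ∘ suc)) k)
  product-zero v (suc i) h k = lv-zeroʳ (v zero) (product-zero (v ∘ suc) i h k)

  totalIntegrand : ∀ {r} → Vector ℤₚ r → Vector ℤ r → Vector ℤₚ r → Vector ℤₚ r → ℤₚ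
  totalIntegrand s n γ x = product λ l → totalFactor (s l) (n l) (partialForm γ x l)

  integrand-total : ∀ {r} (s : Vector ℤₚ r) (n : Vector ℤ r) γ x → integrand s n γ x ≈ totalIntegrand s n γ x
  -- The second decision supplies an explicit index whose form is divisible by p; failure of the
  -- domain condition alone would not produce one.
  integrand-total s n γ x = go (domain? γ x) (Fin.any? λ l → pₚ∣? (partialForm γ x l))
    where
      go : ∀ d → Dec (Σ (Fin _) λ l → pₚ ∣ partialForm γ x l) → integrandAt s n γ x d ≈ totalIntegrand s n γ x
      go (yes D) _ k = lv-product λ l → lv-sym (totalFactor-unit (s l) (n l) (D l) k)
      go (no ¬D) (yes (l , d)) = ≈-sym {totalIntegrand s n γ x} {0#} (product-zero _ l (totalFactor-non-unit (s l) (n l) d))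
      go (no ¬D) (no none) = contradiction (λ l d → none (l , d)) ¬D

  -- Restriction to coordinate subspaces

  module ℤₚ-sums = BlockSums (CommutativeRing.+-monoid ℤₚ-commutativeRing)
  module ℤ-sums = BlockSums ℤ.+-0-monoid

  extend : ∀ {n} (J : Subset n) → Vector ℤₚ ∣ J ∣ → Vector ℤₚ n
  extend Vec.[]              x = x
  extend (inside  Vec.∷ J) x = x zero ∷ extend J (x ∘ suc)
  extend (outside Vec.∷ J) x = 0# ∷ extend J x

  -- a + Σ_{j ≤ l} xⱼγⱼ
  form : ∀ {r} → ℤₚ → Vector ℤₚ r → Vector ℤₚ r → Vector ℤₚ r
  form a γ x zero    = a + x zero * γ zero
  form a γ x (suc l) = form (a + x zero * γ zero) (γ ∘ suc) (x ∘ suc) l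

  form-cong : ∀ {r a b} {γ x : Vector ℤₚ r} → a ≈ b → ∀ l → form a γ x l ≈ form b γ x l
  form-cong h zero    k = lv-+ (h k) lv-refl
  form-cong {a = a} {b} {γ} {x} h (suc l) = form-cong {a = a + x zero * γ zero} {b + x zero * γ zero} (λ k → lv-+ (h k) lv-refl) l

  partialForm-suc : ∀ {r} (γ x : Vector ℤₚ (suc r)) l → partialForm γ x (suc l) ≈ x zero * γ zero + partialForm (γ ∘ suc) (x ∘ suc) l
  partialForm-suc γ x l k = lv-+ {k} {x zero * γ zero} lv-refl (lv-sum λ j →
    level (mod-reflexive (cong (λ b → approx (if b then x (suc j) * γ (suc j) else 0#) k) (≤ᵇ-suc (toℕ j) (toℕ l)))))

  -- Replaces truncated sums by a running total, which a coordinate equal to 0 leaves unchanged.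
  -- This is the form in which blocks can be merged one coordinate at a time.
  partialForm-form : ∀ {r} a (γ x : Vector ℤₚ r) l → a + partialForm γ x l ≈ form a γ x l
  partialForm-form {suc r} a γ x zero k = lv-+ {k} {a} lv-refl
    (lv-trans (lv-+ {k} {x zero * γ zero} lv-refl (sum-zero {r} {λ _ → 0#} (λ _ → ≈-refl) k)) (+-identityʳ (x zero * γ zero) k))
  partialForm-form a γ x (suc l) k = begin
    a + partialForm γ x (suc l)
      ≈⟨ lv-+ {k} {a} lv-refl (partialForm-suc γ x l k) ⟩
    a + (x zero * γ zero + partialForm (γ ∘ suc) (x ∘ suc) l)
      ≈⟨ +-assoc a (x zero * γ zero) (partialForm (γ ∘ suc) (x ∘ suc) l) k ⟨
    (a + x zero * γ zero) + partialForm (γ ∘ suc) (x ∘ suc) l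
      ≈⟨ partialForm-form (a + x zero * γ zero) (γ ∘ suc) (x ∘ suc) l k ⟩
    form a γ x (suc l) ∎
    where open lv-Reasoning k

  formProduct : ∀ {r} → ℤₚ → Vector ℤₚ r → Vector ℤ r → Vector ℤₚ r → Vector ℤₚ r → ℤₚ
  formProduct a s n γ x = product λ l → totalFactor (s l) (n l) (form a γ x l)

  integrand-form : ∀ {r} (s : Vector ℤₚ r) (n : Vector ℤ r) γ x → integrand s n γ x ≈ formProduct 0# s n γ x
  integrand-form s n γ x k = lv-trans (integrand-total s n γ x k) (lv-product λ l →
    totalFactor-cong (s l) (n l) {partialForm γ x l} {form 0# γ x l}
      (λ m → lv-trans (lv-sym (+-identityˡ (partialForm γ x l) m)) (partialForm-form 0# γ x l m)) k)

  integrand-zero : ∀ {r} (s : Vector ℤₚ (suc r)) (n : Vector ℤ (suc r)) γ x → integrand s n γ (0# ∷ x) ≈ 0#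
  integrand-zero s n γ x k = lv-trans (integrand-form s n γ (0# ∷ x) k)
    (product-zero (λ l → totalFactor (s l) (n l) (form 0# γ (0# ∷ x) l)) zero
      (totalFactor-non-unit (s zero) (n zero) (0# ,∣ exactly λ m → lemma (approx (γ zero) m))) k)
    where lemma : ∀ g → + 0 ≡ + 0 ℤ.+ + 0 ℤ.* g
          lemma = solve-∀

  module _ {r} (J : Subset r) (s : Vector ℤₚ r) (n : Vector ℤ r) (γ : Vector ℤₚ r) where
    regrouped : ℤₚ → Vector ℤₚ ∣ J ∣ → ℤₚ
    regrouped a x = formProduct a (blockSum +-rawMonoid J s) (blockSum +-0-rawMonoid J n) (γ ∘ element J) x

  -- The induction carries an open block: s₀ and n₀ are the exponents collected so far at the
  -- running total a. A coordinate outside J is 0, so its factor is again taken at a and its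
  -- exponents join the block; an element of J closes the block, whose remaining `prefixSum` is then
  -- empty.
  regroup : ∀ {r} (J : Subset r) s₀ n₀ a s n γ x →
    totalFactor s₀ n₀ a * formProduct a s n γ (extend J x) ≈
    totalFactor (s₀ + ℤₚ-sums.prefixSum J s) (n₀ ℤ.+ ℤ-sums.prefixSum J n) a * regrouped J s n γ a x

  -- The first coordinate belongs to J and opens a new block at a + x₀γ₀, with its own s and n as
  -- the first exponents collected.
  regroup-inside : ∀ {r} (J : Subset r) a s n γ x →
    formProduct a s n γ (extend (inside Vec.∷ J) x) ≈ regrouped (inside Vec.∷ J) s n γ a x

  regroup Vec.[] s₀ n₀ a s n γ x k = lv-*
    (totalFactor-exponent-cong {s₀} {s₀ + 0#} (λ m → lv-sym (+-identityʳ s₀ m)) (sym (ℤ.+-identityʳ n₀)) a k) lv-refl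
  regroup {suc r} (inside Vec.∷ J) s₀ n₀ a s n γ x k = lv-*
    (totalFactor-exponent-cong {s₀} {s₀ + ℤₚ-sums.prefixSum (inside Vec.∷ J) s}
      (λ m → lv-sym (lv-trans (lv-+ {m} {s₀} lv-refl (ℤₚ-sums.sum-ε (suc r) m)) (+-identityʳ s₀ m)))
      (sym (trans (cong (λ z → n₀ ℤ.+ z) (ℤ-sums.sum-ε (suc r))) (ℤ.+-identityʳ n₀))) a k)
    (regroup-inside J a s n γ x k)
  regroup (outside Vec.∷ J) s₀ n₀ a s n γ x k = begin
    totalFactor s₀ n₀ a * (totalFactor (s zero) (n zero) a′ * X)
      ≈⟨ lv-* (totalFactor-cong s₀ n₀ {a} {a′} (λ m → lv-sym (a′≈a m)) k) lv-refl ⟩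
    totalFactor s₀ n₀ a′ * (totalFactor (s zero) (n zero) a′ * X)
      ≈⟨ *-assoc (totalFactor s₀ n₀ a′) (totalFactor (s zero) (n zero) a′) X k ⟨
    (totalFactor s₀ n₀ a′ * totalFactor (s zero) (n zero) a′) * X
      ≈⟨ lv-* (totalFactor-+ s₀ n₀ (s zero) (n zero) a′ k) lv-refl ⟩
    totalFactor (s₀ + s zero) (n₀ ℤ.+ n zero) a′ * X
      ≈⟨ regroup J (s₀ + s zero) (n₀ ℤ.+ n zero) a′ (s ∘ suc) (n ∘ suc) (γ ∘ suc) x k ⟩
    totalFactor ((s₀ + s zero) + ℤₚ-sums.prefixSum J (s ∘ suc)) ((n₀ ℤ.+ n zero) ℤ.+ ℤ-sums.prefixSum J (n ∘ suc)) a′ * Y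
      ≈⟨ lv-* (totalFactor-cong _ _ {a′} {a} a′≈a k) lv-refl ⟩
    totalFactor ((s₀ + s zero) + ℤₚ-sums.prefixSum J (s ∘ suc)) ((n₀ ℤ.+ n zero) ℤ.+ ℤ-sums.prefixSum J (n ∘ suc)) a * Y
      ≈⟨ lv-* (totalFactor-exponent-cong {(s₀ + s zero) + ℤₚ-sums.prefixSum J (s ∘ suc)} {s₀ + ℤₚ-sums.prefixSum (outside Vec.∷ J) s}
             (+-assoc s₀ (s zero) (ℤₚ-sums.prefixSum J (s ∘ suc))) (ℤ.+-assoc n₀ (n zero) (ℤ-sums.prefixSum J (n ∘ suc))) a k)
           (lv-product λ μ → lv-trans
             (totalFactor-cong _ _ {form a′ (γ ∘ suc ∘ element J) x μ} {form a (γ ∘ suc ∘ element J) x μ} (form-cong {a = a′} {a} a′≈a μ) k)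
             (totalFactor-exponent-cong {blockSum +-rawMonoid J (s ∘ suc) μ} {blockSum +-rawMonoid (outside Vec.∷ J) s μ}
               (λ m → lv-sym (ℤₚ-sums.blockSum-outside J s μ m)) (sym (ℤ-sums.blockSum-outside J n μ)) _ k)) ⟩
    totalFactor (s₀ + ℤₚ-sums.prefixSum (outside Vec.∷ J) s) (n₀ ℤ.+ ℤ-sums.prefixSum (outside Vec.∷ J) n) a *
      regrouped (outside Vec.∷ J) s n γ a x ∎
    where
      open lv-Reasoning k
      a′ X Y : ℤₚ
      a′ = a + 0# * γ zero
      X = formProduct a′ (s ∘ suc) (n ∘ suc) (γ ∘ suc) (extend J x)
      Y = regrouped J (s ∘ suc) (n ∘ suc) (γ ∘ suc) a′ x
      a′≈a : a′ ≈ a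
      a′≈a = exactly λ m → lemma (approx a m) (approx (γ zero) m)
        where lemma : ∀ a g → a ℤ.+ + 0 ℤ.* g ≡ a
              lemma = solve-∀

  regroup-inside J a s n γ x k = lv-trans
    (regroup J (s zero) (n zero) (a + x zero * γ zero) (s ∘ suc) (n ∘ suc) (γ ∘ suc) (x ∘ suc) k)
    (lv-* lv-refl (lv-product λ μ → totalFactor-exponent-cong
      {blockSum +-rawMonoid J (s ∘ suc) μ} {blockSum +-rawMonoid (inside Vec.∷ J) s (suc μ)}
      (λ m → lv-sym (ℤₚ-sums.blockSum-inside-suc J s μ m)) (sym (ℤ-sums.blockSum-inside-suc J n μ)) _ k))

  integrand-extend : ∀ {r} (J : Subset r) s n γ x → let J′ = inside Vec.∷ J in
    integrand s n γ (extend J′ x) ≈ integrand (blockSum +-rawMonoid J′ s) (blockSum +-0-rawMonoid J′ n) (γ ∘ element J′) x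
  integrand-extend J s n γ x k = lv-trans (integrand-form s n γ (extend (inside Vec.∷ J) x) k)
    (lv-trans (regroup-inside J 0# s n γ x k) (lv-sym (integrand-form
      (blockSum +-rawMonoid (inside Vec.∷ J) s) (blockSum +-0-rawMonoid (inside Vec.∷ J) n) (γ ∘ element (inside Vec.∷ J)) x k)))

  form-neg : ∀ {r} {a b} (γ x : Vector ℤₚ r) → b ≈ - a → ∀ l → form b γ (λ i → - x i) l ≈ - form a γ x l
  form-neg {suc r} {a} {b} γ x h = λ { zero → step ; (suc l) → form-neg (γ ∘ suc) (x ∘ suc) step l }
    where
      lemma : ∀ a x g → ℤ.- a ℤ.+ ℤ.- x ℤ.* g ≡ ℤ.- (a ℤ.+ x ℤ.* g)
      lemma = solve-∀
      step : b + (- x zero) * γ zero ≈ - (a + x zero * γ zero)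
      step k = lv-trans (lv-+ (h k) lv-refl) (level (mod-reflexive (lemma (approx a k) (approx (x zero) k) (approx (γ zero) k))))

  product-* : ∀ {r} (v w : Vector ℤₚ r) → product (λ i → v i * w i) ≈ product v * product w
  product-* {zero}  v w = ≈-sym (*-identityˡ 1#)
  product-* {suc r} v w k = lv-trans (lv-* {k} {v zero * w zero} lv-refl (product-* (v ∘ suc) (w ∘ suc) k))
    (level (mod-reflexive (lemma (approx (v zero) k) (approx (w zero) k) (approx (product (v ∘ suc)) k) (approx (product (w ∘ suc)) k))))
    where lemma : ∀ a b c d → (a ℤ.* b) ℤ.* (c ℤ.* d) ≡ (a ℤ.* c) ℤ.* (b ℤ.* d)
          lemma = solve-∀

  integrand-neg : ∀ {r} (s : Vector ℤₚ r) n γ x → integrand s n γ (λ i → - x i) ≈ product (ε ∘ n) * integrand s n γ x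
  integrand-neg s n γ x k = begin
    integrand s n γ (λ i → - x i)
      ≈⟨ integrand-form s n γ (λ i → - x i) k ⟩
    product (λ l → totalFactor (s l) (n l) (form 0# γ (λ i → - x i) l))
      ≈⟨ lv-product (λ l → lv-trans
           (totalFactor-cong (s l) (n l) {form 0# γ (λ i → - x i) l} { - form 0# γ x l} (form-neg {a = 0#} {0#} γ x (exactly λ _ → refl) l) k)
           (totalFactor-neg (s l) (n l) (form 0# γ x l) k)) ⟩
    product (λ l → ε (n l) * totalFactor (s l) (n l) (form 0# γ x l))
      ≈⟨ product-* (ε ∘ n) (λ l → totalFactor (s l) (n l) (form 0# γ x l)) k ⟩
    product (ε ∘ n) * formProduct 0# s n γ x
      ≈⟨ lv-* {k} {product (ε ∘ n)} lv-refl (lv-sym (integrand-form s n γ x k)) ⟩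
    product (ε ∘ n) * integrand s n γ x ∎
    where open lv-Reasoning k

  -- States x = (-1)ᵃ as a dichotomy between the residues of a modulo 2. Excluding one residue by
  -- the parity hypothesis then leaves the other sign.
  IsSign : ℤ → ℤₚ → Set
  IsSign a x = (a ≡ + 0 [mod + 2 ] × x ≈ 1#) ⊎ (a ≡ + 1 [mod + 2 ] × x ≈ fromℤ (ℤ.- + 1))

  *-signs : ∀ {x y u v w} → x ≈ fromℤ u → y ≈ fromℤ v → u ℤ.* v ≡ w → x * y ≈ fromℤ w
  *-signs h h′ refl k = lv-trans (lv-* (h k) (h′ k)) (level mod-refl)

  IsSign-* : ∀ {a b x y} → IsSign a x → IsSign b y → IsSign (a ℤ.+ b) (x * y)
  IsSign-* (inj₁ (h , e)) (inj₁ (h′ , e′)) = inj₁ (mod-+ h h′ , *-signs e e′ refl)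
  IsSign-* (inj₁ (h , e)) (inj₂ (h′ , e′)) = inj₂ (mod-+ h h′ , *-signs e e′ refl)
  IsSign-* (inj₂ (h , e)) (inj₁ (h′ , e′)) = inj₂ (mod-+ h h′ , *-signs e e′ refl)
  IsSign-* (inj₂ (h , e)) (inj₂ (h′ , e′)) = inj₁ (mod-trans (mod-+ h h′) (mod (divides (+ 1) refl)) , *-signs e e′ refl)

  mod-2-neg : ∀ a → ℤ.- a ≡ a [mod + 2 ]
  mod-2-neg a = mod (divides (ℤ.- a) (lemma a))
    where lemma : ∀ a → ℤ.- a ℤ.- a ≡ ℤ.- a ℤ.* + 2
          lemma = solve-∀

  IsSign-^ : ∀ n → IsSign (+ n) ((- 1#) ^ n)
  IsSign-^ zero    = inj₁ (mod-refl , ≈-refl)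
  IsSign-^ (suc n) = IsSign-* {+ 1} {+ n} (inj₂ (mod-refl , exactly λ _ → refl)) (IsSign-^ n)

  IsSign-cong : ∀ {a b x} → a ≡ b [mod + 2 ] → IsSign b x → IsSign a x
  IsSign-cong h (inj₁ (h′ , e)) = inj₁ (mod-trans h h′ , e)
  IsSign-cong h (inj₂ (h′ , e)) = inj₂ (mod-trans h h′ , e)

  IsSign-ε : ∀ n → IsSign n (ε n)
  IsSign-ε (+ n)    = IsSign-^ n
  IsSign-ε -[1+ n ] = IsSign-cong (mod-2-neg (+ suc n)) (IsSign-^ (suc n))


  IsSign-product : ∀ {r} (n : Vector ℤ r) → IsSign (sumℤ n) (product (ε ∘ n))
  IsSign-product {zero}  n = inj₁ (mod-refl , ≈-refl)
  IsSign-product {suc r} n = IsSign-* (IsSign-ε (n zero)) (IsSign-product (n ∘ suc))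

  total-sign : ∀ {r} (n : Vector ℤ r) → ¬ (sumℤ n ≡ + r [mod + 2 ]) → (- 1#) ^ r * product (ε ∘ n) ≈ fromℤ (ℤ.- + 1)
  total-sign {r} n odd with IsSign-* (IsSign-^ r) (IsSign-product n)
  ... | inj₂ (_ , e) = e
  ... | inj₁ (h , _) = contradiction
    (mod-trans (mod-reflexive (lemma (+ r) (sumℤ n))) (mod-trans (mod-+ h (mod-2-neg (+ r))) (mod-reflexive (ℤ.+-identityˡ (+ r))))) odd
    where lemma : ∀ r n → n ≡ (r ℤ.+ n) ℤ.+ ℤ.- r
          lemma = solve-∀

  -- Riemann sums

  module _ {A : Set} where
    sumOver-level : ∀ {k} (xs : List A) {f g} → (∀ x → f x ≈[ k ] g x) → sumOver xs f ≈[ k ] sumOver xs g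
    sumOver-level List.[]         h = lv-refl
    sumOver-level (x List.∷ xs) h = lv-+ (h x) (sumOver-level xs h)

    sumOver-zero : ∀ (xs : List A) → sumOver xs (λ _ → 0#) ≈ 0#
    sumOver-zero List.[]         = ≈-refl
    sumOver-zero (x List.∷ xs) k = lv-trans (+-identityˡ (sumOver xs (λ _ → 0#)) k) (sumOver-zero xs k)

    sumOver-++ : ∀ (xs ys : List A) f → sumOver (xs ++ ys) f ≈ sumOver xs f + sumOver ys f
    sumOver-++ List.[]         ys f = ≈-sym (+-identityˡ (sumOver ys f))
    sumOver-++ (x List.∷ xs) ys f k = lv-trans (lv-+ {k} {f x} lv-refl (sumOver-++ xs ys f k))
      (lv-sym (+-assoc (f x) (sumOver xs f) (sumOver ys f) k))

    sumOver-+ : ∀ (xs : List A) f g → sumOver xs (λ x → f x + g x) ≈ sumOver xs f + sumOver xs g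
    sumOver-+ List.[]         f g = ≈-sym (+-identityˡ 0#)
    sumOver-+ (x List.∷ xs) f g k = lv-trans (lv-+ {k} {f x + g x} lv-refl (sumOver-+ xs f g k))
      (interchange (f x) (g x) (sumOver xs f) (sumOver xs g) k)

    sumOver-* : ∀ (xs : List A) c f → sumOver xs (λ x → c * f x) ≈ c * sumOver xs f
    sumOver-* List.[]         c f = ≈-sym (zeroʳ c)
    sumOver-* (x List.∷ xs) c f k = lv-trans (lv-+ {k} {c * f x} lv-refl (sumOver-* xs c f k)) (lv-sym (distribˡ c (f x) (sumOver xs f) k))

    sumOver-sum : ∀ {n} (xs : List A) (f : Fin n → A → ℤₚ) → sum (λ i → sumOver xs (f i)) ≈ sumOver xs (λ x → sum λ i → f i x)
    sumOver-sum {zero}  xs f = ≈-sym (sumOver-zero xs)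
    sumOver-sum {suc n} xs f k = lv-trans (lv-+ {k} {sumOver xs (f zero)} lv-refl (sumOver-sum xs (λ i → f (suc i)) k))
      (lv-sym (sumOver-+ xs (f zero) (λ x → sum λ i → f (suc i) x) k))

    sumOver-filter : ∀ {P : A → Set} (P? : ∀ x → Dec (P x)) xs f →
                     sumOver (filter P? xs) f ≈ sumOver xs (λ x → if does (P? x) then f x else 0#)
    sumOver-filter P? List.[]       f = ≈-refl
    sumOver-filter P? (x List.∷ xs) f k with does (P? x)
    ... | true  = lv-+ {k} {f x} lv-refl (sumOver-filter P? xs f k)
    ... | false = lv-trans (sumOver-filter P? xs f k) (lv-sym (+-identityˡ _ k))

  sumOver-map : ∀ {A B : Set} (φ : A → B) xs f → sumOver (List.map φ xs) f ≡ sumOver xs (f ∘ φ)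
  sumOver-map φ List.[]       f = refl
  sumOver-map φ (x List.∷ xs) f = cong (λ y → f (φ x) + y) (sumOver-map φ xs f)

  reflexive : ∀ {x y} → x ≡ y → x ≈ y
  reflexive refl = ≈-refl

  sumOver-allSubsets : ∀ n (f : Subset (suc n) → ℤₚ) →
    sumOver (allSubsets (suc n)) f ≈ sumOver (allSubsets n) (f ∘ (outside Vec.∷_)) + sumOver (allSubsets n) (f ∘ (inside Vec.∷_))
  sumOver-allSubsets n f k = lv-trans (sumOver-++ (List.map (outside Vec.∷_) (allSubsets n)) (List.map (inside Vec.∷_) (allSubsets n)) f k)
    (lv-+ (reflexive (sumOver-map (outside Vec.∷_) (allSubsets n) f) k) (reflexive (sumOver-map (inside Vec.∷_) (allSubsets n) f) k))

  -- Here g is f with the value at ⊤ erased. An explicit element missing from J is the usable form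
  -- of J ≠ ⊤, and every subset with an `outside` entry supplies one.
  sumOver-except-⊤ : ∀ n (g f : Subset n → ℤₚ) → (∀ J x → x ∉ J → g J ≈ f J) → g ⊤ ≈ 0# →
                     sumOver (allSubsets n) g + f ⊤ ≈ sumOver (allSubsets n) f
  sumOver-except-⊤ zero g f h h⊤ k = lv-trans
    (lv-+ {w = f Vec.[]} (lv-trans (+-identityʳ (g Vec.[]) k) (h⊤ k)) lv-refl) (+-comm 0# (f Vec.[]) k)
  sumOver-except-⊤ (suc n) g f h h⊤ k = begin
    sumOver (allSubsets (suc n)) g + f ⊤
      ≈⟨ lv-+ (sumOver-allSubsets n g k) lv-refl ⟩
    (sumOver xs (g ∘ (outside Vec.∷_)) + sumOver xs (g ∘ (inside Vec.∷_))) + f ⊤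
      ≈⟨ +-assoc (sumOver xs (g ∘ (outside Vec.∷_))) (sumOver xs (g ∘ (inside Vec.∷_))) (f ⊤) k ⟩
    sumOver xs (g ∘ (outside Vec.∷_)) + (sumOver xs (g ∘ (inside Vec.∷_)) + f ⊤)
      ≈⟨ lv-+ (sumOver-level xs λ J → h (outside Vec.∷ J) zero (λ ()) k)
           (sumOver-except-⊤ n (g ∘ (inside Vec.∷_)) (f ∘ (inside Vec.∷_)) (λ J x x∉J → h (inside Vec.∷ J) (suc x) (x∉J ∘ drop-there)) h⊤ k) ⟩
    sumOver xs (f ∘ (outside Vec.∷_)) + sumOver xs (f ∘ (inside Vec.∷_))
      ≈⟨ sumOver-allSubsets n f k ⟨
    sumOver (allSubsets (suc n)) f ∎
    where
      open lv-Reasoning k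
      xs = allSubsets n

  if-yes : ∀ {P : Set} (d : Dec P) {x y : ℤₚ} → P → (if does d then x else y) ≈ x
  if-yes (yes _) _ = ≈-refl
  if-yes (no ¬p) p = contradiction p ¬p

  if-no : ∀ {P : Set} (d : Dec P) {x y : ℤₚ} → ¬ P → (if does d then x else y) ≈ y
  if-no (yes p) ¬p = contradiction p ¬p
  if-no (no _)  _  = ≈-refl

  sumOver-properSubsets∋0 : ∀ n (f : Subset (suc n) → ℤₚ) →
    sumOver (properSubsets∋0 n) f + f ⊤ ≈ sumOver (allSubsets n) (f ∘ (inside Vec.∷_))
  sumOver-properSubsets∋0 n f k = begin
    sumOver (properSubsets∋0 n) f + f ⊤
      ≈⟨ lv-+ (sumOver-filter (λ J → (zero ∈? J) ×-dec (J ⊂? ⊤)) (allSubsets (suc n)) f k) lv-refl ⟩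
    sumOver (allSubsets (suc n)) g + f ⊤
      ≈⟨ lv-+ (sumOver-allSubsets n g k) lv-refl ⟩
    (sumOver xs (λ _ → 0#) + sumOver xs (g ∘ (inside Vec.∷_))) + f ⊤
      ≈⟨ lv-+ (lv-trans (lv-+ (sumOver-zero xs k) lv-refl) (+-identityˡ (sumOver xs (g ∘ (inside Vec.∷_))) k)) lv-refl ⟩
    sumOver xs (g ∘ (inside Vec.∷_)) + f ⊤
      ≈⟨ sumOver-except-⊤ n (g ∘ (inside Vec.∷_)) (f ∘ (inside Vec.∷_))
           (λ J x x∉J → if-yes ((inside Vec.∷ J) ⊂? ⊤) ((λ _ → ∈⊤) , suc x , ∈⊤ , x∉J ∘ drop-there))
           (if-no ((inside Vec.∷ ⊤ {n}) ⊂? ⊤) λ { (_ , x , _ , x∉⊤) → x∉⊤ ∈⊤ }) k ⟩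
    sumOver xs (f ∘ (inside Vec.∷_)) ∎
    where
      open lv-Reasoning k
      xs = allSubsets n
      g : Subset (suc n) → ℤₚ
      g J = if does ((zero ∈? J) ×-dec (J ⊂? ⊤)) then f J else 0#

  riemannSum-cong : ∀ μ N r {f g} → (∀ x → f x ≈ g x) → riemannSum μ N r f ≈ riemannSum μ N r g
  riemannSum-cong μ N r h k = riemannSum-level μ N r k λ x → h x k

  riemannSum-* : ∀ μ N r c f → riemannSum μ N r (λ x → c * f x) ≈ c * riemannSum μ N r f
  riemannSum-* μ N zero    c f = ≈-refl
  riemannSum-* μ N (suc r) c f k = lv-trans
    (lv-sum {k} {w = λ j → c * (mass μ N j * R j)} λ j → lv-trans
      (lv-* {k} {mass μ N j} lv-refl (riemannSum-* μ N r c (λ x → f (fromℤ (+ toℕ j) ∷ x)) k))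
      (level (mod-reflexive (lemma (approx (mass μ N j) k) (approx c k) (approx (R j) k)))))
    (lv-sym (*-distribˡ-sum c (λ j → mass μ N j * R j) k))
    where
      R : Fin (p ℕ.^ N) → ℤₚ
      R j = riemannSum μ N r (λ x → f (fromℤ (+ toℕ j) ∷ x))
      lemma : ∀ m c r → m ℤ.* (c ℤ.* r) ≡ c ℤ.* (m ℤ.* r)
      lemma = solve-∀

  riemannSum-zero : ∀ μ N r → riemannSum μ N r (λ _ → 0#) ≈ 0#
  riemannSum-zero μ N zero    = ≈-refl
  riemannSum-zero μ N (suc r) = sum-zero λ j k → lv-zeroʳ (mass μ N j) (riemannSum-zero μ N r k)

  module _ (μ : Measure) (N : ℕ)
    (odd : ∀ (i j : Fin (p ℕ.^ N)) → + toℕ i ≡ ℤ.- (+ toℕ j) [mod P^ N ] → mass μ N i ≈ - mass μ N j) where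
    private instance
      P≢0 : NonZero (p ℕ.^ N)
      P≢0 = p^≢0 N

    -- Reindexing each coordinate by j ↦ -j contributes one sign. The representative `opposite j`
    -- equals -j only modulo p^N, so f must be unable to distinguish such points modulo pᵏ.
    riemannSum-odd : ∀ r f k → ModulusAt f k N → riemannSum μ N r f ≈[ k ] (- 1#) ^ r * riemannSum μ N r (λ x → f (λ i → - x i))
    riemannSum-odd zero    f k h = lv-trans (h _ _ (λ ())) (lv-sym (*-identityˡ _ k))
    riemannSum-odd (suc r) f k h = begin
      sum (λ j → mass μ N j * R (fromℤ (+ toℕ j)))
        ≈⟨ sum-opposite (λ j → mass μ N j * R (fromℤ (+ toℕ j))) k ⟩
      sum (λ j → mass μ N (opposite j) * R (fromℤ (+ toℕ (opposite j))))
        ≈⟨ lv-sum (λ j → lv-* (odd (opposite j) j (opposite-mod j) k) (step j)) ⟩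
      sum (λ j → - mass μ N j * ((- 1#) ^ r * S j))
        ≈⟨ lv-sum {w = λ j → (- 1#) ^ suc r * (mass μ N j * S j)} (λ j → level (mod-reflexive (lemma (approx (mass μ N j) k) (approx ((- 1#) ^ r) k) (approx (S j) k)))) ⟩
      sum (λ j → (- 1#) ^ suc r * (mass μ N j * S j))
        ≈⟨ *-distribˡ-sum ((- 1#) ^ suc r) (λ j → mass μ N j * S j) k ⟨
      (- 1#) ^ suc r * sum (λ j → mass μ N j * S j) ∎
      where
        open lv-Reasoning k
        lemma : ∀ m e s → ℤ.- m ℤ.* (e ℤ.* s) ≡ (ℤ.- + 1 ℤ.* e) ℤ.* (m ℤ.* s)
        lemma = solve-∀
        R : ℤₚ → ℤₚ
        R a = riemannSum μ N r (λ x → f (a ∷ x))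
        S : Fin (p ℕ.^ N) → ℤₚ
        S j = riemannSum μ N r (λ x → f (λ i → - (fromℤ (+ toℕ j) ∷ x) i))
        neg-∷ : ∀ (a : ℤₚ) (x : Vector ℤₚ r) i → ((- a) ∷ (λ i → - x i)) i ≈[ N ] - (a ∷ x) i
        neg-∷ a x zero    = lv-refl
        neg-∷ a x (suc i) = lv-refl
        step : ∀ j → R (fromℤ (+ toℕ (opposite j))) ≈[ k ] (- 1#) ^ r * S j
        step j = begin
          R (fromℤ (+ toℕ (opposite j)))
            ≈⟨ riemannSum-level μ N r k (λ x → h _ _ (∷-level (level (opposite-mod j)) λ _ → lv-refl)) ⟩
          R (- fromℤ (+ toℕ j))
            ≈⟨ riemannSum-odd r (λ x → f ((- fromℤ (+ toℕ j)) ∷ x)) k (λ x y e → h _ _ (∷-level lv-refl e)) ⟩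
          (- 1#) ^ r * riemannSum μ N r (λ x → f ((- fromℤ (+ toℕ j)) ∷ (λ i → - x i)))
            ≈⟨ lv-* {k} {(- 1#) ^ r} lv-refl (riemannSum-level μ N r k (λ x → h _ _ (neg-∷ (fromℤ (+ toℕ j)) x))) ⟩
          (- 1#) ^ r * S j ∎

  sum-δ : ∀ n {{_ : NonZero n}} (d F : ℕ → ℤₚ) → d 0 ≈ 1# → (∀ i → suc i < n → d (suc i) ≈ 0#) →
          sum {n} (λ j → d (toℕ j) * F (toℕ j)) ≈ F 0
  sum-δ (suc n) d F h0 h k = lv-trans
    (lv-+ {k} {d 0 * F 0} {1# * F 0} {_} {0#} (lv-* (h0 k) lv-refl)
      (sum-zero {n} {λ j → d (suc (toℕ j)) * F (suc (toℕ j))} (λ j k → lv-trans (lv-* {k} {d (suc (toℕ j))} {0#} {F (suc (toℕ j))} (h (toℕ j) (s≤s (Fin.toℕ<n j)) k) lv-refl) (zeroˡ (F (suc (toℕ j))) k)) k))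
    (exactly {1# * F 0 + 0#} {F 0} (λ m → lemma (approx (F 0) m)) k)
    where lemma : ∀ x → + 1 ℤ.* x ℤ.+ + 0 ≡ x
          lemma = solve-∀

  δ-zero : ∀ N → δ N (+ 0) ≡ + 1
  δ-zero N = indicator-yes (P^ N ℤ∣.∣? + 0) (divides (+ 0) refl)

  δ-suc : ∀ N i → suc i < p ℕ.^ N → δ N (+ suc i) ≡ + 0
  δ-suc N i lt = indicator-no (P^ N ℤ∣.∣? + suc i) λ d → ℕ.<⇒≱ lt (ℕ.∣⇒≤ (ℤ∣.∣⇒∣ᵤ d))

  -- Multilinear expansion of (μ + hδ₀)ʳ.
  module _ (μ ν : Measure) (h : ℤₚ) (N : ℕ) (ν≈ : ∀ j → mass ν N j ≈ mass μ N j + h * fromℤ (δ N (+ toℕ j))) where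
    expansionTerm : ∀ {r} → (Vector ℤₚ r → ℤₚ) → Subset r → ℤₚ
    expansionTerm {r} f J = h ^ (r ℕ.∸ ∣ J ∣) * riemannSum μ N ∣ J ∣ (f ∘ extend J)

    riemannSum-split : ∀ r f → riemannSum ν N (suc r) f ≈
      sum (λ j → mass μ N j * riemannSum ν N r (λ x → f (fromℤ (+ toℕ j) ∷ x))) + h * riemannSum ν N r (λ x → f (0# ∷ x))
    riemannSum-split r f k = begin
      sum (λ j → mass ν N j * F (toℕ j))
        ≈⟨ lv-sum {w = λ j → u j + h * v j} (λ j → lv-trans (lv-* (ν≈ j k) lv-refl)
             (level (mod-reflexive (lemma (approx (mass μ N j) k) (approx h k) (δ N (+ toℕ j)) (approx (F (toℕ j)) k))))) ⟩
      sum (λ j → u j + h * v j)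
        ≈⟨ ∑-distrib-+ u (λ j → h * v j) k ⟩
      sum u + sum (λ j → h * v j)
        ≈⟨ lv-+ {k} {sum u} lv-refl (lv-trans (lv-sym (*-distribˡ-sum h v k)) (lv-* {k} {h} lv-refl
             (sum-δ (p ℕ.^ N) {{p^≢0 N}} (λ i → fromℤ (δ N (+ i))) F (exactly λ _ → δ-zero N) (λ i lt → exactly λ _ → δ-suc N i lt) k))) ⟩
      sum u + h * F 0 ∎
      where
        open lv-Reasoning k
        F : ℕ → ℤₚ
        F i = riemannSum ν N r (λ x → f (fromℤ (+ i) ∷ x))
        u v : Fin (p ℕ.^ N) → ℤₚ
        u j = mass μ N j * F (toℕ j)
        v j = fromℤ (δ N (+ toℕ j)) * F (toℕ j)
        lemma : ∀ m h d f → (m ℤ.+ h ℤ.* d) ℤ.* f ≡ m ℤ.* f ℤ.+ h ℤ.* (d ℤ.* f)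
        lemma = solve-∀

    riemannSum-expansion : ∀ r f → riemannSum ν N r f ≈ sumOver (allSubsets r) (expansionTerm f)
    riemannSum-expansion zero    f = exactly λ n → lemma (approx (f (λ ())) n)
      where lemma : ∀ x → x ≡ + 1 ℤ.* x ℤ.+ + 0
            lemma = solve-∀
    riemannSum-expansion (suc r) f k = begin
      riemannSum ν N (suc r) f
        ≈⟨ riemannSum-split r f k ⟩
      sum (λ j → mass μ N j * riemannSum ν N r (f₁ j)) + h * riemannSum ν N r f₀
        ≈⟨ lv-+ (lv-sum {w = λ j → mass μ N j * sumOver xs (expansionTerm (f₁ j))} λ j → lv-* {k} {mass μ N j} lv-refl (riemannSum-expansion r (f₁ j) k))
                (lv-* {k} {h} lv-refl (riemannSum-expansion r f₀ k)) ⟩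
      sum (λ j → mass μ N j * sumOver xs (expansionTerm (f₁ j))) + h * sumOver xs (expansionTerm f₀)
        ≈⟨ lv-+ insides outsides ⟩
      sumOver xs (expansionTerm f ∘ (inside Vec.∷_)) + sumOver xs (expansionTerm f ∘ (outside Vec.∷_))
        ≈⟨ +-comm (sumOver xs (expansionTerm f ∘ (inside Vec.∷_))) (sumOver xs (expansionTerm f ∘ (outside Vec.∷_))) k ⟩
      sumOver xs (expansionTerm f ∘ (outside Vec.∷_)) + sumOver xs (expansionTerm f ∘ (inside Vec.∷_))
        ≈⟨ sumOver-allSubsets r (expansionTerm f) k ⟨
      sumOver (allSubsets (suc r)) (expansionTerm f) ∎
      where
        open lv-Reasoning k
        xs = allSubsets r
        f₁ : Fin (p ℕ.^ N) → Vector ℤₚ r → ℤₚ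
        f₁ j x = f (fromℤ (+ toℕ j) ∷ x)
        f₀ : Vector ℤₚ r → ℤₚ
        f₀ x = f (0# ∷ x)
        lemma : ∀ m h s → m ℤ.* (h ℤ.* s) ≡ h ℤ.* (m ℤ.* s)
        lemma = solve-∀
        outside-term : ∀ J → h * expansionTerm f₀ J ≈ expansionTerm f (outside Vec.∷ J)
        outside-term J k = lv-trans (lv-sym (*-assoc h (h ^ (r ℕ.∸ ∣ J ∣)) R₀ k))
            -- Subtraction is truncated, so drawing `suc` out of the difference relies on J having
            -- at most r elements.
            (lv-* {k} {h ^ suc (r ℕ.∸ ∣ J ∣)} {h ^ (suc r ℕ.∸ ∣ J ∣)} {R₀} (reflexive (cong (h ^_) (sym (ℕ.+-∸-assoc 1 (∣p∣≤n J)))) k) lv-refl)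
          where R₀ : ℤₚ
                R₀ = riemannSum μ N ∣ J ∣ (f₀ ∘ extend J)
        outsides : h * sumOver xs (expansionTerm f₀) ≈[ k ] sumOver xs (expansionTerm f ∘ (outside Vec.∷_))
        outsides = lv-trans (lv-sym (sumOver-* xs h (expansionTerm f₀) k)) (sumOver-level xs λ J → outside-term J k)
        inside-term : ∀ J → sum (λ j → mass μ N j * expansionTerm (f₁ j) J) ≈ expansionTerm f (inside Vec.∷ J)
        inside-term J k = lv-trans
            (lv-sum {w = λ j → h ^ (r ℕ.∸ ∣ J ∣) * (mass μ N j * R₁ j)} λ j →
              level (mod-reflexive (lemma (approx (mass μ N j) k) (approx (h ^ (r ℕ.∸ ∣ J ∣)) k) (approx (R₁ j) k))))
            (lv-sym (*-distribˡ-sum (h ^ (r ℕ.∸ ∣ J ∣)) (λ j → mass μ N j * R₁ j) k))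
          where R₁ : Fin (p ℕ.^ N) → ℤₚ
                R₁ j = riemannSum μ N ∣ J ∣ (f₁ j ∘ extend J)
        insides : sum (λ j → mass μ N j * sumOver xs (expansionTerm (f₁ j))) ≈[ k ] sumOver xs (expansionTerm f ∘ (inside Vec.∷_))
        insides = lv-trans
          (lv-sum {w = λ j → sumOver xs (λ J → mass μ N j * expansionTerm (f₁ j) J)} λ j → lv-sym (sumOver-* xs (mass μ N j) (expansionTerm (f₁ j)) k))
          (lv-trans (sumOver-sum xs (λ j J → mass μ N j * expansionTerm (f₁ j) J) k) (sumOver-level xs λ J → inside-term J k))

  -- The size of ⊤ does not reduce to n for a variable n. Induction compares the two sums directly,
  -- without transport along an equality of dimensions.
  riemannSum-⊤ : ∀ μ N n f → riemannSum μ N ∣ ⊤ {n} ∣ (f ∘ extend ⊤) ≈ riemannSum μ N n f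
  riemannSum-⊤ μ N zero    f = ≈-refl
  riemannSum-⊤ μ N (suc n) f k = lv-sum λ j → lv-* {k} {mass μ N j} lv-refl (riemannSum-⊤ μ N n (λ x → f (fromℤ (+ toℕ j) ∷ x)) k)

  -- The functional equation

  -- Division by 2 loses precision when p = 2.
  cancel-2 : Σ ℕ λ v → ∀ k x → fromℤ (+ 2) * x ≈[ k ℕ.+ v ] 0# → x ≈[ k ] 0#
  cancel-2 = proj₁ (cancel 2 _) , λ k x h → level (mod-trans (mod-sym (approx-lower x (ℕ.m≤m+n k (proj₁ (cancel 2 _)))))
    (∣⇒mod0 (proj₂ (cancel 2 _) k (approx x (k ℕ.+ proj₁ (cancel 2 _))) (mod0⇒∣ (at-level h)))))

  -- From level k + 2 on, the Riemann sums are constant modulo pᵏ. The 2 is the continuity modulus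
  -- of the integrand: for p = 2 the component ω depends on the residue modulo 4.
  L-riemannSum : ∀ {r} (s : Vector ℤₚ r) n γ c k N → k ℕ.+ 2 ≤ N → riemannSum (m̃ c) N r (integrand s n γ) ≈[ k ] L s n γ c
  L-riemannSum {r} s n γ c k N le = proj₂ (limit-converges (λ N → riemannSum (m̃ c) N r (integrand s n γ))
    (riemannSum-Cauchy (m̃ c) r (integrand-continuous s n γ)) k) N le

  module _ {m : ℕ} (n : Vector ℤ (suc m)) (odd : ¬ (sumℤ n ≡ + suc m [mod + 2 ])) (γ : Vector ℤₚ (suc m)) (c : ℤₚˣ) (s : Vector ℤₚ (suc m)) where
    r = suc m

    f : Vector ℤₚ r → ℤₚ
    f = integrand s n γ

    modulus : ∀ k {N} → k ℕ.+ 2 ≤ N → ModulusAt f k N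
    modulus k le x y e = proj₂ (integrand-continuous s n γ k) x y λ i → lv-lower le (e i)

    oddMeasure-riemannSum-neg : ∀ k N → k ℕ.+ 2 ≤ N → riemannSum (oddMeasure c) N r f ≈[ k ] - riemannSum (oddMeasure c) N r f
    oddMeasure-riemannSum-neg k N le = begin
      X
        ≈⟨ riemannSum-odd (oddMeasure c) N (oddMeasure-odd c N) r f k (modulus k le) ⟩
      (- 1#) ^ r * riemannSum (oddMeasure c) N r (λ x → f (λ i → - x i))
        ≈⟨ lv-* {k} {(- 1#) ^ r} lv-refl (riemannSum-cong (oddMeasure c) N r (integrand-neg s n γ) k) ⟩
      (- 1#) ^ r * riemannSum (oddMeasure c) N r (λ x → product (ε ∘ n) * f x)
        ≈⟨ lv-* {k} {(- 1#) ^ r} lv-refl (riemannSum-* (oddMeasure c) N r (product (ε ∘ n)) f k) ⟩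
      (- 1#) ^ r * (product (ε ∘ n) * X)
        ≈⟨ *-assoc ((- 1#) ^ r) (product (ε ∘ n)) X k ⟨
      ((- 1#) ^ r * product (ε ∘ n)) * X
        ≈⟨ lv-* (total-sign n odd k) lv-refl ⟩
      fromℤ (ℤ.- + 1) * X
        ≈⟨ level (mod-reflexive (ℤ.-1*i≡-i (approx X k))) ⟩
      - X ∎
      where
        open lv-Reasoning k
        X = riemannSum (oddMeasure c) N r f

    oddMeasure-riemannSum-zero : ∀ k → Σ ℕ λ N → Σ (k ℕ.+ 2 ≤ N) λ _ → riemannSum (oddMeasure c) N r f ≈[ k ] 0#
    oddMeasure-riemannSum-zero k = N , ℕ.+-monoˡ-≤ 2 (ℕ.m≤m+n k v) , proj₂ cancel-2 k X (lv-trans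
        (level (mod-reflexive (lemma (approx X (k ℕ.+ v)))))
        (lv-trans (lv-+ {k ℕ.+ v} {X} lv-refl (oddMeasure-riemannSum-neg (k ℕ.+ v) N ℕ.≤-refl)) (-‿inverseʳ X (k ℕ.+ v))))
      where
        v N : ℕ
        v = proj₁ cancel-2
        -- The v digits are lost when 2 is cancelled from 2X = 0; the final 2 is the modulus of the
        -- integrand.
        N = k ℕ.+ v ℕ.+ 2
        X = riemannSum (oddMeasure c) N r f
        lemma : ∀ x → + 2 ℤ.* x ≡ x ℤ.+ x
        lemma = solve-∀

    term : Subset r → ℤₚ
    term J = [1- c ]/2 ^ (r ℕ.∸ ∣ J ∣) *
      L (blockSum +-rawMonoid J s) (blockSum +-0-rawMonoid J n) (γ ∘ element J) c

    module _ (k N : ℕ) (le : k ℕ.+ 2 ≤ N) where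
      expansion : Subset r → ℤₚ
      expansion = expansionTerm (m̃ c) (oddMeasure c) [1- c ]/2 N (oddMeasure-mass c N) f

      expansion-outside : ∀ J → expansion (outside Vec.∷ J) ≈[ k ] 0#
      expansion-outside J = lv-zeroʳ ([1- c ]/2 ^ (r ℕ.∸ ∣ J ∣)) (lv-trans
        (riemannSum-cong (m̃ c) N ∣ J ∣ (λ x → integrand-zero s n γ (extend J x)) k) (riemannSum-zero (m̃ c) N ∣ J ∣ k))

      expansion-inside : ∀ J → expansion (inside Vec.∷ J) ≈[ k ] term (inside Vec.∷ J)
      expansion-inside J = lv-* {k} {[1- c ]/2 ^ (m ℕ.∸ ∣ J ∣)} lv-refl (lv-trans
        (riemannSum-cong (m̃ c) N (suc ∣ J ∣) (integrand-extend J s n γ) k)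
        (L-riemannSum (blockSum +-rawMonoid J′ s) (blockSum +-0-rawMonoid J′ n) (γ ∘ element J′) c k N le))
        where J′ = inside Vec.∷ J

      expansion-⊤ : expansion ⊤ ≈[ k ] L s n γ c
      expansion-⊤ = begin
        [1- c ]/2 ^ (r ℕ.∸ ∣ ⊤ {r} ∣) * R₁
          ≈⟨ lv-* {k} {[1- c ]/2 ^ (r ℕ.∸ ∣ ⊤ {r} ∣)} {1#} {R₁} {R₂}
               (reflexive (cong ([1- c ]/2 ^_) (trans (cong (r ℕ.∸_) (∣⊤∣≡n r)) (ℕ.n∸n≡0 r))) k)
               (riemannSum-⊤ (m̃ c) N r f k) ⟩
        1# * R₂
          ≈⟨ *-identityˡ R₂ k ⟩
        R₂
          ≈⟨ L-riemannSum s n γ c k N le ⟩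
        L s n γ c ∎
        where
          open lv-Reasoning k
          R₁ R₂ : ℤₚ
          R₁ = riemannSum (m̃ c) N ∣ ⊤ {r} ∣ (f ∘ extend ⊤)
          R₂ = riemannSum (m̃ c) N r f

      sum-of-terms : riemannSum (oddMeasure c) N r f ≈[ k ] sumOver (properSubsets∋0 m) term + L s n γ c
      sum-of-terms = begin
        riemannSum (oddMeasure c) N r f
          ≈⟨ riemannSum-expansion (m̃ c) (oddMeasure c) [1- c ]/2 N (oddMeasure-mass c N) r f k ⟩
        sumOver (allSubsets r) expansion
          ≈⟨ sumOver-allSubsets m expansion k ⟩
        sumOver xs (expansion ∘ (outside Vec.∷_)) + sumOver xs (expansion ∘ (inside Vec.∷_))
          ≈⟨ lv-+ (lv-trans (sumOver-level xs expansion-outside) (sumOver-zero xs k)) (sumOver-level xs expansion-inside) ⟩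
        0# + sumOver xs (term ∘ (inside Vec.∷_))
          ≈⟨ +-identityˡ (sumOver xs (term ∘ (inside Vec.∷_))) k ⟩
        sumOver xs (term ∘ (inside Vec.∷_))
          ≈⟨ sumOver-properSubsets∋0 m term k ⟨
        sumOver (properSubsets∋0 m) term + term ⊤
          -- The term at ⊤ has sums over one-element blocks as arguments and is not literally L.
          -- Both are compared with the same Riemann sum instead of with each other.
          ≈⟨ lv-+ {k} {sumOver (properSubsets∋0 m) term} lv-refl (lv-trans (lv-sym (expansion-inside ⊤)) expansion-⊤) ⟩
        sumOver (properSubsets∋0 m) term + L s n γ c ∎
        where
          open lv-Reasoning k
          xs = allSubsets m

    functional-equation : L s n γ c ≈ - sumOver (properSubsets∋0 m) term
    functional-equation k = go (oddMeasure-riemannSum-zero k)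
      where
        S ℓ : ℤₚ
        S = sumOver (properSubsets∋0 m) term
        ℓ = L s n γ c
        lemma : ∀ s l → l ≡ (s ℤ.+ l) ℤ.- s
        lemma = solve-∀
        go : (Σ ℕ λ N → Σ (k ℕ.+ 2 ≤ N) λ _ → riemannSum (oddMeasure c) N r f ≈[ k ] 0#) → ℓ ≈[ k ] - S
        go (N , le , zero′) = begin
          ℓ                                     ≈⟨ exactly {ℓ} {(S + ℓ) - S} (λ m → lemma (approx S m) (approx ℓ m)) k ⟩
          (S + ℓ) - S                           ≈⟨ lv-+ (lv-trans (lv-sym (sum-of-terms k N le)) zero′) lv-refl ⟩
          0# - S                                ≈⟨ +-identityˡ (- S) k ⟩
          - S                                   ∎
          where open lv-Reasoning k

theorem2p15 : (p : ℕ) (p-prime : Prime p) → let open PAdic p p-prime in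
    (m : ℕ) → let r = suc (suc m) in
    (k : Vector ℤ r) → ¬ (sumℤ k ≡ + r [mod + 2 ]) →
    (γ : Vector ℤₚ r) → (∀ (j : Fin (suc m)) → pₚ ∣ γ (suc j)) →
    (c : ℤₚˣ) (s : Vector ℤₚ r) →
    L s k γ c ≈
    - sumOver (properSubsets∋0 (suc m)) λ J →
    [1- c ]/2 ^ (r ∸ ∣ J ∣) *
    L (blockSum +-rawMonoid J s) (blockSum +-0-rawMonoid J k) (γ ∘ element J) c
theorem2p15 p p-prime m k k-odd γ _ c s = FunctionalEquation.functional-equation p p-prime k k-odd γ c s
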